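{- Let $D$ be a $2$-arc-strong semicomplete split digraph. Then for every choice of (not necessarily distinct) vertices $u,v$ of $D$, the digraph $D$ contains a good $(u,v)$-pair, i.e. an out-branching of $D$ rooted at $u$ and an in-branching of $D$ rooted at $v$ that are arc-disjoint.
   Context: All digraphs are finite and have no loops and no parallel arcs; opposite arcs $xy$ and $yx$ may both be present. Two distinct vertices $x,y$ are adjacent if at least one of $xy$, $yx$ is an arc. A digraph is semicomplete if every two distinct vertices are adjacent. A digraph $D=(V,A)$ is $k$-arc-strong if $D\setminus A'$ is strong (strongly connected) for every $A'\subseteq A$ with $|A'|\le k-1$. A semicomplete split digraph is a digraph $D$ whose vertex set is the disjoint union of two non-empty sets $V_1$ and $V_2$ such that $V_1$ is an independent set (no two vertices of $V_1$ are adjacent), the subdigraph induced by $V_2$ is semicomplete, and every vertex of $V_1$ is adjacent to every vertex of $V_2$. An out-branching (resp. in-branching) of $D$ rooted at $r$ is a spanning subdigraph of $D$ that is an oriented tree in which every vertex except the root $r$ has in-degree (resp. out-degree) exactly one, the root having in-degree (resp. out-degree) zero. A good $(u,v)$-pair in $D$ is a pair consisting of an out-branching of $D$ rooted at $u$ and an in-branching of $D$ rooted at $v$ which have no arc in common. -}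

module Defs where

open import Data.Fin using (Fin; zero; suc; inject₁; fromℕ)
open import Data.Fin.Subset using (Subset; _∈_; _∉_; _⊆_; _∪_; _∩_; _─_; ∣_∣; ⊤; Nonempty; Empty)
open import Data.Fin.Subset.Properties using (p─q⊆p)
open import Data.Nat using (ℕ; suc; _≤_; _<_)
open import Data.Product using (_×_; Σ-syntax)
open import Data.Sum using (_⊎_)
open import Data.Vec using (lookup; sum; tabulate)
open import Function using (_∘_)
open import Function.Definitions using (Injective)
open import Relation.Binary.Construct.Closure.ReflexiveTransitive using (Star)
open import Relation.Binary.PropositionalEquality using (_≡_; _≢_)
open import Relation.Nullary using (¬_)

-- A set of ordered pairs of vertices, given by out-neighbourhoods:
-- the pair (x , y) belongs to A exactly when y ∈ A x.
ArcSet : ℕ → Set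
ArcSet n = Fin n → Subset n

_⊆ᴬ_ : ∀ {n} → ArcSet n → ArcSet n → Set
A ⊆ᴬ B = ∀ x → A x ⊆ B x

size : ∀ {n} → ArcSet n → ℕ
size A = sum (tabulate (λ x → ∣ A x ∣))

-- Opposite arcs are allowed; parallel arcs are excluded by the use of arc sets.
record Digraph (n : ℕ) : Set where
  field
    arcs     : ArcSet n
    loopless : ∀ x → x ∉ arcs x

open Digraph public

module _ {n : ℕ} (D : Digraph n) where

  Arc : Fin n → Fin n → Set
  Arc x y = y ∈ arcs D x

  -- By looplessness, adjacent vertices are distinct.
  Adjacent : Fin n → Fin n → Set
  Adjacent x y = Arc x y ⊎ Arc y x

  outDegree : Fin n → ℕ
  outDegree x = ∣ arcs D x ∣

  inDegree : Fin n → ℕ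
  inDegree x = ∣ tabulate (λ y → lookup (arcs D y) x) ∣

  Strong : Set
  Strong = ∀ x y → Star Arc x y

  Independent : Subset n → Set
  Independent S = ∀ x y → x ∈ S → y ∈ S → ¬ Adjacent x y

  -- The subdigraph induced by S is semicomplete.
  SemicompleteOn : Subset n → Set
  SemicompleteOn S = ∀ x y → x ∈ S → y ∈ S → x ≢ y → Adjacent x y

_∖_ : ∀ {n} → Digraph n → ArcSet n → Digraph n
arcs     (D ∖ A) x = arcs D x ─ A x
loopless (D ∖ A) x = loopless D x ∘ p─q⊆p (arcs D x) (A x)

-- size A < k is |A| ≤ k - 1 without truncated subtraction.
ArcStrong : ∀ {n} → ℕ → Digraph n → Set
ArcStrong k D = ∀ A → A ⊆ᴬ arcs D → size A < k → Strong (D ∖ A)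

record SemicompleteSplit {n : ℕ} (D : Digraph n) : Set where
  field
    V₁ V₂        : Subset n
    cover        : V₁ ∪ V₂ ≡ ⊤
    disjoint     : Empty (V₁ ∩ V₂)
    nonempty₁    : Nonempty V₁
    nonempty₂    : Nonempty V₂
    independent  : Independent D V₁
    semicomplete : SemicompleteOn D V₂
    complete     : ∀ x y → x ∈ V₁ → y ∈ V₂ → Adjacent D x y

-- A cycle c₀ c₁ … cₘ c₀ of the underlying undirected graph, with m + 1 ≥ 3
-- pairwise distinct vertices.
record UndirectedCycle {n : ℕ} (D : Digraph n) : Set where
  field
    m        : ℕ
    m≥2      : 2 ≤ m
    c        : Fin (suc m) → Fin n
    distinct : Injective _≡_ _≡_ c
    step     : ∀ (i : Fin m) → Adjacent D (c (inject₁ i)) (c (suc i))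
    close    : Adjacent D (c (fromℕ m)) (c zero)

-- An orientation of a tree: no two opposite arcs, and the underlying
-- undirected graph is connected and acyclic.
record OrientedTree {n : ℕ} (T : Digraph n) : Set where
  field
    oriented  : ∀ x y → ¬ (Arc T x y × Arc T y x)
    connected : ∀ x y → Star (Adjacent T) x y
    acyclic   : ¬ UndirectedCycle T

-- T has the same vertex set Fin n as D, hence is spanning.
SpanningSubdigraph : ∀ {n} → Digraph n → Digraph n → Set
SpanningSubdigraph T D = arcs T ⊆ᴬ arcs D

record OutBranching {n : ℕ} (D : Digraph n) (r : Fin n) (T : Digraph n) : Set where
  field
    spanning : SpanningSubdigraph T D
    tree     : OrientedTree T
    root     : inDegree T r ≡ 0
    nonroot  : ∀ x → x ≢ r → inDegree T x ≡ 1

record InBranching {n : ℕ} (D : Digraph n) (r : Fin n) (T : Digraph n) : Set where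
  field
    spanning : SpanningSubdigraph T D
    tree     : OrientedTree T
    root     : outDegree T r ≡ 0
    nonroot  : ∀ x → x ≢ r → outDegree T x ≡ 1

ArcDisjoint : ∀ {n} → Digraph n → Digraph n → Set
ArcDisjoint S T = ∀ x y → ¬ (Arc S x y × Arc T x y)

GoodPair : ∀ {n} → Digraph n → Fin n → Fin n → Set
GoodPair {n} D u v =
  Σ[ O ∈ Digraph n ] Σ[ I ∈ Digraph n ]
    (OutBranching D u O × InBranching D v I × ArcDisjoint O I)

{-# OPTIONS --safe #-}
-- A good pair is a colouring of the arcs in which one colour reaches everything from u and the
-- other reaches v from everywhere.
--
-- Hub argument.  Suppose an out-tree from u and an in-tree to v are arc-disjoint and share a vertex
-- w of V₂.  Every other vertex is adjacent to w and is attached to one of the trees (or to both);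
-- let P and Q be the vertices still missing from the out-tree and from the in-tree.  By
-- 2-arc-strength two arcs enter each subset of P and two arcs leave each subset of Q, so each part
-- can be absorbed into the trees alternately: an arc from Q to P that serves one tree costs the
-- other side one arc at a single vertex, and this one deficiency is repaired in the next step.
-- Hence one deficient vertex on one side is harmless from the start.
--
-- Tight cuts.  If only two arcs lead from a set N containing u to its complement K containing v
-- (both with at least two vertices), then Edmonds' branching theorem inside N and inside K gives a
-- good pair directly, since all other arcs between N and K go back to N.  Otherwise such cuts have
-- three arcs, and the arcs used at the roots themselves cause no deficiency.
--
-- It remains to find a suitable start.  If u → a → v with a in V₂, the hub is a.  Otherwise the hub
-- is u (or v, or an out-neighbour of u when both roots are in V₁), the in-tree is a path to v whose
-- removal keeps everything reachable, and all deficient vertices of this path lie behind a single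
-- one because the in-neighbours of v in V₂ are adjacent to each other.
module Submission where

open import Defs
open import Data.Nat using (ℕ)
open import Data.Fin using (Fin)

import Data.Bool as Bool
open import Data.Bool using (Bool; true; false; _∧_; _∨_; not; if_then_else_)
open import Data.Bool.Properties using (∨-zeroʳ)
open import Data.Empty using (⊥; ⊥-elim)
open import Data.Fin using (zero; suc; _≟_; inject₁; fromℕ; toℕ)
open import Data.Fin.Properties using (any?; toℕ-inject₁)
open import Data.Fin.Relation.Unary.Top using (View; view; ‵fromℕ; ‵inject₁)
open import Data.Fin.Subset using (Subset; ∣_∣; _─_; ⁅_⁆) renaming (_∈_ to _∈ˢ_; _∉_ to _∉ˢ_; ⊥ to ∅)
open import Data.Fin.Subset.Properties using (p─q⊆p; x∈⁅x⁆; x∈⁅y⁆⇒x≡y; ∉⊥; ∣⊥∣≡0; ∣⁅x⁆∣≡1; x∈p∪q⁻; ∈⊤; p⊂q⇒∣p∣<∣q∣)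
open import Data.List using (List; []; _∷_; _++_)
import Data.List.Membership.DecPropositional as DecMembership
open import Data.List.Membership.Propositional using (_∈_; _∉_)
open import Data.List.Membership.Propositional.Properties using (∈-++⁺ˡ; ∈-++⁺ʳ; ∈-++⁻)
open import Data.List.Relation.Unary.Any using (here; there)
open import Data.Nat using (zero; suc; _+_; _≤_; _<_; z≤n; s≤s)
open import Data.Nat.Induction using (<-wellFounded)
open import Data.Nat.Properties using (≤-refl; ≤-trans; ≤-pred; ≤-reflexive; ≤-total; ≤-<-trans; <-trans; <-irrefl; <⇒≢; n<1+n; m≤n⇒m≤1+n; +-comm; +-monoˡ-≤)
open import Data.Product using (Σ; ∃; ∃₂; _×_; _,_; proj₁; proj₂)
open import Data.Product.Properties using (≡-dec)
import Data.Sum as Sum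
open import Data.Sum using (_⊎_; inj₁; inj₂; swap)
open import Data.Vec using ([]; _∷_; tabulate; lookup; sum; here; there)
open import Data.Vec.Properties using (lookup∘tabulate; lookup⇒[]=; []=⇒lookup; tabulate-cong)
open import Function using (_∘_; flip; id)
open import Function.Definitions using (Injective)
open import Induction.WellFounded using (Acc; acc)
open import Relation.Binary.Construct.Closure.ReflexiveTransitive using (Star; ε; _◅_; _◅◅_)
import Relation.Binary.Construct.Closure.ReflexiveTransitive as Star
open import Relation.Binary.PropositionalEquality using (_≡_; _≢_; refl; sym; trans; cong; subst)
open import Relation.Nullary using (¬_; Dec; yes; no)
open import Relation.Nullary.Decidable using (⌊_⌋; _×-dec_; ¬?)

-- An arc of the second kind is never lost, since a tree only takes arcs joining vertices that it
-- does not yet contain. Such arcs are supplied by `cover`: a walk through vertices missing from one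
-- tree runs through the other. The obstacle is the start: the arcs of the initial trees are lost
-- from the outset and only one deficient vertex can be repaired, so the trees of each case are
-- chosen such that all losses are charged to one vertex. Sets with a root and a further vertex
-- escape local control; for these the tight cuts are needed. Which cut matters is known only while
-- the trees grow, so the conditions carry an alternative outcome that ends the argument at once.

Pred : ℕ → Set
Pred n = Fin n → Bool

BRel : ℕ → Set
BRel n = Fin n → Fin n → Bool

_∋_ : ∀ {n} → Pred n → Fin n → Set
S ∋ x = S x ≡ true

_∌_ : ∀ {n} → Pred n → Fin n → Set
S ∌ x = S x ≡ false

infix 4 _∋_ _∌_

true≢false : ∀ {b : Bool} → b ≡ true → b ≡ false → ⊥
true≢false refl ()

true? : ∀ (b : Bool) → Dec (b ≡ true)
true? b = b Bool.≟ true

¬true⇒false : ∀ {b : Bool} → ¬ b ≡ true → b ≡ false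
¬true⇒false {true}  h = ⊥-elim (h refl)
¬true⇒false {false} _ = refl

bool-cases : ∀ (b : Bool) → b ≡ true ⊎ b ≡ false
bool-cases true  = inj₁ refl
bool-cases false = inj₂ refl

∧-true : ∀ {a b : Bool} → a ≡ true → b ≡ true → a ∧ b ≡ true
∧-true refl refl = refl

∧-true⁻ : ∀ {a b : Bool} → a ∧ b ≡ true → a ≡ true × b ≡ true
∧-true⁻ {true} {true} refl = refl , refl

∨-trueˡ : ∀ {a b : Bool} → a ≡ true → a ∨ b ≡ true
∨-trueˡ refl = refl

∨-trueʳ : ∀ {a b : Bool} → b ≡ true → a ∨ b ≡ true
∨-trueʳ {a} refl = ∨-zeroʳ a

∨-true⁻ : ∀ {a b : Bool} → a ∨ b ≡ true → a ≡ true ⊎ b ≡ true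
∨-true⁻ {true}  _ = inj₁ refl
∨-true⁻ {false} h = inj₂ h

∨-false : ∀ {a b : Bool} → a ≡ false → b ≡ false → a ∨ b ≡ false
∨-false refl refl = refl

∨-false⁻ : ∀ {a b : Bool} → a ∨ b ≡ false → a ≡ false × b ≡ false
∨-false⁻ {false} {false} refl = refl , refl

not-true : ∀ {a : Bool} → a ≡ false → not a ≡ true
not-true refl = refl

not-false : ∀ {a : Bool} → a ≡ true → not a ≡ false
not-false refl = refl

not-true⁻ : ∀ {a : Bool} → not a ≡ true → a ≡ false
not-true⁻ {false} refl = refl

not-false⁻ : ∀ {a : Bool} → not a ≡ false → a ≡ true
not-false⁻ {true} refl = refl

∋∌⇒≢ : ∀ {n} {S : Pred n} {x y : Fin n} → S ∋ x → S ∌ y → x ≢ y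
∋∌⇒≢ p q refl = true≢false p q

_⊕_ : ∀ {n} → Pred n → Fin n → Pred n
(S ⊕ x) y = ⌊ x ≟ y ⌋ ∨ S y

⊕-new : ∀ {n} (S : Pred n) (x : Fin n) → (S ⊕ x) ∋ x
⊕-new S x with x ≟ x
... | yes _  = refl
... | no x≢x = ⊥-elim (x≢x refl)

⊕-old : ∀ {n} (S : Pred n) (x : Fin n) {y : Fin n} → S ∋ y → (S ⊕ x) ∋ y
⊕-old S x p = ∨-trueʳ p

⊕-case : ∀ {n} (S : Pred n) (x : Fin n) {y : Fin n} → (S ⊕ x) ∋ y → y ≡ x ⊎ S ∋ y
⊕-case S x {y} p with x ≟ y
... | yes refl = inj₁ refl
... | no _     = inj₂ p

⊕-out : ∀ {n} (S : Pred n) (x : Fin n) {y : Fin n} → (S ⊕ x) ∌ y → y ≢ x × S ∌ y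
⊕-out S x {y} p with x ≟ y
... | no x≢y = (λ e → x≢y (sym e)) , p

single : ∀ {n} → Fin n → Pred n
single x = (λ _ → false) ⊕ x

single-∋ : ∀ {n} (x : Fin n) → single x ∋ x
single-∋ x = ⊕-new (λ _ → false) x

single-∋⁻ : ∀ {n} {x y : Fin n} → single x ∋ y → y ≡ x
single-∋⁻ {x = x} p with ⊕-case (λ _ → false) x p
... | inj₁ e = e

single-∌ : ∀ {n} {x y : Fin n} → y ≢ x → single x ∌ y
single-∌ y≢x = ¬true⇒false (λ p → y≢x (single-∋⁻ p))

single-∌⁻ : ∀ {n} {x y : Fin n} → single x ∌ y → y ≢ x
single-∌⁻ {x = x} p refl = true≢false (single-∋ x) p

compl : ∀ {n} → Pred n → Pred n
compl S x = not (S x)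

count : ∀ {n} → Pred n → ℕ
count S = ∣ tabulate S ∣

count-< : ∀ {n} (S T : Pred n) (x : Fin n) → (∀ y → S ∋ y → T ∋ y) → S ∌ x → T ∋ x → count S < count T
count-< S T x S⊆T x∉S x∈T = p⊂q⇒∣p∣<∣q∣ {p = tabulate S} {q = tabulate T}
  ( (λ {y} p → to T (S⊆T y (from S p)))
  , x , to T x∈T , λ p → true≢false (from S p) x∉S )
  where
  from : ∀ (S : Pred _) {y} → y ∈ˢ tabulate S → S ∋ y
  from S {y} p = trans (sym (lookup∘tabulate S y)) ([]=⇒lookup p)
  to : ∀ (S : Pred _) {y} → S ∋ y → y ∈ˢ tabulate S
  to S {y} p = lookup⇒[]= y (tabulate S) (trans (lookup∘tabulate S y) p)

-- Every unfinished step adds a vertex, so the number of missing vertices bounds the recursion.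
-- Closures, Edmonds branchings and parent trees are all obtained this way.
saturate : ∀ {n} {P D : Pred n → Set} →
  (∀ S → P S → D S ⊎ (∃ λ x → S ∌ x × P (S ⊕ x))) →
  ∀ S → P S → Σ (Pred n) (λ S′ → P S′ × D S′)
saturate {n} {P} {D} step S₀ p₀ = go (count (compl S₀)) S₀ ≤-refl p₀
  where
  go : ∀ k S → count (compl S) ≤ k → P S → Σ (Pred n) (λ S′ → P S′ × D S′)
  smaller : ∀ S x → S ∌ x → count (compl (S ⊕ x)) < count (compl S)
  smaller S x x∉S = count-< _ _ x
    (λ y q → not-true (proj₂ (⊕-out S x (not-true⁻ q))))
    (not-false (⊕-new S x)) (not-true x∉S)
  go k S le p with step S p
  ... | inj₁ d = S , p , d
  go zero S le p | inj₂ (x , x∉S , _) with ≤-trans (smaller S x x∉S) le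
  ... | ()
  go (suc k) S le p | inj₂ (x , x∉S , p′) = go k (S ⊕ x) (≤-pred (≤-trans (smaller S x x∉S) le)) p′

-- Walks and cuts

⟦_⟧ : ∀ {n} → BRel n → Fin n → Fin n → Set
⟦ R ⟧ x y = R x y ≡ true

Within : ∀ {n} → Pred n → (Fin n → Fin n → Set) → Fin n → Fin n → Set
Within S R x y = S ∋ x × S ∋ y × R x y

exit : ∀ {n} {R : Fin n → Fin n → Set} (S : Pred n) {x y : Fin n} → Star R x y → S ∋ x → S ∌ y →
  ∃₂ λ s t → S ∋ s × S ∌ t × R s t × Star (Within S R) x s
exit S ε p q = ⊥-elim (true≢false p q)
exit S (_◅_ {j = z} r rs) p q with bool-cases (S z)
... | inj₂ z∉ = _ , z , p , z∉ , r , ε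
... | inj₁ z∈ with exit S rs z∈ q
...   | s , t , s∈ , t∉ , a , w = s , t , s∈ , t∉ , a , (p , z∈ , r) ◅ w

Crossing : ∀ {n} → Pred n → (Fin n → Fin n → Set) → Set
Crossing S R = ∃₂ λ s t → S ∋ s × S ∌ t × R s t

cross : ∀ {n} {R : Fin n → Fin n → Set} (S : Pred n) {x y : Fin n} → Star R x y → S ∋ x → S ∌ y → Crossing S R
cross S w p q with exit S w p q
... | s , t , s∈ , t∉ , a , _ = s , t , s∈ , t∉ , a

-- The reach set is wanted as a Boolean set together with its closedness, because it serves as a
-- cut.
closure : ∀ {n} (R : BRel n) (r : Fin n) → Σ (Pred n) λ S →
  S ∋ r × (∀ x → S ∋ x → Star ⟦ R ⟧ r x) × (∀ x y → S ∋ x → R x y ≡ true → S ∋ y)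
closure {n} R r with saturate {n} {P} {D} step (single r) (single-∋ r , init)
  where
  P D : Pred n → Set
  P S = S ∋ r × (∀ x → S ∋ x → Star ⟦ R ⟧ r x)
  D S = ∀ x y → S ∋ x → R x y ≡ true → S ∋ y
  init : ∀ x → single r ∋ x → Star ⟦ R ⟧ r x
  init x p with single-∋⁻ p
  ... | refl = ε
  step : ∀ S → P S → D S ⊎ (∃ λ x → S ∌ x × P (S ⊕ x))
  step S (r∈ , reach) with any? (λ x → any? (λ y → true? (S x) ×-dec (true? (R x y) ×-dec (S y Bool.≟ false))))
  ... | yes (x , y , x∈ , xy , y∉) = inj₂ (y , y∉ , ⊕-old S y r∈ , reach′)
    where
    reach′ : ∀ z → (S ⊕ y) ∋ z → Star ⟦ R ⟧ r z
    reach′ z z∈ with ⊕-case S y z∈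
    ... | inj₁ refl = reach x x∈ ◅◅ (xy ◅ ε)
    ... | inj₂ z∈S  = reach z z∈S
  ... | no none = inj₁ closed
    where
    closed : D S
    closed x y x∈ xy with bool-cases (S y)
    ... | inj₁ y∈ = y∈
    ... | inj₂ y∉ = ⊥-elim (none (x , y , x∈ , xy , y∉))
... | S , (r∈ , reach) , closed = S , r∈ , reach , closed

-- Boolean split graphs, reversal and colourings

record Two {n : ℕ} (R : Fin n → Fin n → Set) : Set where
  constructor two
  field
    {s₁ t₁ s₂ t₂} : Fin n
    arc₁   : R s₁ t₁
    arc₂   : R s₂ t₂
    differ : (s₁ , t₁) ≢ (s₂ , t₂)

Two-map : ∀ {n} {R R′ : Fin n → Fin n → Set} → (∀ {x y} → R x y → R′ x y) → Two R → Two R′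
Two-map f (two a b d) = two (f a) (f b) d

-- c is the indicator of V₂; cut is 2-arc-strength.
record Graph (n : ℕ) : Set where
  field
    E   : BRel n
    c   : Pred n
    adj : ∀ {x y} → x ≢ y → c ∋ x ⊎ c ∋ y → E x y ≡ true ⊎ E y x ≡ true
    ind : ∀ {x y} → c ∌ x → c ∌ y → E x y ≡ false
    irr : ∀ {x} → E x x ≡ false
    cut : ∀ (S : Pred n) {x y} → S ∋ x → S ∌ y → Two (λ s t → S ∋ s × S ∌ t × E s t ≡ true)

-- Reversal exchanges the two kinds of branchings and the two roots, so each argument also yields
-- its mirror image. Arcs leaving a set in the reversed graph are arcs leaving its complement in the
-- original one.
op : ∀ {n} → Graph n → Graph n
op G = record
  { E   = flip E
  ; c   = c
  ; adj = λ x≢y h → swap (adj x≢y h)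
  ; ind = λ p q → ind q p
  ; irr = irr
  ; cut = λ S p q → flipTwo (cut (compl S) (not-true q) (not-false p))
  }
  where
  open Graph G
  flipTwo : ∀ {S} → Two (λ s t → compl S ∋ s × compl S ∌ t × E s t ≡ true) →
    Two (λ s t → S ∋ s × S ∌ t × E t s ≡ true)
  flipTwo (two (p , q , e) (p′ , q′ , e′) d) =
    two (not-false⁻ q , not-true⁻ p , e) (not-false⁻ q′ , not-true⁻ p′ , e′) λ { refl → d refl }

-- The colour classes need not be trees: branchings are extracted at the very end from reachability
-- alone, and the values of `χ` off the arcs are ignored.
GP : ∀ {n} → Graph n → Fin n → Fin n → Set
GP {n} G u v = Σ (BRel n) λ χ →
    (∀ x → Star (λ a b → E a b ≡ true × χ a b ≡ true) u x)
  × (∀ x → Star (λ a b → E a b ≡ true × χ a b ≡ false) x v)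
  where open Graph G

GP-op : ∀ {n} (G : Graph n) {u v : Fin n} → GP (op G) v u → GP G u v
GP-op G (χ , out , inn) =
    (λ a b → not (χ b a))
  , (λ x → Star.reverse (λ { (e , p) → e , not-true p }) (inn x))
  , (λ x → Star.reverse (λ { (e , p) → e , not-false p }) (out x))

module GraphLemmas {n : ℕ} (G : Graph n) where
  open Graph G

  adjˡ : ∀ {x y} → c ∋ x → x ≢ y → E x y ≡ false → E y x ≡ true
  adjˡ cx x≢y ¬xy with adj x≢y (inj₁ cx)
  ... | inj₁ xy = ⊥-elim (true≢false xy ¬xy)
  ... | inj₂ yx = yx

  adjʳ : ∀ {x y} → c ∋ y → x ≢ y → E x y ≡ false → E y x ≡ true
  adjʳ cy x≢y ¬xy with adj x≢y (inj₂ cy)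
  ... | inj₁ xy = ⊥-elim (true≢false xy ¬xy)
  ... | inj₂ yx = yx

  arc⇒≢ : ∀ {x y} → E x y ≡ true → x ≢ y
  arc⇒≢ xy refl = true≢false xy irr

  headV₂ : ∀ {x y} → c ∌ x → E x y ≡ true → c ∋ y
  headV₂ {x} {y} cx xy with bool-cases (c y)
  ... | inj₁ p = p
  ... | inj₂ q = ⊥-elim (true≢false xy (ind cx q))

  tailV₂ : ∀ {x y} → c ∌ y → E x y ≡ true → c ∋ x
  tailV₂ {x} {y} cy xy with bool-cases (c x)
  ... | inj₁ p = p
  ... | inj₂ q = ⊥-elim (true≢false xy (ind q cy))

  entering : ∀ (S : Pred n) {x y} → S ∋ x → S ∌ y → Two (λ s t → S ∌ s × S ∋ t × E s t ≡ true)
  entering S p q = Two-map (λ { (a , b , e) → not-true⁻ a , not-false⁻ b , e })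
    (cut (compl S) (not-true q) (not-false p))

-- Alternating growth of two arc-disjoint trees

_≟ᵃ_ : ∀ {n} (e f : Fin n × Fin n) → Dec (e ≡ f)
_≟ᵃ_ = ≡-dec _≟_ _≟_

addArc : ∀ {n} → BRel n → Fin n → Fin n → BRel n
addArc R s t x y = (⌊ s ≟ x ⌋ ∧ ⌊ t ≟ y ⌋) ∨ R x y

addArc-new : ∀ {n} (R : BRel n) s t → addArc R s t s t ≡ true
addArc-new R s t with s ≟ s | t ≟ t
... | yes _ | yes _ = refl
... | no h  | _     = ⊥-elim (h refl)
... | yes _ | no h  = ⊥-elim (h refl)

addArc-old : ∀ {n} (R : BRel n) s t {x y} → R x y ≡ true → addArc R s t x y ≡ true
addArc-old R s t p = ∨-trueʳ p

addArc-case : ∀ {n} (R : BRel n) s t {x y} → addArc R s t x y ≡ true → (x , y) ≡ (s , t) ⊎ R x y ≡ true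
addArc-case R s t {x} {y} p with s ≟ x | t ≟ y
... | yes refl | yes refl = inj₁ refl
... | yes _    | no _     = inj₂ p
... | no _     | _        = inj₂ p

addArc-false : ∀ {n} (R : BRel n) s t {x y} → (x , y) ≢ (s , t) → R x y ≡ false → addArc R s t x y ≡ false
addArc-false R s t ne p = ¬true⇒false λ h → Sum.[ ne , (λ q → true≢false q p) ] (addArc-case R s t h)

record State {n : ℕ} (G : Graph n) (u v : Fin n) : Set where
  open Graph G
  field
    tp tm  : BRel n
    disj   : ∀ {x y} → tp x y ≡ true → tm x y ≡ true → ⊥
    X Y    : Pred n
    reachX : ∀ x → X ∋ x → Star (λ a b → E a b ≡ true × tp a b ≡ true) u x
    reachY : ∀ y → Y ∋ y → Star (λ a b → E a b ≡ true × tm a b ≡ true) y v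
    cover  : ∀ z → X ∋ z ⊎ Y ∋ z

opState : ∀ {n} {G : Graph n} {u v : Fin n} → State G u v → State (op G) v u
opState σ = record
  { tp = flip tm ; tm = flip tp ; disj = λ p q → disj q p ; X = Y ; Y = X
  ; reachX = λ x p → Star.reverse id (reachY x p)
  ; reachY = λ x p → Star.reverse id (reachX x p)
  ; cover = swap ∘ cover }
  where open State σ

module Conditions {n : ℕ} (G : Graph n) {u v : Fin n} (σ : State G u v) (W : Set) where
  open Graph G
  open State σ

  Avail : Fin n → Fin n → Set
  Avail x y = E x y ≡ true × tp x y ≡ false

  Leaves : Pred n → Fin n → Fin n → Set
  Leaves S s t = S ∋ s × S ∌ t × Avail s t

  -- The out-tree only takes arcs into vertices outside `X`; hence one available arc with its head
  -- in `X` is as safe as two arbitrary ones.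
  Good : Pred n → Set
  Good S = (∃₂ λ s t → Leaves S s t × X ∋ t) ⊎ Two (Leaves S)

  -- `W` stands for the final goal. It is a parameter so that it stays the same type when the graph
  -- is reversed.
  Full : Set
  Full = ∀ S x → S ∋ x → (∀ y → S ∋ y → Y ∌ y) → W ⊎ Good S

  -- Sets through `r` may have lost their second arc; the remaining one is what lets the next step
  -- be made.
  Deficient : Fin n → Set
  Deficient r = ∀ S x → S ∋ x → (∀ y → S ∋ y → Y ∌ y) → W ⊎ (Good S ⊎ (S ∋ r × (∃₂ λ s t → Leaves S s t)))

  Full⇒Deficient : ∀ r → Full → Deficient r
  Full⇒Deficient r full S x p q = Sum.map₂ inj₁ (full S x p q)

  Good⇒Leaves : ∀ {S} → Good S → ∃₂ λ s t → Leaves S s t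
  Good⇒Leaves (inj₁ (s , t , l , _)) = s , t , l
  Good⇒Leaves (inj₂ (two l _ _))     = _ , _ , l

open Conditions

finish : ∀ {n} (G : Graph n) {u v : Fin n} (σ : State G u v) →
  (∀ x → State.X σ ∋ x) → (∀ x → State.Y σ ∋ x) → GP G u v
finish G σ allX allY = tp , (λ x → reachX x (allX x)) ,
  (λ x → Star.map (λ { (e , p) → e , ¬true⇒false (λ q → disj q p) }) (reachY x (allY x)))
  where open State σ

-- One vertex s outside Y joins Y through an arc s → t with t in Y.  The reach set of r is the
-- only set that has to be inspected; afterwards the complement of Y has no deficiency, because
-- a set avoiding s is left by the walk from r to s or avoids r.
module Step {n : ℕ} (G : Graph n) {u v : Fin n} (σ : State G u v) (W : Set) where
  open Graph G
  open State σ

  record Result : Set where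
    field
      σ′     : State G u v
      fewer  : count (compl (State.Y σ′)) < count (compl Y)
      sameX  : State.X σ′ ≡ X
      full   : Full G σ′ W
      other  : Full (op G) (opState σ′) W ⊎ (∃ λ t → Deficient (op G) (opState σ′) W t)

  module _ (r : Fin n) (r∉Y : Y ∌ r) (def : Deficient G σ W r) (fullP : Full (op G) (opState σ) W) where

    ρ : BRel n
    ρ x y = not (Y y) ∧ (E x y ∧ not (tp x y))

    ρ⁻ : ∀ {x y} → ρ x y ≡ true → Y ∌ y × Avail G σ W x y
    ρ⁻ p with ∧-true⁻ p
    ... | a , b with ∧-true⁻ b
    ...   | e , f = not-true⁻ a , e , not-true⁻ f

    module Join (s t : Fin n) (s∉Y : Y ∌ s) (w : Star ⟦ ρ ⟧ r s) (st : Avail G σ W s t) (t∈Y : Y ∋ t) where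

      tm′ : BRel n
      tm′ = addArc tm s t

      lift : ∀ {x y} → E x y ≡ true × tm x y ≡ true → E x y ≡ true × tm′ x y ≡ true
      lift (e , p) = e , addArc-old tm s t p

      reachY′ : ∀ y → (Y ⊕ s) ∋ y → Star (λ a b → E a b ≡ true × tm′ a b ≡ true) y v
      reachY′ y p with ⊕-case Y s p
      ... | inj₁ refl = (proj₁ st , addArc-new tm s t) ◅ Star.map lift (reachY t t∈Y)
      ... | inj₂ q    = Star.map lift (reachY y q)

      disj′ : ∀ {x y} → tp x y ≡ true → tm′ x y ≡ true → ⊥
      disj′ p q with addArc-case tm s t q
      ... | inj₁ refl = true≢false p (proj₂ st)
      ... | inj₂ q′   = disj p q′

      σ′ : State G u v
      σ′ = record
        { tp = tp ; tm = tm′ ; disj = disj′ ; X = X ; Y = Y ⊕ s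
        ; reachX = reachX ; reachY = reachY′
        ; cover = λ z → Sum.map₂ (⊕-old Y s) (cover z) }

      fewer : count (compl (Y ⊕ s)) < count (compl Y)
      fewer = count-< _ _ s (λ y q → not-true (proj₂ (⊕-out Y s (not-true⁻ q))))
        (not-false (⊕-new Y s)) (not-true s∉Y)

      full : Full G σ′ W
      full S x x∈S S⊆ with bool-cases (S r)
      ... | inj₁ r∈S with cross S w r∈S (¬true⇒false λ s∈S → proj₁ (⊕-out Y s (S⊆ s s∈S)) refl)
      ...   | a , b , a∈ , b∉ , ab with ρ⁻ ab
      ...     | b∉Y , av with cover b
      ...       | inj₁ b∈X = inj₂ (inj₁ (a , b , (a∈ , b∉ , av) , b∈X))
      ...       | inj₂ b∈Y = ⊥-elim (true≢false b∈Y b∉Y)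
      full S x x∈S S⊆ | inj₂ r∉S with def S x x∈S (λ y p → proj₂ (⊕-out Y s (S⊆ y p)))
      ... | inj₁ won                  = inj₁ won
      ... | inj₂ (inj₁ good)          = inj₂ good
      ... | inj₂ (inj₂ (r∈S , _))     = ⊥-elim (true≢false r∈S r∉S)

      keep : ∀ {S x y} → (y , x) ≢ (s , t) → Leaves (op G) (opState σ) W S x y → Leaves (op G) (opState σ′) W S x y
      keep ne (p , q , e , f) = p , q , e , addArc-false tm s t ne f

      other : Full (op G) (opState σ′) W ⊎ (∃ λ t → Deficient (op G) (opState σ′) W t)
      other with bool-cases (X t)
      -- With its head in `X`, the new arc enters no set that avoids `X`, so nothing is lost.
      ... | inj₁ t∈X = inj₁ λ S x x∈S S⊆ → Sum.map₂ (good S S⊆) (fullP S x x∈S S⊆)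
        where
        ne : ∀ S → (∀ y → S ∋ y → X ∌ y) → ∀ {x y} → S ∋ x → (y , x) ≢ (s , t)
        ne S S⊆ x∈ refl = true≢false t∈X (S⊆ t x∈)
        good : ∀ S → (∀ y → S ∋ y → X ∌ y) → Good (op G) (opState σ) W S → Good (op G) (opState σ′) W S
        good S S⊆ (inj₁ (x , y , l , y∈)) = inj₁ (x , y , keep (ne S S⊆ (proj₁ l)) l , ⊕-old Y s y∈)
        good S S⊆ (inj₂ (two a b d)) = inj₂ (two (keep (ne S S⊆ (proj₁ a)) a) (keep (ne S S⊆ (proj₁ b)) b) d)
      -- Only sets containing `t` lose the arc. An arc coming from `Y` is not the lost one, because
      -- `s` was outside `Y`; of two arcs at least one remains.
      ... | inj₂ _ = inj₂ (t , λ S x x∈S S⊆ → Sum.map₂ (good S) (fullP S x x∈S S⊆))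
        where
        good : ∀ S → Good (op G) (opState σ) W S →
          Good (op G) (opState σ′) W S ⊎ (S ∋ t × (∃₂ λ x y → Leaves (op G) (opState σ′) W S x y))
        good S (inj₁ (x , y , l , y∈)) =
          inj₁ (inj₁ (x , y , keep (λ { refl → true≢false y∈ s∉Y }) l , ⊕-old Y s y∈))
        good S (inj₂ (two {x₁} {y₁} {x₂} {y₂} a b d)) with (y₁ , x₁) ≟ᵃ (s , t) | (y₂ , x₂) ≟ᵃ (s , t)
        ... | yes refl | _        = inj₂ (proj₁ a , x₂ , y₂ , keep (λ { refl → d refl }) b)
        ... | no _     | yes refl = inj₂ (proj₁ b , x₁ , y₁ , keep (λ { refl → d refl }) a)
        ... | no h     | no h′    = inj₁ (inj₂ (two (keep h a) (keep h′ b) d))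

      result : Result
      result = record { σ′ = σ′ ; fewer = fewer ; sameX = refl ; full = full ; other = other }

    outside-Y : ∀ {a b} → Star ⟦ ρ ⟧ a b → Y ∌ a → Y ∌ b
    outside-Y ε        p = p
    outside-Y (e ◅ es) _ = outside-Y es (proj₁ (ρ⁻ e))

    step : W ⊎ Result
    step with closure ρ r
    ... | R , r∈R , walk , closed with def R r r∈R (λ y y∈R → outside-Y (walk y y∈R) r∉Y)
    ... | inj₁ won = inj₁ won
    ... | inj₂ h = inj₂ (use (leaving h))
      where
      leaving : Good G σ W R ⊎ (R ∋ r × (∃₂ λ s t → Leaves G σ W R s t)) → ∃₂ λ s t → Leaves G σ W R s t
      leaving (inj₁ good)    = Good⇒Leaves G σ W good
      leaving (inj₂ (_ , l)) = l
      use : (∃₂ λ s t → Leaves G σ W R s t) → Result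
      use (s , t , s∈ , t∉ , e , f) = Join.result s t (outside-Y (walk s s∈) r∉Y) (walk s s∈) (e , f) t∈Y
        where
        t∈Y : Y ∋ t
        t∈Y with bool-cases (Y t)
        ... | inj₁ p = p
        ... | inj₂ q = ⊥-elim (true≢false (closed s t s∈ (∧-true (not-true q) (∧-true e (not-true f)))) t∉)

allOf : ∀ {n} (S : Pred n) → ¬ (∃ λ x → S ∌ x) → ∀ x → S ∋ x
allOf S none x with bool-cases (S x)
... | inj₁ p = p
... | inj₂ q = ⊥-elim (none (x , q))

mutual
  -- The side with the deficiency moves next, and `k` bounds the vertices missing from the two trees
  -- together. A deficient vertex already in the tree is harmless, since the sets in question avoid
  -- it; any missing vertex takes its place. Once `Y` is everything, the condition on that side is
  -- vacuous and only the reversed problem remains.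
  exhaust : ∀ k {n} (G : Graph n) {u v : Fin n} (σ : State G u v) {W : Set} → (GP G u v → W) →
    count (compl (State.Y σ)) + count (compl (State.X σ)) ≤ k →
    ∀ r → Deficient G σ W r → Full (op G) (opState σ) W → W
  exhaust k G σ {W} done le r def fullP with any? (λ x → State.Y σ x Bool.≟ false)
  ... | yes (q , q∉Y) with bool-cases (State.Y σ r)
  ...   | inj₂ r∉Y = advance k G σ done le r r∉Y def fullP
  ...   | inj₁ r∈Y = advance k G σ done le q q∉Y def′ fullP
    where
    def′ : Deficient G σ W q
    def′ S x x∈S S⊆ with def S x x∈S S⊆
    ... | inj₁ won                  = inj₁ won
    ... | inj₂ (inj₁ good)          = inj₂ (inj₁ good)
    ... | inj₂ (inj₂ (r∈S , _))     = ⊥-elim (true≢false r∈Y (S⊆ r r∈S))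
  exhaust k G σ {W} done le r def fullP | no noneQ with any? (λ x → State.X σ x Bool.≟ false)
  ... | yes (p , p∉X) = advance k (op G) (opState σ) (done ∘ GP-op G)
        (≤-trans (≤-reflexive (+-comm (count (compl (State.X σ))) _)) le) p p∉X
        (Full⇒Deficient (op G) (opState σ) W p fullP)
        (λ S x x∈S S⊆ → ⊥-elim (noneQ (x , S⊆ x x∈S)))
  ... | no noneP = done (finish G σ (allOf (State.X σ) noneP) (allOf (State.Y σ) noneQ))

  advance : ∀ k {n} (G : Graph n) {u v : Fin n} (σ : State G u v) {W : Set} → (GP G u v → W) →
    count (compl (State.Y σ)) + count (compl (State.X σ)) ≤ k →
    ∀ r → State.Y σ ∌ r → Deficient G σ W r → Full (op G) (opState σ) W → W
  advance k G σ {W} done le r r∉Y def fullP with Step.step G σ W r r∉Y def fullP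
  ... | inj₁ won = won
  advance zero G σ {W} done le r r∉Y def fullP | inj₂ res
    with ≤-trans (≤-trans (s≤s z≤n) (≤-trans (+-monoˡ-≤ _ (Step.Result.fewer res)) ≤-refl)) le
  ... | ()
  advance (suc k) G σ {W} done le r r∉Y def fullP | inj₂ res = next other
    where
    open Step.Result res
    bound : count (compl (State.Y σ′)) + count (compl (State.X σ′)) ≤ k
    bound = ≤-pred (≤-trans (+-monoˡ-≤ (count (compl (State.X σ′))) fewer)
      (subst (λ Z → count (compl (State.Y σ)) + count (compl Z) ≤ suc k) (sym sameX) le))
    next : Full (op G) (opState σ′) W ⊎ (∃ λ t → Deficient (op G) (opState σ′) W t) → W
    next (inj₁ full′) = exhaust k G σ′ done bound r (Full⇒Deficient G σ′ W r full) full′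
    next (inj₂ (t , def′)) = exhaust k (op G) (opState σ′) (done ∘ GP-op G)
      (≤-trans (≤-reflexive (+-comm (count (compl (State.X σ′))) _)) bound) t def′ full

-- Two trees through a common hub

_∈?_ : ∀ {n} (x : Fin n) xs → Dec (x ∈ xs)
_∈?_ {n} = DecMembership._∈?_ (_≟_ {n})

_∈ᵃ?_ : ∀ {n} (e : Fin n × Fin n) es → Dec (e ∈ es)
_∈ᵃ?_ {n} = DecMembership._∈?_ (_≟ᵃ_ {n})

⌊⌋-true⁻ : ∀ {A : Set} (d : Dec A) → ⌊ d ⌋ ≡ true → A
⌊⌋-true⁻ (yes a) _ = a

⌊⌋-false⁻ : ∀ {A : Set} (d : Dec A) → ⌊ d ⌋ ≡ false → ¬ A
⌊⌋-false⁻ (no ¬a) _ = ¬a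

⌊⌋-true : ∀ {A : Set} (d : Dec A) → A → ⌊ d ⌋ ≡ true
⌊⌋-true (yes _) _ = refl
⌊⌋-true (no ¬a) a = ⊥-elim (¬a a)

⌊⌋-false : ∀ {A : Set} (d : Dec A) → ¬ A → ⌊ d ⌋ ≡ false
⌊⌋-false (yes a) ¬a = ⊥-elim (¬a a)
⌊⌋-false (no _)  _  = refl

-- An out-tree from u on xs with arcs ps and an in-tree to v on ys with arcs ms, both
-- containing the vertex w of V₂; every other vertex is adjacent to w and can be attached to it.
record Core {n : ℕ} (G : Graph n) (u v w : Fin n) : Set where
  open Graph G
  field
    xs ys  : List (Fin n)
    ps ms  : List (Fin n × Fin n)
    w∈V₂   : c ∋ w
    w∈xs   : w ∈ xs
    w∈ys   : w ∈ ys
    reachX : ∀ {x} → x ∈ xs → Star (λ a b → E a b ≡ true × (a , b) ∈ ps) u x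
    reachY : ∀ {y} → y ∈ ys → Star (λ a b → E a b ≡ true × (a , b) ∈ ms) y v
    tails  : ∀ {a b} → (a , b) ∈ ps → a ∈ xs
    heads  : ∀ {a b} → (a , b) ∈ ms → b ∈ ys
    disj   : ∀ {e} → e ∈ ps → e ∉ ms

module Hub {n : ℕ} (G : Graph n) {u v w : Fin n} (core : Core G u v w) where
  open Graph G
  open GraphLemmas G
  open Core core

  InX InY : Fin n → Set
  InX z = z ∈ xs ⊎ (E w z ≡ true × (w , z) ∉ ms)
  InY z = z ∈ ys ⊎ (E z w ≡ true × (z , w) ∉ ps)

  Leaving Entering : Pred n → Fin n → Fin n → Set
  Leaving  S s t = S ∋ s × S ∌ t × E s t ≡ true × (s , t) ∉ ps
  Entering S s t = S ∌ s × S ∋ t × E s t ≡ true × (s , t) ∉ ms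

  -- Only the arcs of the initial trees are counted as lost. The arcs added at `w` cannot matter:
  -- `w` is in both trees, hence in none of the sets considered.
  GoodQ GoodP : Pred n → Set
  GoodQ S = (∃₂ λ s t → Leaving  S s t × InX t) ⊎ Two (Leaving S)
  GoodP S = (∃₂ λ s t → Entering S s t × InY s) ⊎ Two (Entering S)

  FullQ : Set
  FullQ = ∀ S x → S ∋ x → (∀ y → S ∋ y → ¬ InY y) → GP G u v ⊎ GoodQ S

  DeficientP : Fin n → Set
  DeficientP r = ∀ S x → S ∋ x → (∀ y → S ∋ y → ¬ InX y) →
    GP G u v ⊎ (GoodP S ⊎ (S ∋ r × (∃₂ λ s t → Entering S s t)))

  private
    tp tm : BRel n
    tp a b = ⌊ (a , b) ∈ᵃ? ps ⌋ ∨ (⌊ w ≟ a ⌋ ∧ (E w b ∧ (not ⌊ b ∈? xs ⌋ ∧ not ⌊ (w , b) ∈ᵃ? ms ⌋)))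
    tm a b = ⌊ (a , b) ∈ᵃ? ms ⌋ ∨ (⌊ w ≟ b ⌋ ∧ (E a w ∧ (not ⌊ a ∈? ys ⌋ ∧ not ⌊ (a , w) ∈ᵃ? ps ⌋)))

    X Y : Pred n
    X z = ⌊ z ∈? xs ⌋ ∨ (E w z ∧ not ⌊ (w , z) ∈ᵃ? ms ⌋)
    Y z = ⌊ z ∈? ys ⌋ ∨ (E z w ∧ not ⌊ (z , w) ∈ᵃ? ps ⌋)

    InX⇒X : ∀ {z} → InX z → X ∋ z
    InX⇒X {z} (inj₁ p) = ∨-trueˡ (⌊⌋-true (z ∈? xs) p)
    InX⇒X {z} (inj₂ (e , p)) = ∨-trueʳ (∧-true e (not-true (⌊⌋-false ((w , z) ∈ᵃ? ms) p)))

    X⇒InX : ∀ {z} → X ∋ z → InX z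
    X⇒InX {z} p with ∨-true⁻ {⌊ z ∈? xs ⌋} p
    ... | inj₁ q = inj₁ (⌊⌋-true⁻ (z ∈? xs) q)
    ... | inj₂ q with ∧-true⁻ q
    ...   | e , f = inj₂ (e , ⌊⌋-false⁻ ((w , z) ∈ᵃ? ms) (not-true⁻ f))

    InY⇒Y : ∀ {z} → InY z → Y ∋ z
    InY⇒Y {z} (inj₁ p) = ∨-trueˡ (⌊⌋-true (z ∈? ys) p)
    InY⇒Y {z} (inj₂ (e , p)) = ∨-trueʳ (∧-true e (not-true (⌊⌋-false ((z , w) ∈ᵃ? ps) p)))

    Y⇒InY : ∀ {z} → Y ∋ z → InY z
    Y⇒InY {z} p with ∨-true⁻ {⌊ z ∈? ys ⌋} p
    ... | inj₁ q = inj₁ (⌊⌋-true⁻ (z ∈? ys) q)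
    ... | inj₂ q with ∧-true⁻ q
    ...   | e , f = inj₂ (e , ⌊⌋-false⁻ ((z , w) ∈ᵃ? ps) (not-true⁻ f))

    tp⁻ : ∀ {a b} → tp a b ≡ true → (a , b) ∈ ps ⊎ (a ≡ w × b ∉ xs × (w , b) ∉ ms)
    tp⁻ {a} {b} p with ∨-true⁻ {⌊ (a , b) ∈ᵃ? ps ⌋} p
    ... | inj₁ q = inj₁ (⌊⌋-true⁻ ((a , b) ∈ᵃ? ps) q)
    ... | inj₂ q with ∧-true⁻ {⌊ w ≟ a ⌋} q
    ...   | e , f with ∧-true⁻ {E w b} f
    ...     | _ , g with ∧-true⁻ {not ⌊ b ∈? xs ⌋} g
    ...       | h , k = inj₂ (sym (⌊⌋-true⁻ (w ≟ a) e) , ⌊⌋-false⁻ (b ∈? xs) (not-true⁻ h)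
                             , ⌊⌋-false⁻ ((w , b) ∈ᵃ? ms) (not-true⁻ k))

    tm⁻ : ∀ {a b} → tm a b ≡ true → (a , b) ∈ ms ⊎ (b ≡ w × a ∉ ys × (a , w) ∉ ps)
    tm⁻ {a} {b} p with ∨-true⁻ {⌊ (a , b) ∈ᵃ? ms ⌋} p
    ... | inj₁ q = inj₁ (⌊⌋-true⁻ ((a , b) ∈ᵃ? ms) q)
    ... | inj₂ q with ∧-true⁻ {⌊ w ≟ b ⌋} q
    ...   | e , f with ∧-true⁻ {E a w} f
    ...     | _ , g with ∧-true⁻ {not ⌊ a ∈? ys ⌋} g
    ...       | h , k = inj₂ (sym (⌊⌋-true⁻ (w ≟ b) e) , ⌊⌋-false⁻ (a ∈? ys) (not-true⁻ h)
                             , ⌊⌋-false⁻ ((a , w) ∈ᵃ? ps) (not-true⁻ k))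

    disjoint : ∀ {a b} → tp a b ≡ true → tm a b ≡ true → ⊥
    disjoint p q with tp⁻ p | tm⁻ q
    ... | inj₁ i                | inj₁ j                  = disj i j
    ... | inj₁ i                | inj₂ (refl , _ , ∉ps)   = ∉ps i
    ... | inj₂ (refl , _ , ∉ms) | inj₁ j                  = ∉ms j
    ... | inj₂ (refl , _)       | inj₂ (_ , w∉ , _)       = w∉ w∈ys

    ps⇒tp : ∀ {a b} → (a , b) ∈ ps → tp a b ≡ true
    ps⇒tp {a} {b} p = ∨-trueˡ (⌊⌋-true ((a , b) ∈ᵃ? ps) p)

    ms⇒tm : ∀ {a b} → (a , b) ∈ ms → tm a b ≡ true
    ms⇒tm {a} {b} p = ∨-trueˡ (⌊⌋-true ((a , b) ∈ᵃ? ms) p)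

    reachXs : ∀ {x} → x ∈ xs → Star (λ a b → E a b ≡ true × tp a b ≡ true) u x
    reachXs p = Star.map (λ { (e , q) → e , ps⇒tp q }) (reachX p)

    reachYs : ∀ {y} → y ∈ ys → Star (λ a b → E a b ≡ true × tm a b ≡ true) y v
    reachYs p = Star.map (λ { (e , q) → e , ms⇒tm q }) (reachY p)

    reachX′ : ∀ x → X ∋ x → Star (λ a b → E a b ≡ true × tp a b ≡ true) u x
    reachX′ x p with x ∈? xs | X⇒InX {x} p
    ... | yes q | _                 = reachXs q
    ... | no ¬q | inj₁ q            = ⊥-elim (¬q q)
    ... | no ¬q | inj₂ (e , ∉ms)    = reachXs w∈xs ◅◅ ((e , ∨-trueʳ
            (∧-true (⌊⌋-true (w ≟ w) refl) (∧-true e (∧-true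
              (not-true (⌊⌋-false (x ∈? xs) ¬q)) (not-true (⌊⌋-false ((w , x) ∈ᵃ? ms) ∉ms)))))) ◅ ε)

    reachY′ : ∀ x → Y ∋ x → Star (λ a b → E a b ≡ true × tm a b ≡ true) x v
    reachY′ x p with x ∈? ys | Y⇒InY {x} p
    ... | yes q | _                 = reachYs q
    ... | no ¬q | inj₁ q            = ⊥-elim (¬q q)
    ... | no ¬q | inj₂ (e , ∉ps)    = (e , ∨-trueʳ
            (∧-true (⌊⌋-true (w ≟ w) refl) (∧-true e (∧-true
              (not-true (⌊⌋-false (x ∈? ys) ¬q)) (not-true (⌊⌋-false ((x , w) ∈ᵃ? ps) ∉ps)))))) ◅ reachYs w∈ys

    -- The arc between `w` and `z` either attaches `z` or is already taken by the opposite tree, and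
    -- then `heads` or `tails` puts `z` into that tree.
    placed : ∀ z → InX z ⊎ InY z
    placed z with w ≟ z
    ... | yes refl = inj₁ (inj₁ w∈xs)
    ... | no w≢z with adj w≢z (inj₁ w∈V₂)
    ...   | inj₁ wz with (w , z) ∈ᵃ? ms
    ...     | yes p = inj₂ (inj₁ (heads p))
    ...     | no ¬p = inj₁ (inj₂ (wz , ¬p))
    placed z | no w≢z | inj₂ zw with (z , w) ∈ᵃ? ps
    ...     | yes p = inj₁ (inj₁ (tails p))
    ...     | no ¬p = inj₂ (inj₂ (zw , ¬p))

    cover′ : ∀ z → X ∋ z ⊎ Y ∋ z
    cover′ z = Sum.map InX⇒X InY⇒Y (placed z)

    σ : State G u v
    σ = record { tp = tp ; tm = tm ; disj = disjoint ; X = X ; Y = Y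
               ; reachX = reachX′ ; reachY = reachY′ ; cover = cover′ }

    module CQ = Conditions G σ (GP G u v)
    module CP = Conditions (op G) (opState σ) (GP G u v)

    leaving : ∀ {S s t} → (∀ y → S ∋ y → Y ∌ y) → Leaving S s t → CQ.Leaves S s t
    leaving S⊆ (p , q , e , f) = p , q , e , ¬true⇒false λ h → [ (λ i → f i) , (λ { (refl , _) →
        true≢false (InY⇒Y (inj₁ w∈ys)) (S⊆ w p) }) ]′ (tp⁻ h)
      where open Sum using ([_,_]′)

    entering′ : ∀ {S s t} → (∀ y → S ∋ y → X ∌ y) → Entering S s t → CP.Leaves S t s
    entering′ S⊆ (p , q , e , f) = q , p , e , ¬true⇒false λ h → [ (λ i → f i) , (λ { (refl , _) →
        true≢false (InX⇒X (inj₁ w∈xs)) (S⊆ w q) }) ]′ (tm⁻ h)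
      where open Sum using ([_,_]′)

    goodQ : ∀ {S} → (∀ y → S ∋ y → Y ∌ y) → GoodQ S → CQ.Good S
    goodQ S⊆ (inj₁ (s , t , l , x)) = inj₁ (s , t , leaving S⊆ l , InX⇒X x)
    goodQ S⊆ (inj₂ t)               = inj₂ (Two-map (leaving S⊆) t)

    goodP : ∀ {S} → (∀ y → S ∋ y → X ∌ y) → GoodP S → CP.Good S
    goodP S⊆ (inj₁ (s , t , l , y)) = inj₁ (t , s , entering′ S⊆ l , InY⇒Y y)
    goodP S⊆ (inj₂ (two a b d))     = inj₂ (two (entering′ S⊆ a) (entering′ S⊆ b) λ { refl → d refl })

    fullQ : FullQ → CQ.Full
    fullQ f S x p S⊆ = Sum.map₂ (goodQ S⊆) (f S x p (λ y y∈ i → true≢false (InY⇒Y i) (S⊆ y y∈)))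

    defP : ∀ r → DeficientP r → CP.Deficient r
    defP r f S x p S⊆ = Sum.map₂
      (Sum.map (goodP S⊆) (λ { (r∈ , s , t , l) → r∈ , t , s , entering′ S⊆ l }))
      (f S x p (λ y y∈ i → true≢false (InX⇒X i) (S⊆ y y∈)))

  -- The deficiency is on the side of the out-tree, so the alternation starts there, that is, in the
  -- reversed graph.
  hub : ∀ r → FullQ → DeficientP r → GP G u v
  hub r fq dp = exhaust _ (op G) (opState σ) (GP-op G) ≤-refl r (defP r dp) (fullQ fq)

  lossless-Q : ∀ S {x} → S ∋ x → S ∌ w → (∀ {s t} → S ∋ s → S ∌ t → (s , t) ∉ ps) → GoodQ S
  lossless-Q S p q h = inj₂ (Two-map (λ { (a , b , e) → a , b , e , h a b }) (cut S p q))

  lossless-P : ∀ S {x} → S ∋ x → S ∌ w → (∀ {s t} → S ∌ s → S ∋ t → (s , t) ∉ ms) → GoodP S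
  lossless-P S p q h = inj₂ (Two-map (λ { (a , b , e) → a , b , e , h a b }) (entering S p q))

  one-lost-P : ∀ S {x a b} → S ∋ x → S ∌ w →
    (∀ {s t} → S ∌ s → S ∋ t → (s , t) ∈ ms → (s , t) ≡ (a , b)) → ∃₂ λ s t → Entering S s t
  one-lost-P S p q h with entering S p q
  ... | two {s₁} {t₁} {s₂} {t₂} (a₁ , b₁ , e₁) (a₂ , b₂ , e₂) d with (s₁ , t₁) ∈ᵃ? ms | (s₂ , t₂) ∈ᵃ? ms
  ...   | no i  | _     = s₁ , t₁ , a₁ , b₁ , e₁ , i
  ...   | yes _ | no j  = s₂ , t₂ , a₂ , b₂ , e₂ , j
  ...   | yes i | yes j = ⊥-elim (d (trans (h a₁ b₁ i) (sym (h a₂ b₂ j))))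

  ∉-InX : ∀ {S z} → (∀ y → S ∋ y → ¬ InX y) → InX z → S ∌ z
  ∉-InX S⊆ i = ¬true⇒false λ z∈ → S⊆ _ z∈ i

  ∉-InY : ∀ {S z} → (∀ y → S ∋ y → ¬ InY y) → InY z → S ∌ z
  ∉-InY S⊆ i = ¬true⇒false λ z∈ → S⊆ _ z∈ i

-- Edmonds' theorem for two branchings

closed-walk : ∀ {n} {R : BRel n} (S : Pred n) → (∀ x y → S ∋ x → R x y ≡ true → S ∋ y) →
  ∀ {a b} → Star ⟦ R ⟧ a b → S ∋ a → S ∋ b
closed-walk S closed ε        p = p
closed-walk S closed (e ◅ es) p = closed-walk S closed es (closed _ _ p e)

-- Lovász's proof of Edmonds' theorem for two branchings towards a root set Z: an arc whose
-- removal would isolate a set R from Z is replaced by an arc inside R, and the new isolated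
-- set is strictly smaller.
module Edmonds {n : ℕ} (G : Graph n) (Z : Pred n) {z₀ : Fin n} (z₀∈Z : Z ∋ z₀) where
  open Graph G

  Avoids : Pred n → Set
  Avoids S = ∀ y → S ∋ y → Z ∌ y

  -- `free` is the cut form of the claim that the arcs outside `T` still lead every vertex to `Z`;
  -- by `tails`, every arc from a vertex outside `M` is still free.
  record Grown (M : Pred n) : Set where
    field
      T     : BRel n
      Z⊆M   : ∀ x → Z ∋ x → M ∋ x
      reach : ∀ x → M ∋ x → ∃ λ z → Z ∋ z × Star (λ a b → E a b ≡ true × T a b ≡ true) x z
      tails : ∀ x y → M ∌ x → T x y ≡ false
      free  : ∀ S x → S ∋ x → Avoids S → Crossing S (λ a b → E a b ≡ true × T a b ≡ false)

  module Extend (M : Pred n) (grown : Grown M) where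
    open Grown grown

    ρ : Fin n → Fin n → BRel n
    ρ x y a b = E a b ∧ (not (T a b) ∧ not ⌊ (a , b) ≟ᵃ (x , y) ⌋)

    ρ⁺ : ∀ {x y a b} → E a b ≡ true → T a b ≡ false → (a , b) ≢ (x , y) → ρ x y a b ≡ true
    ρ⁺ e f ne = ∧-true e (∧-true (not-true f) (not-true (⌊⌋-false (_ ≟ᵃ _) ne)))

    ρ⁻ : ∀ {x y a b} → ρ x y a b ≡ true → E a b ≡ true × T a b ≡ false × (a , b) ≢ (x , y)
    ρ⁻ p with ∧-true⁻ p
    ... | e , q with ∧-true⁻ q
    ...   | f , g = e , not-true⁻ f , ⌊⌋-false⁻ (_ ≟ᵃ _) (not-true⁻ g)

    extend : ∀ x y → M ∌ x → M ∋ y → E x y ≡ true → ∀ z → Z ∋ z → Star ⟦ ρ x y ⟧ x z → Grown (M ⊕ x)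
    extend x y x∉M y∈M xy z z∈Z walk = record
      { T = addArc T x y ; Z⊆M = λ a p → ⊕-old M x (Z⊆M a p) ; reach = reach′ ; tails = tails′ ; free = free′ }
      where
      lift : ∀ {a b} → E a b ≡ true × T a b ≡ true → E a b ≡ true × addArc T x y a b ≡ true
      lift (e , p) = e , addArc-old T x y p
      reach′ : ∀ a → (M ⊕ x) ∋ a → ∃ λ z → Z ∋ z × Star (λ a b → E a b ≡ true × addArc T x y a b ≡ true) a z
      reach′ a p with ⊕-case M x p
      ... | inj₁ refl with reach y y∈M
      ...   | z′ , z′∈ , w = z′ , z′∈ , (xy , addArc-new T x y) ◅ Star.map lift w
      reach′ a p | inj₂ q with reach a q
      ...   | z′ , z′∈ , w = z′ , z′∈ , Star.map lift w
      tails′ : ∀ a b → (M ⊕ x) ∌ a → addArc T x y a b ≡ false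
      tails′ a b p with ⊕-out M x p
      ... | a≢x , a∉M = addArc-false T x y (λ { refl → a≢x refl }) (tails a b a∉M)
      free′ : ∀ S a → S ∋ a → Avoids S → Crossing S (λ a b → E a b ≡ true × addArc T x y a b ≡ false)
      free′ S a a∈ av with free S a a∈ av
      ... | s , t , s∈ , t∉ , e , f with (s , t) ≟ᵃ (x , y)
      ...   | no ne    = s , t , s∈ , t∉ , e , addArc-false T x y ne f
      ...   | yes refl with cross S walk s∈ (¬true⇒false λ z∈S → true≢false z∈Z (av z z∈S))
      ...     | s′ , t′ , s′∈ , t′∉ , p with ρ⁻ p
      ...       | e′ , f′ , ne = s′ , t′ , s′∈ , t′∉ , e′ , addArc-false T x y ne f′

    search : ∀ k x y (R : Pred n) → count R ≤ k → M ∌ x → M ∋ y → E x y ≡ true →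
      R ∋ x → (∀ a → R ∋ a → Star ⟦ ρ x y ⟧ x a) → (∀ a b → R ∋ a → ρ x y a b ≡ true → R ∋ b) →
      ∃ λ x → M ∌ x × Grown (M ⊕ x)
    search k x y R le x∉M y∈M xy x∈R walk closed with any? (λ z → true? (R z) ×-dec true? (Z z))
    ... | yes (z , z∈R , z∈Z) = x , x∉M , extend x y x∉M y∈M xy z z∈Z (walk z z∈R)
    ... | no none with inner
      where
      avoids : Avoids R
      avoids a a∈ = ¬true⇒false λ p → none (a , a∈ , p)
      -- Two arcs leave the part of `R` outside `M`, and one of them is not x → y. Its tail is
      -- outside `M`, so it is free and stays in `R`; its head must therefore lie in `M`.
      S₁ : Pred n
      S₁ a = R a ∧ not (M a)
      fresh : ∀ {a b} → S₁ ∋ a → S₁ ∌ b → E a b ≡ true → (a , b) ≢ (x , y) → M ∌ a × M ∋ b × R ∋ a × R ∋ b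
      fresh {a} {b} p q e ne with ∧-true⁻ {R a} p
      ... | a∈R , a∉M with closed a b a∈R (ρ⁺ e (tails a b (not-true⁻ a∉M)) ne)
      ...   | b∈R with bool-cases (M b)
      ...     | inj₁ b∈M = not-true⁻ a∉M , b∈M , a∈R , b∈R
      ...     | inj₂ b∉M = ⊥-elim (true≢false (∧-true b∈R (not-true b∉M)) q)
      inner : ∃₂ λ x′ y′ → M ∌ x′ × M ∋ y′ × E x′ y′ ≡ true × R ∋ x′ × R ∋ y′ × (x , y) ≢ (x′ , y′)
      inner with cut S₁ {y = z₀} (∧-true x∈R (not-true x∉M))
                   (¬true⇒false λ p → true≢false z₀∈Z (avoids z₀ (proj₁ (∧-true⁻ {R z₀} p))))
      ... | two {a₁} {b₁} {a₂} {b₂} (p₁ , q₁ , e₁) (p₂ , q₂ , e₂) d with (a₁ , b₁) ≟ᵃ (x , y)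
      ...   | no ne with fresh p₁ q₁ e₁ ne
      ...     | i , j , r , r′ = a₁ , b₁ , i , j , e₁ , r , r′ , ne ∘ sym
      inner | two {a₁} {b₁} {a₂} {b₂} (p₁ , q₁ , e₁) (p₂ , q₂ , e₂) d | yes refl with fresh p₂ q₂ e₂ (d ∘ sym)
      ...     | i , j , r , r′ = a₂ , b₂ , i , j , e₂ , r , r′ , d
    ... | x′ , y′ , x′∉M , y′∈M , e′ , x′∈R , y′∈R , ne with closure (ρ x′ y′) x′
    ...   | R′ , x′∈R′ , walk′ , closed′ with any? (λ z → true? (R′ z) ×-dec true? (Z z))
    ...     | yes (z , z∈R′ , z∈Z) = x′ , x′∉M , extend x′ y′ x′∉M y′∈M e′ z z∈Z (walk′ z z∈R′)
    ...     | no none′ = descend k le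
      where
      -- Otherwise no free arc leaves the union of `R` and `R′`, contradicting `free`: each of the
      -- two excluded arcs has its head in the other set.
      x∉R′ : R′ ∌ x
      x∉R′ = ¬true⇒false contra
        where
        U : Pred n
        U a = R a ∨ R′ a
        contra : R′ ∋ x → ⊥
        contra x∈R′ with free U x (∨-trueˡ x∈R) avoids
          where
          avoids : Avoids U
          avoids a p = ¬true⇒false λ a∈Z → Sum.[ (λ q → none (a , q , a∈Z)) , (λ q → none′ (a , q , a∈Z)) ] (∨-true⁻ {R a} p)
        ... | s , t , s∈ , t∉ , e , f with ∨-false⁻ {R t} t∉ | ∨-true⁻ {R s} s∈
        ...   | t∉R , t∉R′ | inj₁ s∈R with (s , t) ≟ᵃ (x , y)
        ...     | no h     = true≢false (closed s t s∈R (ρ⁺ e f h)) t∉R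
        ...     | yes refl = true≢false (closed′ s t x∈R′ (ρ⁺ e f ne)) t∉R′
        contra x∈R′ | s , t , s∈ , t∉ , e , f | t∉R , t∉R′ | inj₂ s∈R′ with (s , t) ≟ᵃ (x′ , y′)
        ...     | no h     = true≢false (closed′ s t s∈R′ (ρ⁺ e f h)) t∉R′
        ...     | yes refl = true≢false y′∈R t∉R
      -- A walk can leave `R` only by x → y, and would then have brought `x` into `R′`.
      R′⊆R : ∀ a → R′ ∋ a → R ∋ a
      R′⊆R a a∈ with bool-cases (R a)
      ... | inj₁ p = p
      ... | inj₂ q with exit R (walk′ a a∈) x′∈R q
      ...   | s , t , s∈ , t∉ , p , pre with ρ⁻ p | (s , t) ≟ᵃ (x , y)
      ...     | e , f , _ | no h     = ⊥-elim (true≢false (closed s t s∈ (ρ⁺ e f h)) t∉)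
      ...     | _         | yes refl = ⊥-elim (true≢false
                (closed-walk R′ closed′ (Star.map (proj₂ ∘ proj₂) pre) x′∈R′) x∉R′)
      smaller : count R′ < count R
      smaller = count-< R′ R x R′⊆R x∉R′ x∈R
      descend : ∀ k → count R ≤ k → ∃ λ x → M ∌ x × Grown (M ⊕ x)
      descend zero le with ≤-trans smaller le
      ... | ()
      descend (suc k) le = search k x′ y′ R′ (≤-pred (≤-trans smaller le)) x′∉M y′∈M e′ x′∈R′ walk′ closed′

  -- The second class needs no construction: by `free`, no reach set among the remaining arcs can
  -- miss `Z`.
  edmonds : Σ (BRel n) λ α →
      (∀ x → ∃ λ z → Z ∋ z × Star (λ a b → E a b ≡ true × α a b ≡ true) x z)
    × (∀ x → ∃ λ z → Z ∋ z × Star (λ a b → E a b ≡ true × α a b ≡ false) x z)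
  edmonds with saturate {n} {Grown} {λ M → ∀ x → M ∋ x} grow Z start
    where
    start : Grown Z
    start = record
      { T = λ _ _ → false ; Z⊆M = λ _ p → p ; reach = λ x p → x , p , ε ; tails = λ _ _ _ → refl
      ; free = λ S x p av → first (cut S {y = z₀} p (¬true⇒false λ q → true≢false z₀∈Z (av z₀ q))) }
      where
      first : ∀ {S} → Two (λ s t → S ∋ s × S ∌ t × E s t ≡ true) → Crossing S (λ a b → E a b ≡ true × false ≡ false)
      first (two (p , q , e) _ _) = _ , _ , p , q , e , refl
    grow : ∀ M → Grown M → (∀ x → M ∋ x) ⊎ (∃ λ x → M ∌ x × Grown (M ⊕ x))
    grow M grown with any? (λ x → M x Bool.≟ false)
    ... | no none = inj₁ (allOf M none)
    ... | yes (x , x∉M) with cut (compl M) {y = z₀} (not-true x∉M) (not-false (Grown.Z⊆M grown z₀ z₀∈Z))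
    ...   | two {s} {t} (p , q , e) _ _ with closure (Extend.ρ M grown s t) s
    ...     | R , s∈R , walk , closed =
      inj₂ (Extend.search M grown (count R) s t R ≤-refl (not-true⁻ p) (not-false⁻ q) e s∈R walk closed)
  ... | M , grown , all = T , (λ x → reach x (all x)) , other
    where
    open Grown grown
    other : ∀ x → ∃ λ z → Z ∋ z × Star (λ a b → E a b ≡ true × T a b ≡ false) x z
    other x with closure (λ a b → E a b ∧ not (T a b)) x
    ... | R , x∈R , walk , closed with any? (λ z → true? (R z) ×-dec true? (Z z))
    ...   | yes (z , z∈R , z∈Z) = z , z∈Z , Star.map (λ p → proj₁ (∧-true⁻ p) , not-true⁻ (proj₂ (∧-true⁻ p))) (walk z z∈R)
    ...   | no none with free R x x∈R (λ a a∈ → ¬true⇒false λ p → none (a , a∈ , p))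
    ...     | s , t , s∈ , t∉ , e , f = ⊥-elim (true≢false (closed s t s∈ (∧-true e (not-true f))) t∉)

-- Splitting and colouring along a tight cut

record TightCut {n : ℕ} (G : Graph n) (N : Pred n) (y k z m : Fin n) : Set where
  open Graph G
  field
    y∈   : N ∋ y
    z∈   : N ∋ z
    k∉   : N ∌ k
    m∉   : N ∌ m
    yk   : E y k ≡ true
    zm   : E z m ≡ true
    diff : (y , k) ≢ (z , m)
    only : ∀ {s t} → N ∋ s → N ∌ t → E s t ≡ true → (s , t) ≡ (y , k) ⊎ (s , t) ≡ (z , m)

swapCut : ∀ {n} {G : Graph n} {N : Pred n} {y k z m : Fin n} → TightCut G N y k z m → TightCut G N z m y k
swapCut t = record { y∈ = z∈ ; z∈ = y∈ ; k∉ = m∉ ; m∉ = k∉ ; yk = zm ; zm = yk ; diff = diff ∘ sym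
                   ; only = λ p q e → swap (only p q e) }
  where open TightCut t

opCut : ∀ {n} {G : Graph n} {N : Pred n} {y k z m : Fin n} → TightCut G N y k z m → TightCut (op G) (compl N) m z k y
opCut t = record
  { y∈ = not-true m∉ ; z∈ = not-true k∉ ; k∉ = not-false z∈ ; m∉ = not-false y∈ ; yk = zm ; zm = yk
  ; diff = λ { refl → diff refl }
  ; only = λ p q e → swap (Sum.map (λ { refl → refl }) (λ { refl → refl }) (only (not-false⁻ q) (not-true⁻ p) e)) }
  where open TightCut t

SplitWalks : ∀ {n} → Graph n → Pred n → (y k z m : Fin n) → BRel n → Set
SplitWalks {n} G N y k z m α =
    (∀ x → N ∋ x → Star (Within N (λ a b → E a b ≡ true × α a b ≡ true)) x y)
  × (∀ x → N ∋ x → Star (Within N (λ a b → E a b ≡ true × α a b ≡ false)) x z)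
  where open Graph G

-- With the complement of `N` as root set, Edmonds' theorem gives both colours a way out of `N`.
-- Only two arcs lead out, so each colour owns one of them and its walks end at the tail of that
-- arc. The colours are exchanged if y → k has the wrong one.
split : ∀ {n} (G : Graph n) {N : Pred n} {y k z m : Fin n} → TightCut G N y k z m →
  Σ (BRel n) (SplitWalks G N y k z m)
split {n} G {N} {y} {k} {z} {m} cutN with Edmonds.edmonds G (compl N) (not-true (TightCut.k∉ cutN))
... | α , walk₁ , walk₀ = byColour (bool-cases (α y k))
  where
  open Graph G
  open TightCut cutN
  end : ∀ b (walk : ∀ x → ∃ λ z → compl N ∋ z × Star (λ a b′ → E a b′ ≡ true × α a b′ ≡ b) x z) →
    ∀ {q r} → (∀ {s t} → (s , t) ≡ (y , k) ⊎ (s , t) ≡ (z , m) → α s t ≡ b → (s , t) ≡ (q , r)) →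
    ∀ x → N ∋ x → Star (Within N (λ a b′ → E a b′ ≡ true × α a b′ ≡ b)) x q
  end b walk h x x∈ with walk x
  ... | w , w∉ , st with exit N st x∈ (not-true⁻ w∉)
  ...   | s , t , s∈ , t∉ , (e , f) , pre with h (only s∈ t∉ e) f
  ...     | refl = pre
  byColour : α y k ≡ true ⊎ α y k ≡ false → Σ (BRel n) (SplitWalks G N y k z m)
  byColour (inj₁ g) with walk₀ y
  ... | w , w∉ , st with exit N st y∈ (not-true⁻ w∉)
  ...   | s , t , s∈ , t∉ , (e , f) , pre with only s∈ t∉ e
  ...     | inj₁ refl = ⊥-elim (true≢false g f)
  ...     | inj₂ refl = α
    , end true walk₁ (λ { (inj₁ e) _ → e ; (inj₂ refl) h → ⊥-elim (true≢false h f) })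
    , end false walk₀ (λ { (inj₂ e) _ → e ; (inj₁ refl) h → ⊥-elim (true≢false g h) })
  byColour (inj₂ g) with walk₁ y
  ... | w , w∉ , st with exit N st y∈ (not-true⁻ w∉)
  ...   | s , t , s∈ , t∉ , (e , f) , pre with only s∈ t∉ e
  ...     | inj₁ refl = ⊥-elim (true≢false f g)
  ...     | inj₂ refl = (λ a b → not (α a b))
    , (λ x x∈ → Star.map (λ { (p , q , e , h) → p , q , e , not-true h })
        (end false walk₀ (λ { (inj₁ e) _ → e ; (inj₂ refl) h → ⊥-elim (true≢false f h) }) x x∈))
    , (λ x x∈ → Star.map (λ { (p , q , e , h) → p , q , e , not-false h })
        (end true walk₁ (λ { (inj₂ e) _ → e ; (inj₁ refl) h → ⊥-elim (true≢false h g) }) x x∈))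

module _ {n : ℕ} (G : Graph n) where
  open Graph G
  open GraphLemmas G

  -- A vertex of V₁ beyond the cut has two in-neighbours, both in V₂. If both lie in `N`, both cut
  -- arcs end at this vertex, which can happen for only one of `v` and `v′`.
  V₂-beyond : ∀ {N : Pred n} {y k z m v v′ : Fin n} → TightCut G N y k z m → N ∌ v → N ∌ v′ → v ≢ v′ →
    ∃ λ κ → N ∌ κ × c ∋ κ
  V₂-beyond {N} {y} {k} {z} {m} {v} {v′} cutN v∉ v′∉ v≢v′ with look v∉ | look v′∉
    where
    open TightCut cutN
    look : ∀ {w} → N ∌ w → (∃ λ κ → N ∌ κ × c ∋ κ) ⊎ (k ≡ w)
    look {w} w∉ with bool-cases (c w)
    ... | inj₁ cw = inj₁ (w , w∉ , cw)
    ... | inj₂ ¬cw with entering (single w) {y = y} (single-∋ w) (single-∌ λ { refl → true≢false y∈ w∉ })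
    ...   | two {s₁} {t₁} {s₂} {t₂} (p₁ , q₁ , e₁) (p₂ , q₂ , e₂) d with single-∋⁻ q₁ | single-∋⁻ q₂ | bool-cases (N s₁) | bool-cases (N s₂)
    ...     | refl | refl | inj₂ o | _      = inj₁ (s₁ , o , tailV₂ ¬cw e₁)
    ...     | refl | refl | inj₁ _ | inj₂ o = inj₁ (s₂ , o , tailV₂ ¬cw e₂)
    ...     | refl | refl | inj₁ i | inj₁ j with only i w∉ e₁ | only j w∉ e₂
    ...       | inj₁ refl | _         = inj₂ refl
    ...       | inj₂ _    | inj₁ refl = inj₂ refl
    ...       | inj₂ refl | inj₂ refl = ⊥-elim (d refl)
  ... | inj₁ κ    | _         = κ
  ... | inj₂ _    | inj₁ κ    = κ
  ... | inj₂ refl | inj₂ refl = ⊥-elim (v≢v′ refl)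

  -- Both cut arcs end at `k`, so any other vertex beyond the cut has all its in-neighbours beyond
  -- it; if it is in V₁, these are in V₂ and one of them is not `k`.
  another-V₂-beyond : ∀ {N : Pred n} {y k z v v′ : Fin n} → TightCut G N y k z k → N ∌ v → N ∌ v′ → v ≢ v′ →
    ∃ λ κ → N ∌ κ × c ∋ κ × κ ≢ k
  another-V₂-beyond {N} {y} {k} {z} {v} {v′} cutN v∉ v′∉ v≢v′ = pick (v ≟ k)
    where
    open TightCut cutN
    look : ∀ {w} → N ∌ w → w ≢ k → ∃ λ κ → N ∌ κ × c ∋ κ × κ ≢ k
    look {w} w∉ w≢k with bool-cases (c w)
    ... | inj₁ cw = w , w∉ , cw , w≢k
    ... | inj₂ ¬cw with entering (single w) {y = y} (single-∋ w) (single-∌ λ { refl → true≢false y∈ w∉ })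
    ...   | two {s₁} {t₁} {s₂} {t₂} (p₁ , q₁ , e₁) (p₂ , q₂ , e₂) d with single-∋⁻ q₁ | single-∋⁻ q₂
    ...     | refl | refl = choose (s₁ ≟ k)
      where
      beyond : ∀ {s} → E s w ≡ true → N ∌ s
      beyond {s} e with bool-cases (N s)
      ... | inj₂ o = o
      ... | inj₁ i with only i w∉ e
      ...   | inj₁ refl = ⊥-elim (w≢k refl)
      ...   | inj₂ refl = ⊥-elim (w≢k refl)
      choose : Dec (s₁ ≡ k) → ∃ λ κ → N ∌ κ × c ∋ κ × κ ≢ k
      choose (no h)     = s₁ , beyond e₁ , tailV₂ ¬cw e₁ , h
      choose (yes refl) = s₂ , beyond e₂ , tailV₂ ¬cw e₂ , λ { refl → d refl }
    pick : Dec (v ≡ k) → ∃ λ κ → N ∌ κ × c ∋ κ × κ ≢ k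
    pick (no h)     = look v∉ h
    pick (yes refl) = look v′∉ (v≢v′ ∘ sym)

-- The out-branching leaves N by y → k and the in-branching by z → m.  Inside N and inside its
-- complement both use complementary colour classes; the arcs back into N are divided according
-- to whether their head is reached from u inside N.
module Attach {n : ℕ} (G : Graph n) {N : Pred n} {y k z m u v v′ : Fin n} (cutN : TightCut G N y k z m)
  (u∈ : N ∋ u) (v∉ : N ∌ v) (v′∉ : N ∌ v′) (v≢v′ : v ≢ v′) (y≢u : y ≢ u)
  -- `hk` makes `u` adjacent to `k` unless `k` is `v`; `hz` yields an arc back to `z` in case `z` is
  -- not reached from `u` inside `N`.
  (hk : Graph.c G ∋ k ⊎ Graph.c G ∋ u ⊎ k ≡ v)
  (hz : Graph.c G ∋ z ⊎ z ≡ u ⊎ (∃ λ κ → N ∌ κ × Graph.c G ∋ κ × κ ≢ m)) where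
  open Graph G
  open GraphLemmas G
  open TightCut cutN

  back : ∀ {s t} → N ∋ s → N ∌ t → c ∋ s ⊎ c ∋ t → (s , t) ≢ (y , k) → (s , t) ≢ (z , m) → E t s ≡ true
  back s∈ t∉ h ne₁ ne₂ with adj (∋∌⇒≢ {S = N} s∈ t∉) h
  ... | inj₂ e = e
  ... | inj₁ e with only s∈ t∉ e
  ...   | inj₁ i = ⊥-elim (ne₁ i)
  ...   | inj₂ i = ⊥-elim (ne₂ i)

  module Colouring (α : BRel n) (walksN : SplitWalks G N y k z m α)
                   (γ : BRel n) (walksK : SplitWalks (op G) (compl N) k y m z γ) where

    inN : BRel n
    inN a b = N a ∧ (N b ∧ (E a b ∧ α a b))

    toV : BRel n
    toV a b = not (N a) ∧ (not (N b) ∧ (E b a ∧ not (γ a b)))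

    module Sets (PN : Pred n) (u∈PN : PN ∋ u) (walkPN : ∀ x → PN ∋ x → Star ⟦ inN ⟧ u x)
                (closedPN : ∀ a b → PN ∋ a → inN a b ≡ true → PN ∋ b)
                (PK : Pred n) (v∈PK : PK ∋ v) (walkPK : ∀ x → PK ∋ x → Star ⟦ toV ⟧ v x)
                (closedPK : ∀ a b → PK ∋ a → toV a b ≡ true → PK ∋ b) where

      χ : BRel n
      χ a b with N a | N b
      ... | true  | true  = α a b
      ... | true  | false = ⌊ (a , b) ≟ᵃ (y , k) ⌋
      ... | false | false = γ b a
      ... | false | true  = not (PN b)

      χNN : ∀ {a b} → N ∋ a → N ∋ b → χ a b ≡ α a b
      χNN {a} {b} p q with N a | N b
      χNN refl refl | true | true = refl

      χKK : ∀ {a b} → N ∌ a → N ∌ b → χ a b ≡ γ b a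
      χKK {a} {b} p q with N a | N b
      χKK refl refl | false | false = refl

      χNK : ∀ {a b} → N ∋ a → N ∌ b → χ a b ≡ ⌊ (a , b) ≟ᵃ (y , k) ⌋
      χNK {a} {b} p q with N a | N b
      χNK refl refl | true | false = refl

      χKN : ∀ {a b} → N ∌ a → N ∋ b → χ a b ≡ not (PN b)
      χKN {a} {b} p q with N a | N b
      χKN refl refl | false | true = refl

      Out In : Fin n → Fin n → Set
      Out a b = E a b ≡ true × χ a b ≡ true
      In  a b = E a b ≡ true × χ a b ≡ false

      inN⁻ : ∀ {a b} → inN a b ≡ true → N ∋ a × N ∋ b × E a b ≡ true × α a b ≡ true
      inN⁻ {a} {b} p with ∧-true⁻ {N a} p
      ... | i , q with ∧-true⁻ {N b} q
      ...   | j , r with ∧-true⁻ {E a b} r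
      ...     | e , f = i , j , e , f

      outPN : ∀ {x} → PN ∋ x → Star Out u x
      outPN p = Star.map (λ q → let (i , j , e , f) = inN⁻ q in e , trans (χNN i j) f) (walkPN _ p)

      y∈PN : PN ∋ y
      y∈PN = closed-walk PN closedPN
        (Star.map (λ { (i , j , e , f) → ∧-true i (∧-true j (∧-true e f)) }) (proj₁ walksN u u∈)) u∈PN

      outK : ∀ {x} → N ∌ x → Star Out u x
      outK x∉ = outPN y∈PN ◅◅ (yk , trans (χNK y∈ k∉) (⌊⌋-true ((y , k) ≟ᵃ (y , k)) refl)) ◅
        Star.reverse (λ { (i , j , e , f) → e , trans (χKK (not-true⁻ j) (not-true⁻ i)) f })
          (proj₁ walksK _ (not-true x∉))

      -- Since `y` is in `PN`, only z → m can point the wrong way; hence the separate treatment of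
      -- `z`.
      source : ∀ {x} → N ∋ x → PN ∌ x → ∃ λ κ → N ∌ κ × E κ x ≡ true
      source {x} x∈ x∉PN with x ≟ z
      ... | no x≢z with V₂-beyond G cutN v∉ v′∉ v≢v′
      ...   | κ , κ∉ , cκ = κ , κ∉ ,
              back x∈ κ∉ (inj₂ cκ) (λ { refl → true≢false y∈PN x∉PN }) (λ { refl → x≢z refl })
      source {x} x∈ x∉PN | yes refl = fromZ hz
        where
        ne : ∀ {κ} → (z , κ) ≢ (y , k)
        ne refl = true≢false y∈PN x∉PN
        fromZ : c ∋ z ⊎ z ≡ u ⊎ (∃ λ κ → N ∌ κ × c ∋ κ × κ ≢ m) → ∃ λ κ → N ∌ κ × E κ z ≡ true
        fromZ (inj₂ (inj₁ refl)) = ⊥-elim (true≢false u∈PN x∉PN)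
        fromZ (inj₂ (inj₂ (κ , κ∉ , cκ , κ≢m))) = κ , κ∉ , back x∈ κ∉ (inj₂ cκ) ne (λ { refl → κ≢m refl })
        fromZ (inj₁ cz) with v ≟ m
        ... | no v≢m   = v , v∉ , back x∈ v∉ (inj₁ cz) ne (λ { refl → v≢m refl })
        ... | yes refl = v′ , v′∉ , back x∈ v′∉ (inj₁ cz) ne (λ { refl → v≢v′ refl })

      out : ∀ x → Star Out u x
      out x with bool-cases (N x) | bool-cases (PN x)
      ... | inj₂ x∉ | _      = outK x∉
      ... | inj₁ _  | inj₁ p = outPN p
      ... | inj₁ x∈ | inj₂ q with source x∈ q
      ...   | κ , κ∉ , e = outK κ∉ ◅◅ (e , trans (χKN κ∉ x∈) (not-true q)) ◅ ε

      toV⁻ : ∀ {a b} → toV a b ≡ true → N ∌ a × N ∌ b × E b a ≡ true × γ a b ≡ false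
      toV⁻ {a} {b} p with ∧-true⁻ {not (N a)} p
      ... | i , q with ∧-true⁻ {not (N b)} q
      ...   | j , r with ∧-true⁻ {E b a} r
      ...     | e , f = not-true⁻ i , not-true⁻ j , e , not-true⁻ f

      inPK : ∀ {x} → PK ∋ x → Star In x v
      inPK p = Star.reverse (λ q → let (i , j , e , f) = toV⁻ q in e , trans (χKK j i) f) (walkPK _ p)

      m∈PK : PK ∋ m
      m∈PK = closed-walk PK closedPK
        (Star.map (λ { (i , j , e , f) → ∧-true i (∧-true j (∧-true e (not-true f))) }) (proj₂ walksK v (not-true v∉))) v∈PK

      inN′ : ∀ {x} → N ∋ x → Star In x v
      inN′ x∈ = Star.map (λ { (i , j , e , f) → e , trans (χNN i j) f }) (proj₂ walksN _ x∈)
        ◅◅ (zm , trans (χNK z∈ m∉) (⌊⌋-false ((z , m) ≟ᵃ (y , k)) (diff ∘ sym))) ◅ inPK m∈PK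

      -- If `u` is in V₁, the walk from `u` to `y` is not trivial and its second vertex is in V₂.
      V₂-in-PN : ∃ λ t → N ∋ t × PN ∋ t × c ∋ t
      V₂-in-PN with bool-cases (c u) | proj₁ walksN u u∈
      ... | inj₁ cu | _ = u , u∈ , u∈PN , cu
      ... | inj₂ _  | ε = ⊥-elim (y≢u refl)
      ... | inj₂ ¬cu | _◅_ {j = t} (i , j , e , f) _ =
        t , j , closedPN u t u∈PN (∧-true i (∧-true j (∧-true e f))) , headV₂ ¬cu e

      -- Since `m` is in `PK`, only y → k can point the wrong way; for `k` the arc back to `u` is
      -- used, which exists because `y` is not `u`.
      target : ∀ {x} → N ∌ x → PK ∌ x → ∃ λ t → N ∋ t × PN ∋ t × E x t ≡ true
      target {x} x∉ x∉PK with x ≟ k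
      ... | no x≢k with V₂-in-PN
      ...   | t , t∈ , t∈PN , ct = t , t∈ , t∈PN ,
              back t∈ x∉ (inj₁ ct) (λ { refl → x≢k refl }) (λ { refl → true≢false m∈PK x∉PK })
      target {x} x∉ x∉PK | yes refl = u , u∈ , u∈PN ,
        back u∈ x∉ (near hk) (λ { refl → y≢u refl }) (λ { refl → true≢false m∈PK x∉PK })
        where
        near : c ∋ k ⊎ c ∋ u ⊎ k ≡ v → c ∋ u ⊎ c ∋ k
        near (inj₁ ck)          = inj₂ ck
        near (inj₂ (inj₁ cu))   = inj₁ cu
        near (inj₂ (inj₂ refl)) = ⊥-elim (true≢false v∈PK x∉PK)

      inn : ∀ x → Star In x v
      inn x with bool-cases (N x) | bool-cases (PK x)
      ... | inj₁ x∈ | _      = inN′ x∈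
      ... | inj₂ _  | inj₁ p = inPK p
      ... | inj₂ x∉ | inj₂ q with target x∉ q
      ...   | t , t∈ , t∈PN , e = (e , trans (χKN x∉ t∈) (not-false t∈PN)) ◅ inN′ t∈

  attach : GP G u v
  attach with split G cutN | split (op G) (swapCut (opCut cutN))
  ... | α , wN | γ , wK with closure (Colouring.inN α wN γ wK) u | closure (Colouring.toV α wN γ wK) v
  ...   | PN , u∈PN , wPN , cPN | PK , v∈PK , wPK , cPK = χ , out , inn
    where open Colouring.Sets α wN γ wK PN u∈PN wPN cPN PK v∈PK wPK cPK

module _ {n : ℕ} (G : Graph n) where
  open Graph G
  open GraphLemmas G

  -- Attaching requires that the arc of the out-branching does not start at `u`; the mirror image
  -- requires instead that the arc of the in-branching does not end at `v`.
  attachᵒᵖ : ∀ {N : Pred n} {y k z m u u′ v : Fin n} → TightCut G N y k z m →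
    N ∋ u → N ∋ u′ → u ≢ u′ → N ∌ v → m ≢ v →
    c ∋ z ⊎ c ∋ v ⊎ z ≡ u → c ∋ k ⊎ k ≡ v ⊎ (∃ λ x → N ∋ x × c ∋ x × x ≢ y) → GP G u v
  attachᵒᵖ cutN u∈ u′∈ u≢u′ v∉ m≢v hz hk = GP-op G (Attach.attach (op G) (opCut cutN)
    (not-true v∉) (not-false u∈) (not-false u′∈) u≢u′ m≢v hz
    (Sum.map₂ (Sum.map₂ λ { (x , p , q , r) → x , not-false p , q , r }) hk))

-- Good pairs across a cut with only two forward arcs

-- When u → k carries the in-branching, the condition on its tail holds trivially. If both arcs
-- start at `u`, only the mirrored form applies, and the absence of u → v keeps their heads away
-- from `v`.
tight-from-root : ∀ {n} (G : Graph n) {N : Pred n} {u u′ v v′ k z m : Fin n} → TightCut G N z m u k →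
  Graph.E G u v ≡ false → N ∋ u → N ∋ u′ → u ≢ u′ → N ∌ v → N ∌ v′ → v ≢ v′ → GP G u v
tight-from-root {n} G {N} {u} {u′} {v} {v′} {k} {z} {m} cutN ¬uv u∈ u′∈ u≢u′ v∉ v′∉ v≢v′ = go (z ≟ u)
  where
  open Graph G
  open GraphLemmas G
  open TightCut cutN renaming (yk to zm′; zm to uk)
  k≢v : k ≢ v
  k≢v refl = true≢false uk ¬uv
  go : Dec (z ≡ u) → GP G u v
  go (no z≢u) with bool-cases (c m) | bool-cases (c u) | m ≟ v
  ... | inj₁ cm | _       | _      = Attach.attach G cutN u∈ v∉ v′∉ v≢v′ z≢u (inj₁ cm) (inj₂ (inj₁ refl))
  ... | inj₂ _  | inj₁ cu | _      = Attach.attach G cutN u∈ v∉ v′∉ v≢v′ z≢u (inj₂ (inj₁ cu)) (inj₂ (inj₁ refl))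
  ... | inj₂ _  | inj₂ _  | yes e  = Attach.attach G cutN u∈ v∉ v′∉ v≢v′ z≢u (inj₂ (inj₂ e)) (inj₂ (inj₁ refl))
  ... | inj₂ ¬cm | inj₂ ¬cu | no m≢v = attachᵒᵖ G (swapCut cutN) u∈ u′∈ u≢u′ v∉ m≢v
        (inj₁ (tailV₂ ¬cm zm′)) (inj₁ (headV₂ ¬cu uk))
  go (yes refl) with bool-cases (c m) | bool-cases (c k)
  ... | inj₁ cm | _       = attachᵒᵖ G cutN u∈ u′∈ u≢u′ v∉ k≢v (inj₂ (inj₂ refl)) (inj₁ cm)
  ... | inj₂ _  | inj₁ ck = attachᵒᵖ G (swapCut cutN) u∈ u′∈ u≢u′ v∉ m≢v (inj₂ (inj₂ refl)) (inj₁ ck)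
    where
    m≢v : m ≢ v
    m≢v refl = true≢false zm′ ¬uv
  ... | inj₂ _  | inj₂ _  with another-V₂-beyond (op G) (opCut cutN) (not-false u∈) (not-false u′∈) u≢u′
  ...   | x , x∈ , cx , x≢u = attachᵒᵖ G cutN u∈ u′∈ u≢u′ v∉ k≢v (inj₂ (inj₂ refl)) (inj₂ (inj₂ (x , not-false⁻ x∈ , cx , x≢u)))

-- Away from the roots the two arcs may be assigned in either order. Each has an end in V₂; if they
-- cross between the sides in the same direction and share that end, a further vertex of V₂ is
-- needed.
tight : ∀ {n} (G : Graph n) {N : Pred n} {u u′ v v′ y k z m : Fin n} → TightCut G N y k z m →
  Graph.E G u v ≡ false → N ∋ u → N ∋ u′ → u ≢ u′ → N ∌ v → N ∌ v′ → v ≢ v′ → GP G u v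
tight {n} G {N} {u} {u′} {v} {v′} {y} {k} {z} {m} cutN ¬uv u∈ u′∈ u≢u′ v∉ v′∉ v≢v′
  with y ≟ u | z ≟ u | k ≟ v | m ≟ v
... | _        | yes refl | _        | _        = tight-from-root G cutN ¬uv u∈ u′∈ u≢u′ v∉ v′∉ v≢v′
... | yes refl | _        | _        | _        = tight-from-root G (swapCut cutN) ¬uv u∈ u′∈ u≢u′ v∉ v′∉ v≢v′
... | no _     | no _     | yes refl | _        = GP-op G (tight-from-root (op G) (opCut cutN) ¬uv
      (not-true v∉) (not-true v′∉) v≢v′ (not-false u∈) (not-false u′∈) u≢u′)
... | no _     | no _     | no _     | yes refl = GP-op G (tight-from-root (op G) (opCut (swapCut cutN)) ¬uv
      (not-true v∉) (not-true v′∉) v≢v′ (not-false u∈) (not-false u′∈) u≢u′)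
... | no y≢u   | no z≢u   | no k≢v   | no m≢v   = go (bool-cases (c y)) (bool-cases (c k)) (bool-cases (c z)) (bool-cases (c m))
  where
  open Graph G
  open GraphLemmas G
  open TightCut cutN
  attachᵏ : c ∋ k → c ∋ z ⊎ z ≡ u ⊎ (∃ λ κ → N ∌ κ × c ∋ κ × κ ≢ m) → GP G u v
  attachᵏ ck = Attach.attach G cutN u∈ v∉ v′∉ v≢v′ y≢u (inj₁ ck)
  attachᶻ : c ∋ z → c ∋ k ⊎ k ≡ v ⊎ (∃ λ x → N ∋ x × c ∋ x × x ≢ y) → GP G u v
  attachᶻ cz = attachᵒᵖ G cutN u∈ u′∈ u≢u′ v∉ m≢v (inj₁ cz)
  go : c ∋ y ⊎ c ∌ y → c ∋ k ⊎ c ∌ k → c ∋ z ⊎ c ∌ z → c ∋ m ⊎ c ∌ m → GP G u v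
  go _         (inj₁ ck)  (inj₁ cz)  _          = attachᵏ ck (inj₁ cz)
  go (inj₁ cy) _          _          (inj₁ cm)  =
    Attach.attach G (swapCut cutN) u∈ v∉ v′∉ v≢v′ z≢u (inj₁ cm) (inj₁ cy)
  go (inj₂ ¬cy) (inj₂ ¬ck) _         _          = ⊥-elim (true≢false yk (ind ¬cy ¬ck))
  go _         _          (inj₂ ¬cz) (inj₂ ¬cm) = ⊥-elim (true≢false zm (ind ¬cz ¬cm))
  go (inj₂ _)  (inj₁ ck)  (inj₂ _)   (inj₁ _) with k ≟ m
  ... | no k≢m   = attachᵏ ck (inj₂ (inj₂ (k , k∉ , ck , k≢m)))
  ... | yes refl = attachᵏ ck (inj₂ (inj₂ (another-V₂-beyond G cutN v∉ v′∉ v≢v′)))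
  go (inj₁ cy) (inj₂ _)   (inj₁ cz)  (inj₂ _) with z ≟ y
  ... | no z≢y   = attachᶻ cz (inj₂ (inj₂ (z , z∈ , cz , z≢y)))
  ... | yes refl with another-V₂-beyond (op G) (opCut cutN) (not-false u∈) (not-false u′∈) u≢u′
  ...   | x , x∈ , cx , x≢y = attachᶻ cz (inj₂ (inj₂ (x , not-false⁻ x∈ , cx , x≢y)))

-- Either a third arc leaves `S`, and `e` spoils at most one of the three, or the cut is tight.
three-leaving : ∀ {n} (G : Graph n) {u u′ v v′ : Fin n} (S : Pred n) (e : Fin n × Fin n) →
  Graph.E G u v ≡ false → S ∋ u → S ∋ u′ → u ≢ u′ → S ∌ v → S ∌ v′ → v ≢ v′ →
  GP G u v ⊎ Two (λ s t → S ∋ s × S ∌ t × Graph.E G s t ≡ true × (s , t) ≢ e)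
three-leaving {n} G {u} {u′} {v} {v′} S e ¬uv u∈ u′∈ u≢u′ v∉ v′∉ v≢v′ with Graph.cut G S u∈ v∉
... | two {s₁} {t₁} {s₂} {t₂} (p₁ , q₁ , e₁) (p₂ , q₂ , e₂) d
  with any? (λ s → any? (λ t → true? (S s) ×-dec ((S t Bool.≟ false) ×-dec (true? (Graph.E G s t)
         ×-dec (¬? ((s , t) ≟ᵃ (s₁ , t₁)) ×-dec ¬? ((s , t) ≟ᵃ (s₂ , t₂)))))))
... | no none = inj₁ (tight G cutS ¬uv u∈ u′∈ u≢u′ v∉ v′∉ v≢v′)
  where
  only : ∀ {s t} → S ∋ s → S ∌ t → Graph.E G s t ≡ true → (s , t) ≡ (s₁ , t₁) ⊎ (s , t) ≡ (s₂ , t₂)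
  only {s} {t} p q r with (s , t) ≟ᵃ (s₁ , t₁) | (s , t) ≟ᵃ (s₂ , t₂)
  ... | yes i | _     = inj₁ i
  ... | no _  | yes j = inj₂ j
  ... | no i  | no j  = ⊥-elim (none (s , t , p , q , r , i , j))
  cutS : TightCut G S s₁ t₁ s₂ t₂
  cutS = record { y∈ = p₁ ; z∈ = p₂ ; k∉ = q₁ ; m∉ = q₂ ; yk = e₁ ; zm = e₂ ; diff = d ; only = only }
... | yes (s₃ , t₃ , p₃ , q₃ , e₃ , d₁ , d₂) with (s₁ , t₁) ≟ᵃ e | (s₂ , t₂) ≟ᵃ e
...   | no i     | no j     = inj₂ (two (p₁ , q₁ , e₁ , i) (p₂ , q₂ , e₂ , j) d)
...   | yes refl | _        = inj₂ (two (p₂ , q₂ , e₂ , d ∘ sym) (p₃ , q₃ , e₃ , d₁) (d₂ ∘ sym))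
...   | no i     | yes refl = inj₂ (two (p₁ , q₁ , e₁ , i) (p₃ , q₃ , e₃ , d₂) (d₁ ∘ sym))

three-entering : ∀ {n} (G : Graph n) {u u′ v v′ : Fin n} (S : Pred n) (e : Fin n × Fin n) →
  Graph.E G u v ≡ false → S ∌ u → S ∌ u′ → u ≢ u′ → S ∋ v → S ∋ v′ → v ≢ v′ →
  GP G u v ⊎ Two (λ s t → S ∌ s × S ∋ t × Graph.E G s t ≡ true × (s , t) ≢ e)
three-entering G S e ¬uv u∉ u′∉ u≢u′ v∈ v′∈ v≢v′ = Sum.map₂
  (Two-map λ { (a , b , f , ne) → not-true⁻ a , not-false⁻ b , f , ne })
  (three-leaving G (compl S) e ¬uv (not-true u∉) (not-true u′∉) u≢u′ (not-false v∈) (not-false v′∈) v≢v′)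

other-member : ∀ {n} (S : Pred n) (u : Fin n) → (∃ λ x → S ∋ x × u ≢ x) ⊎ (∀ {x} → x ≢ u → S ∌ x)
other-member S u with any? (λ x → true? (S x) ×-dec ¬? (u ≟ x))
... | yes p = inj₁ p
... | no ¬p = inj₂ λ x≢u → ¬true⇒false λ x∈ → ¬p (_ , x∈ , x≢u ∘ sym)

-- Equal or adjacent roots

root-V₂ : ∀ {n} (G : Graph n) {u : Fin n} → Graph.c G ∋ u → GP G u u
root-V₂ {n} G {u} cu = hub u
  (λ S x x∈ S⊆ → inj₂ (lossless-Q S x∈ (∉-InY S⊆ (inj₁ (here refl))) λ _ _ ()))
  (λ S x x∈ S⊆ → inj₂ (inj₁ (lossless-P S x∈ (∉-InX S⊆ (inj₁ (here refl))) λ _ _ ())))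
  where
  core : Core G u u u
  core = record
    { xs = u ∷ [] ; ys = u ∷ [] ; ps = [] ; ms = [] ; w∈V₂ = cu ; w∈xs = here refl ; w∈ys = here refl
    ; reachX = λ { (here refl) → ε } ; reachY = λ { (here refl) → ε }
    ; tails = λ () ; heads = λ () ; disj = λ () }
  open Hub G core

arc-from-V₂ : ∀ {n} (G : Graph n) {u v : Fin n} → Graph.c G ∋ u → Graph.E G u v ≡ true → GP G u v
arc-from-V₂ {n} G {u} {v} cu uv = hub v
  (λ S x x∈ S⊆ → inj₂ (lossless-Q S x∈ (∉-InY S⊆ (inj₁ (here refl))) λ _ _ ()))
  pc
  where
  core : Core G u v u
  core = record
    { xs = u ∷ [] ; ys = u ∷ v ∷ [] ; ps = [] ; ms = (u , v) ∷ [] ; w∈V₂ = cu ; w∈xs = here refl ; w∈ys = here refl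
    ; reachX = λ { (here refl) → ε }
    ; reachY = λ { (here refl) → (uv , here refl) ◅ ε ; (there (here refl)) → ε }
    ; tails = λ () ; heads = λ { (here refl) → there (here refl) } ; disj = λ () }
  open Hub G core
  pc : DeficientP v
  pc S x x∈ S⊆ with bool-cases (S v)
  ... | inj₁ v∈ = inj₂ (inj₂ (v∈ , one-lost-P S x∈ (∉-InX S⊆ (inj₁ (here refl))) λ { _ _ (here refl) → refl }))
  ... | inj₂ v∉ = inj₂ (inj₁ (lossless-P S x∈ (∉-InX S⊆ (inj₁ (here refl)))
                    λ { _ t∈ (here refl) → true≢false t∈ v∉ }))

arc-between-roots : ∀ {n} (G : Graph n) {u v : Fin n} → Graph.E G u v ≡ true → GP G u v
arc-between-roots G {u} {v} uv with bool-cases (Graph.c G u)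
... | inj₁ cu  = arc-from-V₂ G cu uv
... | inj₂ ¬cu = GP-op G (arc-from-V₂ (op G) (GraphLemmas.headV₂ G ¬cu uv) uv)

-- Roots joined by a path u → a → v with a in V₂

module Middle {n : ℕ} (G : Graph n) {u v a : Fin n} (ca : Graph.c G ∋ a) (u≢v : u ≢ v)
  (ua : Graph.E G u a ≡ true) (av : Graph.E G a v ≡ true) (¬uv : Graph.E G u v ≡ false) where
  open Graph G
  open GraphLemmas G

  private
    u≢a : u ≢ a
    u≢a = arc⇒≢ ua
    a≢v : a ≢ v
    a≢v = arc⇒≢ av

  core : Core G u v a
  core = record
    { xs = u ∷ a ∷ [] ; ys = a ∷ v ∷ [] ; ps = (u , a) ∷ [] ; ms = (a , v) ∷ [] ; w∈V₂ = ca
    ; w∈xs = there (here refl) ; w∈ys = here refl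
    ; reachX = λ { (here refl) → ε ; (there (here refl)) → (ua , here refl) ◅ ε }
    ; reachY = λ { (here refl) → (av , here refl) ◅ ε ; (there (here refl)) → ε }
    ; tails = λ { (here refl) → here refl } ; heads = λ { (here refl) → there (here refl) }
    ; disj = λ { (here refl) (here e) → u≢a (cong proj₁ e) } }

  open Hub G core

  -- What saves the set consisting of `u` alone after the loss of u → a: an out-neighbour attached
  -- to `a`, or two further out-arcs. Larger sets through `u` are served by three arcs.
  Escape : Set
  Escape = (∃ λ k → k ≢ a × E u k ≡ true × E a k ≡ true)
         ⊎ (∃₂ λ k l → k ≢ l × k ≢ a × l ≢ a × E u k ≡ true × E u l ≡ true)

  escape⇒GP : Escape → GP G u v
  escape⇒GP esc = hub v qc pc
    where
    pc : DeficientP v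
    pc S x x∈ S⊆ with bool-cases (S v)
    ... | inj₁ v∈ = inj₂ (inj₂ (v∈ , one-lost-P S x∈ (∉-InX S⊆ (inj₁ (there (here refl)))) λ { _ _ (here refl) → refl }))
    ... | inj₂ v∉ = inj₂ (inj₁ (lossless-P S x∈ (∉-InX S⊆ (inj₁ (there (here refl))))
                      λ { _ t∈ (here refl) → true≢false t∈ v∉ }))
    qc : FullQ
    qc S x x∈ S⊆ = go (bool-cases (S u)) (other-member S u)
      where
      a∉ : S ∌ a
      a∉ = ∉-InY S⊆ (inj₁ (here refl))
      v∉ : S ∌ v
      v∉ = ∉-InY S⊆ (inj₁ (there (here refl)))
      go : S ∋ u ⊎ S ∌ u → (∃ λ x → S ∋ x × u ≢ x) ⊎ (∀ {x} → x ≢ u → S ∌ x) → GP G u v ⊎ GoodQ S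
      go (inj₂ u∉) _ = inj₂ (lossless-Q S x∈ a∉ λ { s∈ _ (here refl) → true≢false s∈ u∉ })
      go (inj₁ u∈) (inj₁ (x , x∈ , u≢x)) = Sum.map₂
        (λ t → inj₂ (Two-map (λ { (p , q , e , ne) → p , q , e , λ { (here i) → ne i } }) t))
        (three-leaving G S (u , a) ¬uv u∈ x∈ u≢x v∉ a∉ (a≢v ∘ sym))
      go (inj₁ u∈) (inj₂ rest) = leave esc
        where
        leave : Escape → GP G u v ⊎ GoodQ S
        leave (inj₁ (k , k≢a , uk , ak)) = inj₂ (inj₁ (u , k , (u∈ , rest (arc⇒≢ uk ∘ sym) , uk , λ { (here refl) → k≢a refl })
              , inj₂ (ak , λ { (here refl) → true≢false uk ¬uv })))
        leave (inj₂ (k , l , k≢l , k≢a , l≢a , uk , ul)) = inj₂ (inj₂ (two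
              (u∈ , rest (arc⇒≢ uk ∘ sym) , uk , λ { (here refl) → k≢a refl })
              (u∈ , rest (arc⇒≢ ul ∘ sym) , ul , λ { (here refl) → l≢a refl }) λ { refl → k≢l refl }))

  forced : GP G u v ⊎ (∃ λ k → k ≢ a × E u k ≡ true × E a k ≡ false × (∀ {l} → E u l ≡ true → l ≡ a ⊎ l ≡ k))
  forced with second
    where
    second : ∃ λ k → k ≢ a × E u k ≡ true
    second with cut (single u) {y = v} (single-∋ u) (single-∌ (u≢v ∘ sym))
    ... | two {s₁} {t₁} {s₂} {t₂} (p₁ , _ , e₁) (p₂ , _ , e₂) d with single-∋⁻ p₁ | single-∋⁻ p₂ | t₁ ≟ a
    ...   | refl | refl | no h     = t₁ , h , e₁
    ...   | refl | refl | yes refl = t₂ , (λ { refl → d refl }) , e₂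
  ... | k , k≢a , uk with bool-cases (E a k)
  ...   | inj₁ ak = inj₁ (escape⇒GP (inj₁ (k , k≢a , uk , ak)))
  ...   | inj₂ ¬ak with any? (λ l → ¬? (k ≟ l) ×-dec (¬? (l ≟ a) ×-dec true? (E u l)))
  ...     | yes (l , k≢l , l≢a , ul) = inj₁ (escape⇒GP (inj₂ (k , l , k≢l , k≢a , l≢a , uk , ul)))
  ...     | no none = inj₂ (k , k≢a , uk , ¬ak , unique)
    where
    unique : ∀ {l} → E u l ≡ true → l ≡ a ⊎ l ≡ k
    unique {l} ul with l ≟ a | k ≟ l
    ... | yes e   | _       = inj₁ e
    ... | no _    | yes e   = inj₂ (sym e)
    ... | no l≢a  | no k≢l  = ⊥-elim (none (l , k≢l , l≢a , ul))

  -- u → k → a → v for the in-branching, u → a → l → v for the out-branching.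
  two-detours : ∀ {k l} → E u k ≡ true → E k a ≡ true → k ≢ a → E a l ≡ true → E l v ≡ true → l ≢ a →
    E a k ≡ false → E l u ≡ true → GP G u v
  two-detours {k} {l} uk ka k≢a al lv l≢a ¬ak lu = H.hub k qc pc
    where
    k≢l : k ≢ l
    k≢l refl = true≢false al ¬ak
    k≢v : k ≢ v
    k≢v refl = true≢false uk ¬uv
    l≢u : l ≢ u
    l≢u refl = true≢false lv ¬uv
    core′ : Core G u v a
    core′ = record
      { xs = u ∷ a ∷ l ∷ v ∷ [] ; ys = u ∷ k ∷ a ∷ v ∷ []
      ; ps = (u , a) ∷ (a , l) ∷ (l , v) ∷ [] ; ms = (u , k) ∷ (k , a) ∷ (a , v) ∷ []
      ; w∈V₂ = ca ; w∈xs = there (here refl) ; w∈ys = there (there (here refl))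
      ; reachX = λ { (here refl) → ε
                   ; (there (here refl)) → (ua , here refl) ◅ ε
                   ; (there (there (here refl))) → (ua , here refl) ◅ (al , there (here refl)) ◅ ε
                   ; (there (there (there (here refl)))) →
                       (ua , here refl) ◅ (al , there (here refl)) ◅ (lv , there (there (here refl))) ◅ ε }
      ; reachY = λ { (here refl) → (uk , here refl) ◅ (ka , there (here refl)) ◅ (av , there (there (here refl))) ◅ ε
                   ; (there (here refl)) → (ka , there (here refl)) ◅ (av , there (there (here refl))) ◅ ε
                   ; (there (there (here refl))) → (av , there (there (here refl))) ◅ ε
                   ; (there (there (there (here refl)))) → ε }
      ; tails = λ { (here refl) → here refl ; (there (here refl)) → there (here refl)
                  ; (there (there (here refl))) → there (there (here refl)) }
      ; heads = λ { (here refl) → there (here refl) ; (there (here refl)) → there (there (here refl))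
                  ; (there (there (here refl))) → there (there (there (here refl))) }
      ; disj = λ { (here refl) (here e) → k≢a (sym (cong proj₂ e))
                 ; (here refl) (there (here e)) → arc⇒≢ uk (cong proj₁ e)
                 ; (here refl) (there (there (here e))) → u≢a (cong proj₁ e)
                 ; (there (here refl)) (here e) → u≢a (sym (cong proj₁ e))
                 ; (there (here refl)) (there (here e)) → k≢a (sym (cong proj₁ e))
                 ; (there (here refl)) (there (there (here e))) → arc⇒≢ lv (cong proj₂ e)
                 ; (there (there (here refl))) (here e) → l≢u (cong proj₁ e)
                 ; (there (there (here refl))) (there (here e)) → k≢l (sym (cong proj₁ e))
                 ; (there (there (here refl))) (there (there (here e))) → l≢a (cong proj₁ e) } }
    module H = Hub G core′
    -- The only out-tree arc that can leave such a set is l → v, and l → u, whose head is in the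
    -- out-tree, makes up for it.
    qc : H.FullQ
    qc S x x∈ S⊆ with bool-cases (S l)
    ... | inj₁ l∈ = inj₂ (inj₁ (l , u , (l∈ , H.∉-InY S⊆ (inj₁ (here refl)) , lu ,
            λ { (here e) → l≢u (cong proj₁ e) ; (there (here e)) → l≢a (cong proj₁ e)
              ; (there (there (here e))) → u≢v (cong proj₂ e) }) , inj₁ (here refl)))
    ... | inj₂ l∉ = inj₂ (H.lossless-Q S x∈ (H.∉-InY S⊆ (inj₁ (there (there (here refl)))))
            λ { s∈ _ (here refl) → true≢false s∈ (H.∉-InY S⊆ (inj₁ (here refl)))
              ; s∈ _ (there (here refl)) → true≢false s∈ (H.∉-InY S⊆ (inj₁ (there (there (here refl)))))
              ; s∈ _ (there (there (here refl))) → true≢false s∈ l∉ })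
    pc : H.DeficientP k
    pc S x x∈ S⊆ with bool-cases (S k)
    ... | inj₁ k∈ = inj₂ (inj₂ (k∈ , H.one-lost-P S x∈ (H.∉-InX S⊆ (inj₁ (there (here refl))))
            λ { _ _ (here refl) → refl
              ; _ t∈ (there (here refl)) → ⊥-elim (true≢false t∈ (H.∉-InX S⊆ (inj₁ (there (here refl)))))
              ; _ t∈ (there (there (here refl))) → ⊥-elim (true≢false t∈ (H.∉-InX S⊆ (inj₁ (there (there (there (here refl))))))) }))
    ... | inj₂ k∉ = inj₂ (inj₁ (H.lossless-P S x∈ (H.∉-InX S⊆ (inj₁ (there (here refl))))
            λ { _ t∈ (here refl) → true≢false t∈ k∉
              ; _ t∈ (there (here refl)) → true≢false t∈ (H.∉-InX S⊆ (inj₁ (there (here refl))))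
              ; _ t∈ (there (there (here refl))) → true≢false t∈ (H.∉-InX S⊆ (inj₁ (there (there (there (here refl)))))) }))

-- If there is no escape at either end, `u` dominates only `a` and `k`, and only `a` and `l`
-- dominate `v`. Thus u → l and k → v are absent. Without l → u the vertex `l` is in V₁, so `v` is
-- in V₂ and v → k holds, which is the mirrored case.
middle : ∀ {n} (G : Graph n) {u v a : Fin n} → Graph.c G ∋ a → u ≢ v →
  Graph.E G u a ≡ true → Graph.E G a v ≡ true → Graph.E G u v ≡ false → GP G u v
middle {n} G {u} {v} {a} ca u≢v ua av ¬uv
  with Middle.forced G ca u≢v ua av ¬uv | Middle.forced (op G) ca (u≢v ∘ sym) av ua ¬uv
... | inj₁ won | _        = won
... | inj₂ _   | inj₁ won = GP-op G won
... | inj₂ (k , k≢a , uk , ¬ak , uniqueᵏ) | inj₂ (l , l≢a , lv , ¬la , uniqueˡ) = go (bool-cases (E l u))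
  where
  open Graph G
  open GraphLemmas G
  ka : E k a ≡ true
  ka = adjˡ ca (k≢a ∘ sym) ¬ak
  al : E a l ≡ true
  al = adjʳ ca l≢a ¬la
  k≢l : k ≢ l
  k≢l refl = true≢false al ¬ak
  ¬ul : E u l ≡ false
  ¬ul = ¬true⇒false λ p → Sum.[ l≢a , (λ e → k≢l (sym e)) ] (uniqueᵏ p)
  ¬kv : E k v ≡ false
  ¬kv = ¬true⇒false λ p → Sum.[ k≢a , k≢l ] (uniqueˡ p)
  l≢u : l ≢ u
  l≢u refl = true≢false lv ¬uv
  k≢v : k ≢ v
  k≢v refl = true≢false uk ¬uv
  go : E l u ≡ true ⊎ E l u ≡ false → GP G u v
  go (inj₁ lu)  = Middle.two-detours G ca u≢v ua av ¬uv uk ka k≢a al lv l≢a ¬ak lu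
  go (inj₂ ¬lu) = GP-op G (Middle.two-detours (op G) ca (u≢v ∘ sym) av ua ¬uv lv al l≢a ka uk k≢a ¬la
    (adjʳ (headV₂ l∈V₁ lv) k≢v ¬kv))
    where
    l∈V₁ : c ∌ l
    l∈V₁ = ¬true⇒false λ cl → true≢false (adjˡ cl l≢u ¬lu) ¬ul

-- The vertex list of a simple path is in reverse order: it starts with the end of the path.

data Path {n : ℕ} (R : Fin n → Fin n → Set) (h : Fin n) : Fin n → List (Fin n) → Set where
  start : Path R h h (h ∷ [])
  snoc  : ∀ {x y l} → Path R h x l → R x y → y ∉ l → Path R h y (y ∷ l)

arcsOf : ∀ {n} → List (Fin n) → List (Fin n × Fin n)
arcsOf []          = []
arcsOf (_ ∷ [])    = []
arcsOf (y ∷ x ∷ l) = (x , y) ∷ arcsOf (x ∷ l)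

module _ {n : ℕ} {R : Fin n → Fin n → Set} {h : Fin n} where

  end∈ : ∀ {y l} → Path R h y l → y ∈ l
  end∈ start        = here refl
  end∈ (snoc _ _ _) = here refl

  start∈ : ∀ {y l} → Path R h y l → h ∈ l
  start∈ start        = here refl
  start∈ (snoc p _ _) = there (start∈ p)

  snoc-arcs : ∀ {x y l} → Path R h x l → ∀ {a b} → (a , b) ∈ arcsOf (y ∷ l) → (a , b) ≡ (x , y) ⊎ (a , b) ∈ arcsOf l
  snoc-arcs start        (here e)  = inj₁ e
  snoc-arcs (snoc _ _ _) (here e)  = inj₁ e
  snoc-arcs (snoc _ _ _) (there i) = inj₂ i

  arcs-old : ∀ {x y l} → Path R h x l → ∀ {e} → e ∈ arcsOf l → e ∈ arcsOf (y ∷ l)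
  arcs-old (snoc _ _ _) i = there i

  arcs-new : ∀ {x y l} → Path R h x l → (x , y) ∈ arcsOf (y ∷ l)
  arcs-new start        = here refl
  arcs-new (snoc _ _ _) = here refl

  arc-R : ∀ {y l} → Path R h y l → ∀ {a b} → (a , b) ∈ arcsOf l → R a b
  arc-R (snoc p r _) i with snoc-arcs p i
  ... | inj₁ refl = r
  ... | inj₂ j    = arc-R p j

  arc-head : ∀ {y l} → Path R h y l → ∀ {a b} → (a , b) ∈ arcsOf l → b ∈ l
  arc-head (snoc p r _) i with snoc-arcs p i
  ... | inj₁ refl = here refl
  ... | inj₂ j    = there (arc-head p j)

  arc-tail : ∀ {y l} → Path R h y l → ∀ {a b} → (a , b) ∈ arcsOf l → a ∈ l × a ≢ y
  arc-tail (snoc p r y∉) i with snoc-arcs p i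
  ... | inj₁ refl = there (end∈ p) , λ { refl → y∉ (end∈ p) }
  ... | inj₂ j with arc-tail p j
  ...   | a∈ , _ = there a∈ , λ { refl → y∉ a∈ }

  arc-head≢start : ∀ {y l} → Path R h y l → ∀ {a b} → (a , b) ∈ arcsOf l → b ≢ h
  arc-head≢start (snoc p r y∉) i with snoc-arcs p i
  ... | inj₁ refl = λ { refl → y∉ (start∈ p) }
  ... | inj₂ j    = arc-head≢start p j

  walkToEnd : ∀ {y l} → Path R h y l → ∀ {x} → x ∈ l → Star (λ a b → R a b × (a , b) ∈ arcsOf l) x y
  walkToEnd start          (here refl) = ε
  walkToEnd (snoc p r y∉)  (here refl) = ε
  walkToEnd (snoc p r y∉)  (there x∈)  =
    Star.map (λ { (q , i) → q , arcs-old p i }) (walkToEnd p x∈) ◅◅ (r , arcs-new p) ◅ ε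

  prefix : ∀ {y l} → Path R h y l → ∀ {x} → x ∈ l → ∃ λ l′ → Path R h x l′
  prefix start          (here refl) = _ , start
  prefix p@(snoc _ _ _) (here refl) = _ , p
  prefix (snoc p _ _)   (there x∈)  = prefix p x∈

  simplePath : ∀ {x y l} → Path R h x l → Star R x y → ∃ λ l′ → Path R h y l′
  simplePath p ε = _ , p
  simplePath {l = l} p (_◅_ {j = z} r w) with z ∈? l
  ... | no z∉  = simplePath (snoc p r z∉) w
  ... | yes z∈ = simplePath (proj₂ (prefix p z∈)) w

Path-map : ∀ {n} {R R′ : Fin n → Fin n → Set} {h : Fin n} → (∀ {a b} → R a b → R′ a b) →
  ∀ {y l} → Path R h y l → Path R′ h y l
Path-map f start        = start
Path-map f (snoc p r i) = snoc (Path-map f p) (f r) i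

-- `later` prepares an exchange: a set with the old end but without the new one is entered along the
-- discarded part, by an arc whose head is off the kept part.
record Truncation {n : ℕ} (R : Fin n → Fin n → Set) (h : Fin n) (Q : Pred n) (y : Fin n) (l : List (Fin n)) : Set where
  field
    b     : Fin n
    l′    : List (Fin n)
    path  : Path R h b l′
    b∈Q   : Q ∋ b
    first : ∀ {x} → x ∈ l′ → x ≢ b → Q ∌ x
    sub   : ∀ {x} → x ∈ l′ → x ∈ l
    arcs⊆ : ∀ {e} → e ∈ arcsOf l′ → e ∈ arcsOf l
    later : ∀ S → S ∌ b → S ∋ y → ∃₂ λ w z → (w , z) ∈ arcsOf l × S ∌ w × S ∋ z × z ∉ l′

truncate : ∀ {n} {R : Fin n → Fin n → Set} {h : Fin n} (Q : Pred n) {y l} → Path R h y l →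
  (∀ {x} → x ∈ l → Q ∌ x) ⊎ Truncation R h Q y l
truncate {h = h} Q start with bool-cases (Q h)
... | inj₂ ¬q = inj₁ λ { (here refl) → ¬q }
... | inj₁ q  = inj₂ record { b = h ; l′ = h ∷ [] ; path = start ; b∈Q = q
  ; first = λ { (here refl) ne → ⊥-elim (ne refl) } ; sub = id ; arcs⊆ = id
  ; later = λ S p p′ → ⊥-elim (true≢false p′ p) }
truncate Q {y} (snoc {x} {l = l} p r y∉) with truncate Q p
... | inj₂ t = inj₂ record { b = b ; l′ = l′ ; path = path ; b∈Q = b∈Q ; first = first ; sub = there ∘ sub
  ; arcs⊆ = arcs-old p ∘ arcs⊆ ; later = later′ }
  where
  open Truncation t
  later′ : ∀ S → S ∌ b → S ∋ y → ∃₂ λ w z → (w , z) ∈ arcsOf (y ∷ l) × S ∌ w × S ∋ z × z ∉ l′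
  later′ S b∉ y∈ with bool-cases (S x)
  ... | inj₂ x∉ = x , y , arcs-new p , x∉ , y∈ , y∉ ∘ sub
  ... | inj₁ x∈ with later S b∉ x∈
  ...   | w , z , i , w∉ , z∈ , z∉ = w , z , arcs-old p i , w∉ , z∈ , z∉
... | inj₁ none with bool-cases (Q y)
...   | inj₂ ¬q = inj₁ λ { (here refl) → ¬q ; (there i) → none i }
...   | inj₁ q  = inj₂ record { b = y ; l′ = y ∷ l ; path = snoc p r y∉ ; b∈Q = q
  ; first = λ { (here refl) ne → ⊥-elim (ne refl) ; (there i) _ → none i } ; sub = id ; arcs⊆ = id
  ; later = λ S p p′ → ⊥-elim (true≢false p′ p) }

-- Paths whose removal keeps everything reachable

module Valid {n : ℕ} (G : Graph n) (h u : Fin n) where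
  open Graph G
  open GraphLemmas G

  -- The cut form of: every vertex is reachable from h or u without the arcs es.
  ValidArcs : List (Fin n × Fin n) → Set
  ValidArcs es = ∀ S x → S ∋ x → S ∌ h → S ∌ u → ∃₂ λ s t → S ∌ s × S ∋ t × E s t ≡ true × (s , t) ∉ es

  -- Only the arc from `b` to `w` becomes newly used. A set that relied on it gets y → w in return
  -- if `y` is outside, and otherwise an arc of the discarded part.
  shortcut : ∀ (rest : List (Fin n × Fin n)) {y l w} (Q : Pred n) (t : Truncation ⟦ E ⟧ h Q y l) → Path ⟦ E ⟧ h y l →
    w ∉ l → E y w ≡ true → (∀ {a b} → (a , b) ∈ rest → b ∉ w ∷ l) →
    ValidArcs (rest ++ (y , w) ∷ arcsOf l) →
    ValidArcs (rest ++ (Truncation.b t , w) ∷ arcsOf (Truncation.l′ t))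
  shortcut rest {y} {l} {w} Q t p w∉l yw rest∉ valid S x x∈ h∉ u∉ with valid S x x∈ h∉ u∉
  ... | s , t₁ , s∉ , t∈ , e , free = go ((s , t₁) ≟ᵃ (b , w))
    where
    open Truncation t
    keep : ∀ {f} → f ∉ rest ++ (y , w) ∷ arcsOf l → f ≢ (b , w) → f ∉ rest ++ (b , w) ∷ arcsOf l′
    keep f∉ ne i with ∈-++⁻ rest i
    ... | inj₁ j         = f∉ (∈-++⁺ˡ j)
    ... | inj₂ (here eq) = ne eq
    ... | inj₂ (there j) = f∉ (∈-++⁺ʳ rest (there (arcs⊆ j)))
    go : Dec ((s , t₁) ≡ (b , w)) → ∃₂ λ s t → S ∌ s × S ∋ t × E s t ≡ true × (s , t) ∉ rest ++ (b , w) ∷ arcsOf l′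
    go (no ne) = s , t₁ , s∉ , t∈ , e , keep free ne
    go (yes refl) with bool-cases (S y)
    ... | inj₂ y∉ = y , w , y∉ , t∈ , yw , fresh
      where
      fresh : (y , w) ∉ rest ++ (b , w) ∷ arcsOf l′
      fresh i with ∈-++⁻ rest i
      ... | inj₁ j           = rest∉ j (here refl)
      ... | inj₂ (here refl) = free (∈-++⁺ʳ rest (here refl))
      ... | inj₂ (there j)   = w∉l (arc-head p (arcs⊆ j))
    ... | inj₁ y∈ with later S s∉ y∈
    ...   | a , z , i , a∉ , z∈ , z∉l′ = a , z , a∉ , z∈ , arc-R p i , fresh
      where
      fresh : (a , z) ∉ rest ++ (b , w) ∷ arcsOf l′
      fresh j with ∈-++⁻ rest j
      ... | inj₁ j′          = rest∉ j′ (there (arc-head p i))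
      ... | inj₂ (here refl) = w∉l (arc-head p i)
      ... | inj₂ (there j′)  = z∉l′ (arc-head path j′)

  record ValidPath (v : Fin n) (e₀ : Fin n × Fin n) : Set where
    field
      y     : Fin n
      l     : List (Fin n)
      path  : Path ⟦ E ⟧ h y l
      yv    : E y v ≡ true
      v∉l   : v ∉ l
      valid : ValidArcs ((y , v) ∷ arcsOf l)
      avoid : e₀ ∉ (y , v) ∷ arcsOf l

  -- Edmonds' theorem gives two disjoint arc classes, each reaching everything from `h`. The path is
  -- taken in the class without `e₀`, and the other class proves validity.
  validPath : ∀ {v} → h ≢ v → ∀ e₀ → ValidPath v e₀
  validPath {v} h≢v (a₀ , b₀) with Edmonds.edmonds (op G) (single h) (single-∋ h)
  ... | α , walk₁ , walk₀ = byColour (bool-cases (α b₀ a₀))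
    where
    fromRoot : ∀ {β} → (∀ x → ∃ λ z → single h ∋ z × Star (λ a b → E b a ≡ true × α a b ≡ β) x z) →
      ∀ x → Star (λ a b → E a b ≡ true × α b a ≡ β) h x
    fromRoot walk x with walk x
    ... | z , z∈ , w with single-∋⁻ z∈
    ...   | refl = Star.reverse id w
    build : ∀ β γ → β ≢ γ → α b₀ a₀ ≡ γ → (∀ x → Star (λ a b → E a b ≡ true × α b a ≡ β) h x) →
      (∀ x → Star (λ a b → E a b ≡ true × α b a ≡ γ) h x) → ValidPath v (a₀ , b₀)
    build β γ β≢γ e₀ walk other with simplePath start (walk v)
    ... | _ , start = ⊥-elim (h≢v refl)
    ... | _ , snoc {y} {l = l} p (yv , col) v∉ = record
      { y = y ; l = l ; path = Path-map proj₁ p ; yv = yv ; v∉l = v∉ ; valid = valid ; avoid = avoid }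
      where
      colour : ∀ {a b} → (a , b) ∈ (y , v) ∷ arcsOf l → α b a ≡ β
      colour (here refl) = col
      colour (there i)   = proj₂ (arc-R p i)
      valid : ValidArcs ((y , v) ∷ arcsOf l)
      valid S x x∈ h∉ _ with cross (compl S) (other x) (not-true h∉) (not-false x∈)
      ... | s , t , s∉ , t∈ , e , c′ = s , t , not-true⁻ s∉ , not-false⁻ t∈ , e ,
              λ i → β≢γ (trans (sym (colour i)) c′)
      avoid : (a₀ , b₀) ∉ (y , v) ∷ arcsOf l
      avoid i = β≢γ (trans (sym (colour i)) e₀)
    byColour : α b₀ a₀ ≡ true ⊎ α b₀ a₀ ≡ false → ValidPath v (a₀ , b₀)
    byColour (inj₁ p) = build false true (λ ()) p (fromRoot walk₀) (fromRoot walk₁)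
    byColour (inj₂ p) = build true false (λ ()) p (fromRoot walk₁) (fromRoot walk₀)

  record FirstToV (v : Fin n) : Set where
    field
      b     : Fin n
      l     : List (Fin n)
      path  : Path ⟦ E ⟧ h b l
      bv    : E b v ≡ true
      first : ∀ {x} → x ∈ l → x ≢ b → E x v ≡ false
      v∉l   : v ∉ l
      valid : ValidArcs ((b , v) ∷ arcsOf l)

  firstToV : ∀ {v} → h ≢ v → ∀ e₀ → Σ (FirstToV v) λ F →
    e₀ ≢ (FirstToV.b F , v) → e₀ ∉ (FirstToV.b F , v) ∷ arcsOf (FirstToV.l F)
  firstToV {v} h≢v e₀ with validPath h≢v e₀
  ... | vp with truncate (λ x → E x v) (ValidPath.path vp)
  ...   | inj₁ none = ⊥-elim (true≢false (ValidPath.yv vp) (none (end∈ (ValidPath.path vp))))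
  ...   | inj₂ t = record
    { b = b ; l = l′ ; path = path ; bv = b∈Q ; first = first ; v∉l = P.v∉l ∘ sub
    ; valid = shortcut [] (λ x → E x v) t P.path P.v∉l P.yv (λ ()) P.valid }
    , λ { ne (here e) → ne e ; ne (there i) → P.avoid (there (arcs⊆ i)) }
    where
    open Truncation t
    module P = ValidPath vp

another-in : ∀ {n} (G : Graph n) {v b : Fin n} → Graph.E G b v ≡ true → ∃ λ b₁ → b₁ ≢ b × Graph.E G b₁ v ≡ true
another-in G {v} {b} bv with GraphLemmas.entering G (single v) {y = b} (single-∋ v) (single-∌ (GraphLemmas.arc⇒≢ G bv))
... | two {s₁} {t₁} {s₂} {t₂} (_ , q₁ , e₁) (_ , q₂ , e₂) d with single-∋⁻ q₁ | single-∋⁻ q₂ | s₁ ≟ b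
...   | refl | refl | no h     = s₁ , h , e₁
...   | refl | refl | yes refl = s₂ , (λ { refl → d refl }) , e₂

-- Both roots in V₂, and no path u → a → v with a in V₂

module RootsInV₂ {n : ℕ} (G : Graph n) {u v : Fin n} (cu : Graph.c G ∋ u) (cv : Graph.c G ∋ v)
  (u≢v : u ≢ v) (¬uv : Graph.E G u v ≡ false)
  (noMiddle : ∀ a → Graph.c G ∋ a → Graph.E G u a ≡ true → Graph.E G a v ≡ false) where
  open Graph G
  open GraphLemmas G
  open Valid G u u

  module Along (F : FirstToV v) where
    open FirstToV F

    b≢v : b ≢ v
    b≢v = arc⇒≢ bv

    core : Core G u v u
    core = record
      { xs = u ∷ [] ; ys = v ∷ l ; ps = [] ; ms = (b , v) ∷ arcsOf l ; w∈V₂ = cu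
      ; w∈xs = here refl ; w∈ys = there (start∈ path)
      ; reachX = λ { (here refl) → ε }
      ; reachY = λ { (here refl) → ε
                   ; (there x∈) → Star.map (λ { (e , i) → e , there i }) (walkToEnd path x∈) ◅◅ (bv , here refl) ◅ ε }
      ; tails = λ () ; heads = λ { (here refl) → here refl ; (there i) → there (arc-head path i) }
      ; disj = λ () }
    open Hub G core

    fromV : ∀ {t} → (v , t) ∉ (b , v) ∷ arcsOf l
    fromV (here e)  = b≢v (sym (cong proj₁ e))
    fromV (there i) = v∉l (proj₁ (arc-tail path i))

    toV : ∀ {s} → s ≢ b → (s , v) ∉ (b , v) ∷ arcsOf l
    toV s≢b (here e)  = s≢b (cong proj₁ e)
    toV s≢b (there i) = v∉l (arc-head path i)

    -- Path vertices before `b` have no arc to `v`, so `v` in V₂ dominates them from within the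
    -- in-tree. Only sets with `v` or `b` can be short of arcs; those through `r` keep one arc by
    -- validity.
    finishWith : ∀ r →
      (∀ S → (∀ y → S ∋ y → ¬ InX y) → S ∋ v → S ∌ r → GoodP S) →
      (∀ S → (∀ y → S ∋ y → ¬ InX y) → S ∋ b → S ∌ v → S ∌ r → GoodP S) → GP G u v
    finishWith r atV atB = hub r
      (λ S x x∈ S⊆ → inj₂ (lossless-Q S x∈ (∉-InY S⊆ (inj₁ (there (start∈ path)))) λ _ _ ())) pc
      where
      pc : DeficientP r
      pc S x x∈ S⊆ = inj₂ (go (bool-cases (S r)))
        where
        u∉ : S ∌ u
        u∉ = ∉-InX S⊆ (inj₁ (here refl))
        byHead : S ∌ r → ∀ {s t} → S ∋ t → (s , t) ∈ (b , v) ∷ arcsOf l → GoodP S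
        byHead r∉ t∈ (here refl) = atV S S⊆ t∈ r∉
        byHead r∉ {s} {t} t∈ (there i) with bool-cases (S v) | t ≟ b
        ... | inj₁ v∈ | _        = atV S S⊆ v∈ r∉
        ... | inj₂ v∉ | yes refl = atB S S⊆ t∈ v∉ r∉
        ... | inj₂ v∉ | no t≢b   = inj₁ (v , t , (v∉ , t∈ , adjʳ cv (∋∌⇒≢ {S = S} t∈ v∉) (first (arc-head path i) t≢b) , fromV) , inj₁ (here refl))
        go : S ∋ r ⊎ S ∌ r → GoodP S ⊎ (S ∋ r × (∃₂ λ s t → Entering S s t))
        go (inj₁ r∈) = inj₂ (r∈ , valid S x x∈ u∉ u∉)
        go (inj₂ r∉) with entering S x∈ u∉
        ... | two {s₁} {t₁} {s₂} {t₂} (a₁ , b₁ , e₁) (a₂ , b₂ , e₂) d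
          with (s₁ , t₁) ∈ᵃ? ((b , v) ∷ arcsOf l) | (s₂ , t₂) ∈ᵃ? ((b , v) ∷ arcsOf l)
        ...   | yes i | _     = inj₁ (byHead r∉ b₁ i)
        ...   | no _  | yes j = inj₁ (byHead r∉ b₂ j)
        ...   | no i  | no j  = inj₁ (inj₂ (two (a₁ , b₁ , e₁ , i) (a₂ , b₂ , e₂ , j) d))

    -- The deficient vertex is the tail of an arc between `b` and `b₁`: a set without the tail is
    -- entered by this arc or by an arc to `v`. The arc to `u` attaches `b₁` to the in-tree.
    second-in : ∀ b₁ → b₁ ≢ b → E b₁ v ≡ true → E b₁ u ≡ true → c ∋ b₁ ⊎ c ∋ b → GP G u v
    second-in b₁ b₁≢b b₁v b₁u near with bool-cases (E b₁ b)
    ... | inj₁ b₁b = finishWith b₁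
      (λ S S⊆ v∈ b₁∉ → inj₁ (b₁ , v , (b₁∉ , v∈ , b₁v , toV b₁≢b) , inj₂ (b₁u , λ ())))
      (λ S S⊆ b∈ v∉ b₁∉ → inj₁ (b₁ , b , (b₁∉ , b∈ , b₁b , toB) , inj₂ (b₁u , λ ())))
      where
      toB : (b₁ , b) ∉ (b , v) ∷ arcsOf l
      toB (here e)  = b₁≢b (cong proj₁ e)
      toB (there i) = true≢false b₁v (first (proj₁ (arc-tail path i)) b₁≢b)
    ... | inj₂ ¬b₁b = finishWith b atV (λ S S⊆ b∈ v∉ b∉ → ⊥-elim (true≢false b∈ b∉))
      where
      bb₁ : E b b₁ ≡ true
      bb₁ with adj b₁≢b near
      ... | inj₁ e = ⊥-elim (true≢false e ¬b₁b)
      ... | inj₂ e = e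
      atV : ∀ S → (∀ y → S ∋ y → ¬ InX y) → S ∋ v → S ∌ b → GoodP S
      atV S S⊆ v∈ b∉ with bool-cases (S b₁)
      ... | inj₂ b₁∉ = inj₁ (b₁ , v , (b₁∉ , v∈ , b₁v , toV b₁≢b) , inj₂ (b₁u , λ ()))
      ... | inj₁ b₁∈ = inj₁ (b , b₁ , (b∉ , b₁∈ , bb₁ , fromB) , inj₁ (there (end∈ path)))
        where
        fromB : (b , b₁) ∉ (b , v) ∷ arcsOf l
        fromB (here e)  = arc⇒≢ b₁v (cong proj₂ e)
        fromB (there i) = proj₂ (arc-tail path i) refl

    -- Here `b` is in V₁, and by validity it has an in-neighbour `y` in V₂ off the used arcs. If `y`
    -- is not `u`, it dominates `u`, and it is dominated by `v` when the two differ; so y → b or v →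
    -- y enters every set with `b` and without `v`.
    only-V₁ : (∀ x → c ∋ x → E u x ≡ false) → (∀ x → c ∋ x → E x v ≡ false) → GP G u v
    only-V₁ outV₁ inV₁ = finishWith v (λ S S⊆ v∈ v∉ → ⊥-elim (true≢false v∈ v∉)) atB
      where
      b≢u : b ≢ u
      b≢u e = true≢false (subst (λ x → E x v ≡ true) e bv) ¬uv
      ¬cb : c ∌ b
      ¬cb = ¬true⇒false λ cb → true≢false bv (inV₁ b cb)
      atB : ∀ S → (∀ y → S ∋ y → ¬ InX y) → S ∋ b → S ∌ v → S ∌ v → GoodP S
      atB S S⊆ b∈ v∉ _ with valid (single b) b (single-∋ b) (single-∌ (b≢u ∘ sym)) (single-∌ (b≢u ∘ sym))
      ... | y , t , y∉ , t∈ , e , free with single-∋⁻ t∈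
      ...   | refl = go (y ≟ u) (bool-cases (S y))
        where
        cy : c ∋ y
        cy = tailV₂ ¬cb e
        u∉ : S ∌ u
        u∉ = ∉-InX S⊆ (inj₁ (here refl))
        go : Dec (y ≡ u) → S ∋ y ⊎ S ∌ y → GoodP S
        go (yes refl) _ = inj₁ (u , b , (u∉ , b∈ , e , free) , inj₁ (there (start∈ path)))
        go (no y≢u) (inj₂ y∉S) = inj₁ (y , b , (y∉S , b∈ , e , free) , inj₂ (adjˡ cu (y≢u ∘ sym) (outV₁ y cy) , λ ()))
        go (no y≢u) (inj₁ y∈S) = inj₁ (v , y , (v∉ , y∈S , adjʳ cv (∋∌⇒≢ {S = S} y∈S v∉) (inV₁ y cy) , fromV) , inj₁ (here refl))

  -- Deleting the arcs of a path with two arcs removes at most one arc of any cut.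
  twoStep : ∀ {x} → E u x ≡ true → E x v ≡ true → FirstToV v
  twoStep {x} ux xv = record
    { b = x ; l = x ∷ u ∷ [] ; path = snoc start ux (λ { (here e) → arc⇒≢ ux (sym e) }) ; bv = xv
    ; first = λ { (here refl) ne → ⊥-elim (ne refl) ; (there (here refl)) _ → ¬uv }
    ; v∉l = λ { (here refl) → true≢false xv irr ; (there (here refl)) → u≢v refl }
    ; valid = valid′ }
    where
    valid′ : ValidArcs ((x , v) ∷ (u , x) ∷ [])
    valid′ S w w∈ u∉ _ with entering S w∈ u∉
    ... | two {s₁} {t₁} {s₂} {t₂} (a₁ , b₁ , e₁) (a₂ , b₂ , e₂) d
      with (s₁ , t₁) ∈ᵃ? ((x , v) ∷ (u , x) ∷ []) | (s₂ , t₂) ∈ᵃ? ((x , v) ∷ (u , x) ∷ [])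
    ...   | no i  | _     = s₁ , t₁ , a₁ , b₁ , e₁ , i
    ...   | yes _ | no j  = s₂ , t₂ , a₂ , b₂ , e₂ , j
    ...   | yes (here refl)         | yes (here refl)         = ⊥-elim (d refl)
    ...   | yes (here refl)         | yes (there (here refl)) = ⊥-elim (true≢false b₂ a₁)
    ...   | yes (there (here refl)) | yes (here refl)         = ⊥-elim (true≢false b₁ a₂)
    ...   | yes (there (here refl)) | yes (there (here refl)) = ⊥-elim (d refl)

  someMiddle : (∃ λ b₀ → c ∋ b₀ × E b₀ v ≡ true) → GP G u v
  someMiddle (b₀ , cb₀ , b₀v) with any? (λ x → true? (E u x) ×-dec true? (E x v))
  ... | yes (x , ux , xv) = Along.second-in (twoStep ux xv) b₀ (λ { refl → true≢false ux ¬ub₀ }) b₀v b₀u (inj₁ cb₀)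
    where
    ¬ub₀ : E u b₀ ≡ false
    ¬ub₀ = ¬true⇒false λ e → true≢false b₀v (noMiddle b₀ cb₀ e)
    b₀u : E b₀ u ≡ true
    b₀u = adjˡ cu (λ { refl → true≢false b₀v ¬uv }) ¬ub₀
  -- The pair (u , u) is a dummy: no arc has to be avoided here.
  ... | no none with proj₁ (firstToV u≢v (u , u))
  ...   | F with bool-cases (c (FirstToV.b F))
  ...     | inj₂ ¬cb = Along.second-in F b₀ (λ { refl → true≢false cb₀ ¬cb }) b₀v b₀u (inj₁ cb₀)
    where
    b₀u : E b₀ u ≡ true
    b₀u = adjˡ cu (λ { refl → true≢false b₀v ¬uv }) (¬true⇒false λ e → none (b₀ , e , b₀v))
  ...     | inj₁ cb with another-in G (FirstToV.bv F)
  ...       | b₁ , b₁≢b , b₁v = Along.second-in F b₁ b₁≢b b₁v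
              (adjˡ cu (λ { refl → true≢false b₁v ¬uv }) (¬true⇒false λ e → none (b₁ , e , b₁v))) (inj₂ cb)

roots-V₂ : ∀ {n} (G : Graph n) {u v : Fin n} → Graph.c G ∋ u → Graph.c G ∋ v → u ≢ v → Graph.E G u v ≡ false →
  (∀ a → Graph.c G ∋ a → Graph.E G u a ≡ true → Graph.E G a v ≡ false) → GP G u v
roots-V₂ {n} G {u} {v} cu cv u≢v ¬uv noMiddle with any? (λ x → true? (c x) ×-dec true? (E x v))
  where open Graph G
... | yes p = RootsInV₂.someMiddle G cu cv u≢v ¬uv noMiddle p
... | no noIn with any? (λ x → true? (c x) ×-dec true? (E u x))
  where open Graph G
...   | yes p = GP-op G (RootsInV₂.someMiddle (op G) cv cu (u≢v ∘ sym) ¬uv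
          (λ a ca av → ¬true⇒false λ ua → true≢false av (noMiddle a ca ua)) p)
...   | no noOut = RootsInV₂.Along.only-V₁ G cu cv u≢v ¬uv noMiddle
          (proj₁ (Valid.firstToV G u u u≢v (u , u)))
          (λ x cx → ¬true⇒false λ e → noOut (x , cx , e)) (λ x cx → ¬true⇒false λ e → noIn (x , cx , e))

-- Path-shaped in-trees to a root in V₁

arcsOf-snoc : ∀ {n} {R : Fin n → Fin n → Set} {h x y l} → Path R h x l → arcsOf (y ∷ l) ≡ (x , y) ∷ arcsOf l
arcsOf-snoc start        = refl
arcsOf-snoc (snoc _ _ _) = refl

valid? : ∀ {n} (G : Graph n) (h u : Fin n) (es : List (Fin n × Fin n)) →
  Valid.ValidArcs G h u es ⊎ (Σ (Pred n) λ S → ∃ λ x → S ∋ x × S ∌ h × S ∌ u ×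
    (∀ {s t} → S ∌ s → S ∋ t → Graph.E G s t ≡ true → (s , t) ∈ es))
valid? {n} G h u es with closure ρ h | closure ρ u
  where
  ρ : BRel n
  ρ a b = Graph.E G a b ∧ not ⌊ (a , b) ∈ᵃ? es ⌋
... | A , h∈A , walkA , closedA | B , u∈B , walkB , closedB
  with any? (λ x → (A x ∨ B x) Bool.≟ false)
... | yes (x , x∉) = inj₂ (compl M , x , not-true x∉ , not-false (∨-trueˡ h∈A) , not-false (∨-trueʳ u∈B) , inside)
  where
  M : Pred n
  M a = A a ∨ B a
  inside : ∀ {s t} → compl M ∌ s → compl M ∋ t → Graph.E G s t ≡ true → (s , t) ∈ es
  inside {s} {t} s∈ t∉ e with (s , t) ∈ᵃ? es
  ... | yes i = i
  ... | no ¬i with ∨-true⁻ {A s} (not-false⁻ s∈) | ∨-false⁻ {A t} (not-true⁻ t∉)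
  ...   | inj₁ p | q , _ = ⊥-elim (true≢false (closedA s t p (∧-true e (not-true (⌊⌋-false ((s , t) ∈ᵃ? es) ¬i)))) q)
  ...   | inj₂ p | _ , q = ⊥-elim (true≢false (closedB s t p (∧-true e (not-true (⌊⌋-false ((s , t) ∈ᵃ? es) ¬i)))) q)
... | no none = inj₁ valid
  where
  valid : Valid.ValidArcs G h u es
  valid S x x∈ h∉ u∉ with bool-cases (A x) | bool-cases (B x)
  ... | inj₂ p | inj₂ q = ⊥-elim (none (x , ∨-false p q))
  ... | inj₁ p | _ with cross (compl S) (walkA x p) (not-true h∉) (not-false x∈)
  ...   | s , t , s∉ , t∈ , r = s , t , not-true⁻ s∉ , not-false⁻ t∈ , proj₁ (∧-true⁻ r) ,
            ⌊⌋-false⁻ ((s , t) ∈ᵃ? es) (not-true⁻ (proj₂ (∧-true⁻ {Graph.E G s t} r)))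
  valid S x x∈ h∉ u∉ | inj₂ _ | inj₁ q with cross (compl S) (walkB x q) (not-true u∉) (not-false x∈)
  ...   | s , t , s∉ , t∈ , r = s , t , not-true⁻ s∉ , not-false⁻ t∈ , proj₁ (∧-true⁻ r) ,
            ⌊⌋-false⁻ ((s , t) ∈ᵃ? es) (not-true⁻ (proj₂ (∧-true⁻ {Graph.E G s t} r)))

-- All arcs go from `u` to `h`, whereas no arc of an in-part ends at `h`; this gives
-- arc-disjointness.
record OutPart {n : ℕ} (G : Graph n) (u h : Fin n) : Set where
  open Graph G
  field
    xs     : List (Fin n)
    ps     : List (Fin n × Fin n)
    h∈xs   : h ∈ xs
    u∈xs   : u ∈ xs
    reachX : ∀ {x} → x ∈ xs → Star (λ a b → E a b ≡ true × (a , b) ∈ ps) u x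
    tails  : ∀ {a b} → (a , b) ∈ ps → a ≡ u
    heads  : ∀ {a b} → (a , b) ∈ ps → b ≡ h

record InPart {n : ℕ} (G : Graph n) (h v : Fin n) (e₀ : Fin n × Fin n) : Set where
  open Graph G
  field
    ys     : List (Fin n)
    ms     : List (Fin n × Fin n)
    h∈ys   : h ∈ ys
    v∈ys   : v ∈ ys
    reachY : ∀ {y} → y ∈ ys → Star (λ a b → E a b ≡ true × (a , b) ∈ ms) y v
    heads  : ∀ {a b} → (a , b) ∈ ms → b ∈ ys
    head≢h : ∀ {a b} → (a , b) ∈ ms → b ≢ h
    e₀∉ms  : e₀ ∉ ms

joinParts : ∀ {n} {G : Graph n} {u v h : Fin n} {e₀ : Fin n × Fin n} → Graph.c G ∋ h →
  OutPart G u h → InPart G h v e₀ → Core G u v h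
joinParts ch o i = record
  { xs = xs ; ys = ys ; ps = ps ; ms = ms ; w∈V₂ = ch ; w∈xs = h∈xs ; w∈ys = h∈ys ; reachX = reachX ; reachY = reachY
  ; tails = λ p → subst (_∈ xs) (sym (O.tails p)) u∈xs ; heads = I.heads
  ; disj = λ p q → head≢h q (O.heads p) }
  where
  module O = OutPart o
  module I = InPart i
  open O using (xs; ps; h∈xs; u∈xs; reachX)
  open I using (ys; ms; h∈ys; reachY; head≢h)

-- The in-neighbours of v ∈ V₁ lie in V₂ and dominate the hub h.  The in-tree is a path from h ending
-- with d → b → v; v and b, and d if it is in V₁, are the only vertices that can be hard to reach
-- by the out-branching, and a second in-neighbour b₁ of v ties them together.
module Long {n : ℕ} (G : Graph n) {u v h p₀ q₀ : Fin n} (ch : Graph.c G ∋ h) (¬cv : Graph.c G ∌ v)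
  (¬hv : Graph.E G h v ≡ false) (¬uv : Graph.E G u v ≡ false)
  (far : ∀ x → Graph.E G x v ≡ true → Graph.E G h x ≡ false)
  (q₀≢v : q₀ ≢ v) (¬q₀v : Graph.E G q₀ v ≡ false)
  (outPart : OutPart G u h)
  (fullQ : ∀ (i : InPart G h v (p₀ , q₀)) → Hub.FullQ G (joinParts ch outPart i)) where
  open Graph G
  open GraphLemmas G
  open Valid G h u
  module O = OutPart outPart

  private
    back : ∀ {x} → E x v ≡ true → E x h ≡ true
    back {x} xv = adjˡ ch (λ { refl → true≢false xv ¬hv }) (far x xv)
    h≢v : h ≢ v
    h≢v refl = true≢false ch ¬cv

  module WithPath {d : Fin n} {l : List (Fin n)} (path : Path ⟦ E ⟧ h d l)
    (noV : ∀ {x} → x ∈ l → E x v ≡ false) (v∉l : v ∉ l) (e₀∉l : (p₀ , q₀) ∉ arcsOf l) where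

    module WithEnd {b b₁ : Fin n} (db : E d b ≡ true) (bv : E b v ≡ true) (b₁v : E b₁ v ≡ true) (b₁≢b : b₁ ≢ b)
      (valid : ValidArcs ((b , v) ∷ (d , b) ∷ arcsOf l))
      (early : ∀ {x} → x ∈ l → x ≢ d → c ∌ x → E b x ≡ true ⊎ E b₁ x ≡ true) where

      b∉l : b ∉ l
      b∉l i = true≢false bv (noV i)
      b₁∉l : b₁ ∉ l
      b₁∉l i = true≢false b₁v (noV i)
      b≢v : b ≢ v
      b≢v = arc⇒≢ bv
      d∈l : d ∈ l
      d∈l = end∈ path
      cb₁ : c ∋ b₁
      cb₁ = tailV₂ ¬cv b₁v

      ms : List (Fin n × Fin n)
      ms = (b , v) ∷ (d , b) ∷ arcsOf l

      inPart : InPart G h v (p₀ , q₀)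
      inPart = record
        { ys = v ∷ b ∷ l ; ms = ms ; h∈ys = there (there (start∈ path)) ; v∈ys = here refl
        ; reachY = λ { (here refl) → ε ; (there (here refl)) → (bv , here refl) ◅ ε
                     ; (there (there i)) → Star.map (λ { (e , j) → e , there (there j) }) (walkToEnd path i)
                         ◅◅ (db , there (here refl)) ◅ (bv , here refl) ◅ ε }
        ; heads = λ { (here refl) → here refl ; (there (here refl)) → there (here refl)
                    ; (there (there i)) → there (there (arc-head path i)) }
        ; head≢h = λ { (here refl) → h≢v ∘ sym ; (there (here refl)) → λ { refl → true≢false bv ¬hv }
                     ; (there (there i)) → arc-head≢start path i }
        ; e₀∉ms = λ { (here refl) → q₀≢v refl ; (there (here refl)) → true≢false bv ¬q₀v ; (there (there i)) → e₀∉l i } }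

      open Hub G (joinParts ch outPart inPart)

      fromV : ∀ {t} → (v , t) ∉ ms
      fromV (here refl)         = b≢v refl
      fromV (there (here refl)) = v∉l d∈l
      fromV (there (there i))   = v∉l (proj₁ (arc-tail path i))

      fromB : ∀ {t} → t ≢ v → (b , t) ∉ ms
      fromB t≢v (here refl)       = t≢v refl
      fromB _ (there (here refl)) = b∉l d∈l
      fromB _ (there (there i))   = b∉l (proj₁ (arc-tail path i))

      fromB₁ : ∀ {t} → (b₁ , t) ∉ ms
      fromB₁ (here refl)         = b₁≢b refl
      fromB₁ (there (here refl)) = b₁∉l d∈l
      fromB₁ (there (there i))   = b₁∉l (proj₁ (arc-tail path i))

      inY-b₁ : InY b₁
      inY-b₁ = inj₂ (back b₁v , λ i → true≢false (subst (λ x → E x v ≡ true) (O.tails i) b₁v) ¬uv)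

      Inside : Pred n → Set
      Inside S = ∀ y → S ∋ y → ¬ InX y

      -- Without `b₁`, a set with `v` is entered by b₁ → v; without `v`, path vertices in V₂ are
      -- reached from `v`, and those of V₁ before `d` by `early`. The three obligations are what
      -- remains.
      finishWith : ∀ r →
        (∀ S → Inside S → S ∋ b₁ → S ∌ r → GoodP S) →
        (∀ S → Inside S → S ∋ b → S ∌ b₁ → S ∌ r → GoodP S) →
        (∀ S → Inside S → S ∋ d → c ∌ d → S ∌ v → S ∌ b → S ∌ b₁ → S ∌ r → GoodP S) → GP G u v
      finishWith r atB₁ atB atD = hub r (fullQ inPart) pc
        where
        pc : DeficientP r
        pc S x x∈ S⊆ = inj₂ (go (bool-cases (S r)))
          where
          h∉ : S ∌ h
          h∉ = ∉-InX S⊆ (inj₁ O.h∈xs)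
          u∉ : S ∌ u
          u∉ = ∉-InX S⊆ (inj₁ O.u∈xs)
          byHead : S ∌ r → ∀ {s t} → S ∋ t → (s , t) ∈ ms → GoodP S
          byHead r∉ {s} {t} t∈ i with bool-cases (S b₁) | bool-cases (S v) | bool-cases (S b)
          ... | inj₁ p | _      | _      = atB₁ S S⊆ p r∉
          ... | inj₂ p | inj₁ q | _      = inj₁ (b₁ , v , (p , q , b₁v , fromB₁) , inY-b₁)
          ... | inj₂ p | inj₂ _ | inj₁ q = atB S S⊆ q p r∉
          byHead r∉ t∈ (here refl) | inj₂ _ | inj₂ q | inj₂ _ = ⊥-elim (true≢false t∈ q)
          byHead r∉ t∈ (there (here refl)) | inj₂ _ | inj₂ _ | inj₂ q = ⊥-elim (true≢false t∈ q)
          byHead r∉ {s} {t} t∈ (there (there i)) | inj₂ b₁∉ | inj₂ v∉ | inj₂ b∉ with bool-cases (c t) | t ≟ d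
          ... | inj₁ ct | _ = inj₁ (v , t , (v∉ , t∈ , adjˡ ct (∋∌⇒≢ {S = S} t∈ v∉) (noV (arc-head path i)) , fromV) , inj₁ (here refl))
          ... | inj₂ ¬ct | yes refl = atD S S⊆ t∈ ¬ct v∉ b∉ b₁∉ r∉
          ... | inj₂ ¬ct | no t≢d with early (arc-head path i) t≢d ¬ct
          ...   | inj₁ bt  = inj₁ (b , t , (b∉ , t∈ , bt , fromB (λ { refl → true≢false t∈ v∉ })) , inj₁ (there (here refl)))
          ...   | inj₂ b₁t = inj₁ (b₁ , t , (b₁∉ , t∈ , b₁t , fromB₁) , inY-b₁)
          go : S ∋ r ⊎ S ∌ r → GoodP S ⊎ (S ∋ r × (∃₂ λ s t → Entering S s t))
          go (inj₁ r∈) = inj₂ (r∈ , valid S x x∈ h∉ u∉)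
          go (inj₂ r∉) with entering S x∈ h∉
          ... | two {s₁} {t₁} {s₂} {t₂} (a₁ , b₁ , e₁) (a₂ , b₂ , e₂) diff with (s₁ , t₁) ∈ᵃ? ms | (s₂ , t₂) ∈ᵃ? ms
          ...   | yes i | _     = inj₁ (byHead r∉ b₁ i)
          ...   | no _  | yes j = inj₁ (byHead r∉ b₂ j)
          ...   | no i  | no j  = inj₁ (inj₂ (two (a₁ , b₁ , e₁ , i) (a₂ , b₂ , e₂ , j) diff))

      arc-b₁b : ∀ {S} → E b₁ b ≡ true → S ∋ b → S ∌ b₁ → GoodP S
      arc-b₁b b₁b b∈ b₁∉ = inj₁ (b₁ , b , (b₁∉ , b∈ , b₁b , fromB₁) , inY-b₁)

      arc-b₁d : ∀ {S} → E b₁ d ≡ true → S ∋ d → S ∌ b₁ → GoodP S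
      arc-b₁d b₁d d∈ b₁∉ = inj₁ (b₁ , d , (b₁∉ , d∈ , b₁d , fromB₁) , inY-b₁)

      -- The vertex `b₁` is deficient if it dominates `d` or `d` is in V₂; otherwise d → b₁ → b
      -- makes `d` the deficient vertex.
      good-end : E b₁ b ≡ true → GP G u v
      good-end b₁b with bool-cases (c d) | bool-cases (E b₁ d)
      ... | inj₁ cd | _ = finishWith b₁ (λ S S⊆ p q → ⊥-elim (true≢false p q)) (λ S S⊆ b∈ b₁∉ _ → arc-b₁b b₁b b∈ b₁∉)
              (λ S S⊆ _ ¬cd _ _ _ _ → ⊥-elim (true≢false cd ¬cd))
      ... | inj₂ _ | inj₁ b₁d = finishWith b₁ (λ S S⊆ p q → ⊥-elim (true≢false p q)) (λ S S⊆ b∈ b₁∉ _ → arc-b₁b b₁b b∈ b₁∉)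
              (λ S S⊆ d∈ _ _ _ b₁∉ _ → arc-b₁d b₁d d∈ b₁∉)
      ... | inj₂ _ | inj₂ ¬b₁d = finishWith d
              (λ S S⊆ b₁∈ d∉ → inj₁ (d , b₁ , (d∉ , b₁∈ , adjˡ cb₁ (λ { refl → b₁∉l d∈l }) ¬b₁d , fromD) , inj₁ (there (there d∈l))))
              (λ S S⊆ b∈ b₁∉ _ → arc-b₁b b₁b b∈ b₁∉)
              (λ S S⊆ d∈ _ _ _ _ d∉ → ⊥-elim (true≢false d∈ d∉))
        where
        fromD : (d , b₁) ∉ ms
        fromD (here refl)         = b∉l d∈l
        fromD (there (here refl)) = b₁≢b refl
        fromD (there (there i))   = proj₂ (arc-tail path i) refl

      other-end : E b b₁ ≡ true →
        (c ∌ d → E b₁ d ≡ false → ∀ S → Inside S → S ∋ d → S ∌ v → S ∌ b → S ∌ b₁ → GoodP S) → GP G u v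
      other-end bb₁ atD = finishWith b
        (λ S S⊆ b₁∈ b∉ → inj₁ (b , b₁ , (b∉ , b₁∈ , bb₁ , fromB (arc⇒≢ b₁v)) , inj₁ (there (here refl))))
        (λ S S⊆ b∈ _ b∉ → ⊥-elim (true≢false b∈ b∉))
        (λ S S⊆ d∈ ¬cd v∉ b∉ b₁∉ _ → Sum.[_,_]′ (λ b₁d → arc-b₁d b₁d d∈ b₁∉) (λ ¬b₁d → atD ¬cd ¬b₁d S S⊆ d∈ v∉ b∉ b₁∉)
          (bool-cases (E b₁ d)))

    module Choose {b b₁ : Fin n} (db : E d b ≡ true) (bv : E b v ≡ true) (b₁v : E b₁ v ≡ true) (b₁≢b : b₁ ≢ b)
      (valid : ValidArcs ((b , v) ∷ (d , b) ∷ arcsOf l))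
      (early : ∀ {x} → x ∈ l → x ≢ d → E x b ≡ false) where

      cb : c ∋ b
      cb = tailV₂ ¬cv bv

      early′ : ∀ {x} → x ∈ l → x ≢ d → E b x ≡ true
      early′ {x} i x≢d = adjʳ cb (λ { refl → true≢false bv (noV i) }) (early i x≢d)

      module A = WithEnd db bv b₁v b₁≢b valid (λ i ne _ → inj₁ (early′ i ne))

      -- If b₁ → b fails, the end of the path is rerouted through `b₁`, which exchanges `b` and
      -- `b₁`. If that is not valid, the violating set `S₀` controls the sets through `d`.
      result : GP G u v
      result with bool-cases (E b₁ b)
      ... | inj₁ b₁b = A.good-end b₁b
      ... | inj₂ ¬b₁b with bool-cases (E d b₁) | valid? G h u ((b₁ , v) ∷ (d , b₁) ∷ arcsOf l)
      ...   | inj₂ ¬db₁ | _ = A.other-end (adjʳ cb b₁≢b ¬b₁b)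
                (λ ¬cd ¬b₁d → ⊥-elim (true≢false (adjˡ A.cb₁ (λ { refl → true≢false b₁v (noV (end∈ path)) }) ¬b₁d) ¬db₁))
      ...   | inj₁ db₁ | inj₁ valid₁ = WithEnd.good-end db₁ b₁v bv (b₁≢b ∘ sym) valid₁
                (λ i ne _ → inj₂ (early′ i ne)) (adjʳ cb b₁≢b ¬b₁b)
      ...   | inj₁ db₁ | inj₂ (S₀ , x₀ , x₀∈ , h∉₀ , u∉₀ , only) = A.other-end bb₁ atD
        where
        open Hub G (joinParts ch outPart A.inPart)
        bb₁ : E b b₁ ≡ true
        bb₁ = adjʳ cb b₁≢b ¬b₁b
        ¬db-only : (d , b) ∉ (b₁ , v) ∷ (d , b₁) ∷ arcsOf l
        ¬db-only (here e)          = A.b₁∉l (subst (_∈ l) (cong proj₁ e) A.d∈l)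
        ¬db-only (there (here e))  = b₁≢b (sym (cong proj₂ e))
        ¬db-only (there (there i)) = A.b∉l (arc-head path i)
        ¬b-only : ∀ {t} → (b , t) ∉ (b₁ , v) ∷ (d , b₁) ∷ arcsOf l
        ¬b-only (here e)          = b₁≢b (sym (cong proj₁ e))
        ¬b-only (there (here e))  = A.b∉l (subst (_∈ l) (sym (cong proj₁ e)) A.d∈l)
        ¬b-only (there (there i)) = A.b∉l (proj₁ (arc-tail path i))
        d-if-b : S₀ ∋ b → S₀ ∋ d
        d-if-b b∈ with bool-cases (S₀ d)
        ... | inj₁ p = p
        ... | inj₂ d∉ = ⊥-elim (¬db-only (only d∉ b∈ db))
        b-if : ∀ {t} → S₀ ∋ t → E b t ≡ true → S₀ ∋ b
        b-if t∈ bt with bool-cases (S₀ b)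
        ... | inj₁ p = p
        ... | inj₂ b∉ = ⊥-elim (¬b-only (only b∉ t∈ bt))
        -- The violating set contains v, b and d but not b₁.
        facts : S₀ ∋ d × S₀ ∌ b₁
        facts with valid S₀ x₀ x₀∈ h∉₀ u∉₀
        ... | s , t , s∉ , t∈ , e , free with only s∉ t∈ e
        ...   | here refl          = d-if-b (b-if t∈ bv) , s∉
        ...   | there (here refl)  = ⊥-elim (true≢false (d-if-b (b-if t∈ bb₁)) s∉)
        ...   | there (there i)    = ⊥-elim (free (there (there i)))
        atD : c ∌ d → E b₁ d ≡ false → ∀ S → A.Inside S → S ∋ d → S ∌ v → S ∌ b → S ∌ b₁ → GoodP S
        -- The arc entering the intersection cannot come from outside `S₀`: it would be on the
        -- rerouted path, hence used or with its head outside `S`. So its tail is in `S₀` but not in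
        -- `S`, and it lies on the in-tree or dominates `h`.
        atD _ _ S S⊆ d∈ v∉ b∉ b₁∉ with valid (λ x → S x ∧ S₀ x) d (∧-true d∈ (proj₁ facts))
                 (¬true⇒false λ p → true≢false (proj₂ (∧-true⁻ {S h} p)) h∉₀)
                 (¬true⇒false λ p → true≢false (proj₂ (∧-true⁻ {S u} p)) u∉₀)
        ... | y , t , y∉ , t∈ , e , free with ∧-true⁻ {S t} t∈
        ...   | t∈S , t∈S₀ with bool-cases (S₀ y)
        ...     | inj₂ y∉₀ = ⊥-elim (escape (only y∉₀ t∈S₀ e))
          where
          escape : (y , t) ∈ (b₁ , v) ∷ (d , b₁) ∷ arcsOf l → ⊥
          escape (here refl)         = true≢false t∈S v∉
          escape (there (here refl)) = true≢false t∈S b₁∉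
          escape (there (there i))   = free (there (there i))
        ...     | inj₁ y∈₀ = inj₁ (y , t , (y∉S , t∈S , e , free) , inY (y ∈? (v ∷ b ∷ l)) (bool-cases (E y h)))
          where
          y∉S : S ∌ y
          y∉S = ¬true⇒false λ p → true≢false (∧-true p y∈₀) y∉
          inY : Dec (y ∈ v ∷ b ∷ l) → E y h ≡ true ⊎ E y h ≡ false → InY y
          inY (yes i) _         = inj₁ i
          inY (no _) (inj₁ yh)  = inj₂ (yh , λ i → true≢false (subst (λ x → S₀ x ≡ true) (O.tails i) y∈₀) u∉₀)
          inY (no ¬i) (inj₂ ¬yh) = ⊥-elim (away (only h∉₀ y∈₀ (adjʳ ch (∋∌⇒≢ {S = S₀} y∈₀ h∉₀) ¬yh)))
            where
            away : (h , y) ∈ (b₁ , v) ∷ (d , b₁) ∷ arcsOf l → ⊥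
            away (here refl)         = true≢false b₁v ¬hv
            away (there (here refl)) = true≢false y∈₀ (proj₂ facts)
            away (there (there j))   = ¬i (there (there (arc-head path j)))

  long : GP G u v
  long with firstToV h≢v (p₀ , q₀)
  ... | F , avoids with another-in G (FirstToV.bv F)
  ...   | b₁ , b₁≢b , b₁v = byPath (FirstToV.path F) (FirstToV.first F) (FirstToV.v∉l F) (FirstToV.valid F)
            (λ i → avoids (λ { refl → q₀≢v refl }) (there i))
    where
    open FirstToV F using (b; bv)
    byPath : ∀ {l} → Path ⟦ E ⟧ h b l → (∀ {x} → x ∈ l → x ≢ b → E x v ≡ false) → v ∉ l →
      ValidArcs ((b , v) ∷ arcsOf l) → (p₀ , q₀) ∉ arcsOf l → GP G u v
    byPath start _ _ _ _ = ⊥-elim (true≢false bv ¬hv)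
    byPath (snoc {x = y} {l = l} p yb b∉l) first v∉ valid e₀∉ with truncate (λ x → E x b) p
    ... | inj₁ none = ⊥-elim (true≢false yb (none (end∈ p)))
    ... | inj₂ t = WithPath.Choose.result T.path
            (λ i → first (there (T.sub i)) (λ { refl → b∉l (T.sub i) })) (λ i → v∉ (there (T.sub i)))
            (λ i → e₀∉ (arcs-old p (T.arcs⊆ i)))
            T.b∈Q bv b₁v b₁≢b
            (shortcut ((b , v) ∷ []) (λ x → E x b) t p b∉l yb (λ { (here refl) → v∉ })
              (subst (λ es → ValidArcs ((b , v) ∷ es)) (arcsOf-snoc p) valid))
            T.first
      where module T = Truncation t

-- u in V₂ and v in V₁, and no path u → a → v

root-V₂-V₁ : ∀ {n} (G : Graph n) {u v : Fin n} → Graph.c G ∋ u → Graph.c G ∌ v → Graph.E G u v ≡ false →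
  (∀ a → Graph.c G ∋ a → Graph.E G u a ≡ true → Graph.E G a v ≡ false) → GP G u v
root-V₂-V₁ {n} G {u} {v} cu ¬cv ¬uv noMiddle = Long.long G {p₀ = u} {q₀ = u} cu ¬cv ¬uv ¬uv far
  (λ { refl → true≢false cu ¬cv }) ¬uv outPart
  (λ i S x x∈ S⊆ → inj₂ (Hub.lossless-Q G (joinParts cu outPart i) S x∈
    (Hub.∉-InY G (joinParts cu outPart i) S⊆ (inj₁ (InPart.h∈ys i))) λ _ _ ()))
  where
  open Graph G
  outPart : OutPart G u u
  outPart = record { xs = u ∷ [] ; ps = [] ; h∈xs = here refl ; u∈xs = here refl
                   ; reachX = λ { (here refl) → ε } ; tails = λ () ; heads = λ () }
  far : ∀ x → E x v ≡ true → E u x ≡ false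
  far x xv = ¬true⇒false λ ux → true≢false xv (noMiddle x (GraphLemmas.tailV₂ G ¬cv xv) ux)

-- Both roots in V₁

module BothV₁ {n : ℕ} (G : Graph n) {u v : Fin n} (¬cu : Graph.c G ∌ u) (¬cv : Graph.c G ∌ v) (u≢v : u ≢ v)
  (noMiddle : ∀ a → Graph.c G ∋ a → Graph.E G u a ≡ true → Graph.E G a v ≡ false) where
  open Graph G
  open GraphLemmas G

  ¬uv : E u v ≡ false
  ¬uv = ind ¬cu ¬cv

  module At {a a′ : Fin n} (ua : E u a ≡ true) (ua′ : E u a′ ≡ true) (aa′ : E a a′ ≡ true) where

    ca : c ∋ a
    ca = headV₂ ¬cu ua
    ca′ : c ∋ a′
    ca′ = headV₂ ¬cu ua′
    ¬av : E a v ≡ false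
    ¬av = noMiddle a ca ua
    ¬a′v : E a′ v ≡ false
    ¬a′v = noMiddle a′ ca′ ua′
    a≢v : a ≢ v
    a≢v refl = true≢false ca ¬cv
    a′≢v : a′ ≢ v
    a′≢v refl = true≢false ca′ ¬cv

    outPart : OutPart G u a
    outPart = record
      { xs = u ∷ a ∷ [] ; ps = (u , a) ∷ [] ; h∈xs = there (here refl) ; u∈xs = here refl
      ; reachX = λ { (here refl) → ε ; (there (here refl)) → (ua , here refl) ◅ ε }
      ; tails = λ { (here refl) → refl } ; heads = λ { (here refl) → refl } }

    -- The critical set is `u` alone, which loses u → a. Its arc to `a′` is safe as long as a → a′
    -- attaches `a′` to the hub, which is why the in-tree has to avoid that arc.
    fullQ : ∀ (i : InPart G a v (a , a′)) → Hub.FullQ G (joinParts ca outPart i)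
    fullQ i S x x∈ S⊆ = go (bool-cases (S u)) (other-member S u)
      where
      open Hub G (joinParts ca outPart i)
      open InPart i using (h∈ys; v∈ys; e₀∉ms)
      a∉ : S ∌ a
      a∉ = ∉-InY S⊆ (inj₁ h∈ys)
      v∉ : S ∌ v
      v∉ = ∉-InY S⊆ (inj₁ v∈ys)
      go : S ∋ u ⊎ S ∌ u → (∃ λ x → S ∋ x × u ≢ x) ⊎ (∀ {x} → x ≢ u → S ∌ x) → GP G u v ⊎ GoodQ S
      go (inj₂ u∉) _ = inj₂ (lossless-Q S x∈ a∉ λ { s∈ _ (here refl) → true≢false s∈ u∉ })
      go (inj₁ u∈) (inj₁ (x , x∈ , u≢x)) = Sum.map₂
        (λ t → inj₂ (Two-map (λ { (p , q , e , ne) → p , q , e , λ { (here j) → ne j } }) t))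
        (three-leaving G S (u , a) ¬uv u∈ x∈ u≢x v∉ a∉ (a≢v ∘ sym))
      go (inj₁ u∈) (inj₂ rest) = inj₂ (inj₁ (u , a′ , (u∈ , rest (arc⇒≢ ua′ ∘ sym) , ua′ , λ { (here refl) → true≢false aa′ irr })
        , inj₂ (aa′ , e₀∉ms)))

    far-from-v : (∀ x → E x v ≡ true → E a x ≡ false) → GP G u v
    far-from-v far = Long.long G ca ¬cv ¬av ¬uv far a′≢v ¬a′v outPart fullQ

    -- No set is entered by both in-tree arcs. Three arcs enter a set with `v` and a further vertex,
    -- or the cut is tight; `v` alone is entered from `b₁`, which is attached to `a`. This leaves
    -- `b` as the deficient vertex.
    near-v : ∀ {b b₁} → E a b ≡ true → E b v ≡ true → b₁ ≢ b → E b₁ v ≡ true → E b₁ a ≡ true → GP G u v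
    near-v {b} {b₁} ab bv b₁≢b b₁v b₁a = hub b (fullQ inPart) pc
      where
      inPart : InPart G a v (a , a′)
      inPart = record
        { ys = a ∷ b ∷ v ∷ [] ; ms = (a , b) ∷ (b , v) ∷ [] ; h∈ys = here refl ; v∈ys = there (there (here refl))
        ; reachY = λ { (here refl) → (ab , here refl) ◅ (bv , there (here refl)) ◅ ε
                     ; (there (here refl)) → (bv , there (here refl)) ◅ ε ; (there (there (here refl))) → ε }
        ; heads = λ { (here refl) → there (here refl) ; (there (here refl)) → there (there (here refl)) }
        ; head≢h = λ { (here refl) refl → true≢false ab irr ; (there (here refl)) → a≢v ∘ sym }
        ; e₀∉ms = λ { (here refl) → true≢false bv ¬a′v ; (there (here e)) → a′≢v (cong proj₂ e) } }
      open Hub G (joinParts ca outPart inPart)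
      pc : DeficientP b
      pc S x x∈ S⊆ = go (bool-cases (S v)) (bool-cases (S b)) (other-member S v)
        where
        u∉ : S ∌ u
        u∉ = ∉-InX S⊆ (inj₁ (here refl))
        a∉ : S ∌ a
        a∉ = ∉-InX S⊆ (inj₁ (there (here refl)))
        Outcome : Set
        Outcome = GP G u v ⊎ (GoodP S ⊎ (S ∋ b × (∃₂ λ s t → Entering S s t)))
        rich : ∀ e → (∀ {s t} → S ∌ s → S ∋ t → (s , t) ∈ (a , b) ∷ (b , v) ∷ [] → (s , t) ≡ e) →
          S ∋ v → (∃ λ x → S ∋ x × v ≢ x) → Outcome
        rich e lost v∈ (x , x∈ , v≢x) = Sum.map₂
          (λ t → inj₁ (inj₂ (Two-map (λ { (p , q , f , ne) → p , q , f , λ j → ne (lost p q j) }) t)))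
          (three-entering G S e ¬uv u∉ a∉ (arc⇒≢ ua) v∈ x∈ v≢x)
        go : S ∋ v ⊎ S ∌ v → S ∋ b ⊎ S ∌ b → (∃ λ x → S ∋ x × v ≢ x) ⊎ (∀ {x} → x ≢ v → S ∌ x) → Outcome
        go (inj₁ v∈) (inj₁ b∈) (inj₁ m) = rich (a , b)
          (λ { _ _ (here refl) → refl ; s∉ _ (there (here refl)) → ⊥-elim (true≢false b∈ s∉) }) v∈ m
        go (inj₁ v∈) (inj₂ b∉) (inj₁ m) = rich (b , v)
          (λ { _ t∈ (here refl) → ⊥-elim (true≢false t∈ b∉) ; _ _ (there (here refl)) → refl }) v∈ m
        go (inj₁ v∈) _ (inj₂ rest) = inj₂ (inj₁ (inj₁ (b₁ , v , (rest (arc⇒≢ b₁v) , v∈ , b₁v ,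
          λ { (here refl) → true≢false b₁v ¬av ; (there (here e)) → b₁≢b (cong proj₁ e) })
          , inj₂ (b₁a , λ { (here refl) → true≢false b₁v ¬uv }))))
        go (inj₂ v∉) (inj₁ b∈) _ = inj₂ (inj₂ (b∈ , one-lost-P S x∈ a∉
          λ { _ _ (here refl) → refl ; _ t∈ (there (here refl)) → ⊥-elim (true≢false t∈ v∉) }))
        go (inj₂ v∉) (inj₂ b∉) _ = inj₂ (inj₁ (lossless-P S x∈ a∉
          λ { _ t∈ (here refl) → true≢false t∈ b∉ ; _ t∈ (there (here refl)) → true≢false t∈ v∉ }))

    -- The out-branching contains u → a → b → v → a′ and b → b₁, the in-branching a → a′, b → u → a′ → b₁ → v.
    crossed : ∀ {b b₁} → E a b ≡ true → E b v ≡ true → E b b₁ ≡ true → E a′ b₁ ≡ true → E b₁ v ≡ true → GP G u v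
    crossed {b} {b₁} ab bv bb₁ a′b₁ b₁v = H.hub b
      -- Both trees contain all ends of the used arcs, so nothing is lost on either side.
      (λ S x x∈ S⊆ → inj₂ (H.lossless-Q S x∈ (H.∉-InY S⊆ (inj₁ (there (there (here refl)))))
        λ s∈ _ i → S⊆ _ s∈ (inj₁ (Core.tails core i))))
      (λ S x x∈ S⊆ → inj₂ (inj₁ (H.lossless-P S x∈ (H.∉-InX S⊆ (inj₁ (there (there (here refl)))))
        λ _ t∈ i → S⊆ _ t∈ (inj₁ (Core.heads core i)))))
      where
      cb : c ∋ b
      cb = tailV₂ ¬cv bv
      va′ : E v a′ ≡ true
      va′ = adjˡ ca′ a′≢v ¬a′v
      ¬ub : E u b ≡ false
      ¬ub = ¬true⇒false λ ub → true≢false bv (noMiddle b cb ub)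
      b≢u : b ≢ u
      b≢u refl = true≢false cb ¬cu
      bu : E b u ≡ true
      bu = adjʳ cb (b≢u ∘ sym) ¬ub
      b₁≢u : b₁ ≢ u
      b₁≢u refl = true≢false b₁v ¬uv
      a≢a′ : a ≢ a′
      a≢a′ = arc⇒≢ aa′
      u≢a : u ≢ a
      u≢a = arc⇒≢ ua
      u≢a′ : u ≢ a′
      u≢a′ = arc⇒≢ ua′
      b≢a : b ≢ a
      b≢a refl = true≢false bv ¬av
      b≢a′ : b ≢ a′
      b≢a′ refl = true≢false bv ¬a′v
      b₁≢a : b₁ ≢ a
      b₁≢a refl = true≢false b₁v ¬av
      b≢b₁ : b ≢ b₁
      b≢b₁ = arc⇒≢ bb₁
      all : List (Fin n)
      all = u ∷ v ∷ a ∷ a′ ∷ b ∷ b₁ ∷ []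
      pattern 0th p = here p
      pattern 1st p = there (here p)
      pattern 2nd p = there (there (here p))
      pattern 3rd p = there (there (there (here p)))
      pattern 4th p = there (there (there (there (here p))))
      pattern 5th p = there (there (there (there (there (here p)))))
      core : Core G u v a
      core = record
        { xs = all ; ys = all
        ; ps = (u , a) ∷ (a , b) ∷ (b , v) ∷ (v , a′) ∷ (b , b₁) ∷ []
        ; ms = (u , a′) ∷ (a′ , b₁) ∷ (b₁ , v) ∷ (a , a′) ∷ (b , u) ∷ []
        ; w∈V₂ = ca ; w∈xs = there (there (here refl)) ; w∈ys = there (there (here refl))
        ; reachX = λ { (0th refl) → ε
                     ; (1st refl) → (ua , 0th refl) ◅ (ab , 1st refl) ◅ (bv , 2nd refl) ◅ ε
                     ; (2nd refl) → (ua , 0th refl) ◅ ε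
                     ; (3rd refl) → (ua , 0th refl) ◅ (ab , 1st refl) ◅ (bv , 2nd refl) ◅ (va′ , 3rd refl) ◅ ε
                     ; (4th refl) → (ua , 0th refl) ◅ (ab , 1st refl) ◅ ε
                     ; (5th refl) → (ua , 0th refl) ◅ (ab , 1st refl) ◅ (bb₁ , 4th refl) ◅ ε }
        ; reachY = λ { (0th refl) → (ua′ , 0th refl) ◅ (a′b₁ , 1st refl) ◅ (b₁v , 2nd refl) ◅ ε
                     ; (1st refl) → ε
                     ; (2nd refl) → (aa′ , 3rd refl) ◅ (a′b₁ , 1st refl) ◅ (b₁v , 2nd refl) ◅ ε
                     ; (3rd refl) → (a′b₁ , 1st refl) ◅ (b₁v , 2nd refl) ◅ ε
                     ; (4th refl) → (bu , 4th refl) ◅ (ua′ , 0th refl) ◅ (a′b₁ , 1st refl) ◅ (b₁v , 2nd refl) ◅ ε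
                     ; (5th refl) → (b₁v , 2nd refl) ◅ ε }
        ; tails = λ { (0th refl) → 0th refl ; (1st refl) → 2nd refl ; (2nd refl) → 4th refl ; (3rd refl) → 1st refl
                    ; (4th refl) → 4th refl }
        ; heads = λ { (0th refl) → 3rd refl ; (1st refl) → 5th refl ; (2nd refl) → 1st refl ; (3rd refl) → 3rd refl
                    ; (4th refl) → 0th refl }
        ; disj = λ { (0th refl) (0th e) → a≢a′ (cong proj₂ e)
                   ; (0th refl) (1st e) → u≢a′ (cong proj₁ e)
                   ; (0th refl) (2nd e) → b₁≢u (sym (cong proj₁ e))
                   ; (0th refl) (3rd e) → u≢a (cong proj₁ e)
                   ; (0th refl) (4th e) → b≢u (sym (cong proj₁ e))
                   ; (1st refl) (0th e) → u≢a (sym (cong proj₁ e))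
                   ; (1st refl) (1st e) → a≢a′ (cong proj₁ e)
                   ; (1st refl) (2nd e) → b₁≢a (sym (cong proj₁ e))
                   ; (1st refl) (3rd e) → b≢a′ (cong proj₂ e)
                   ; (1st refl) (4th e) → b≢a (sym (cong proj₁ e))
                   ; (2nd refl) (0th e) → b≢u (cong proj₁ e)
                   ; (2nd refl) (1st e) → b≢a′ (cong proj₁ e)
                   ; (2nd refl) (2nd e) → b≢b₁ (cong proj₁ e)
                   ; (2nd refl) (3rd e) → b≢a (cong proj₁ e)
                   ; (2nd refl) (4th e) → u≢v (sym (cong proj₂ e))
                   ; (3rd refl) (0th e) → u≢v (sym (cong proj₁ e))
                   ; (3rd refl) (1st e) → a′≢v (sym (cong proj₁ e))
                   ; (3rd refl) (2nd e) → a′≢v (cong proj₂ e)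
                   ; (3rd refl) (3rd e) → a≢v (sym (cong proj₁ e))
                   ; (3rd refl) (4th e) → u≢a′ (sym (cong proj₂ e))
                   ; (4th refl) (0th e) → b≢u (cong proj₁ e)
                   ; (4th refl) (1st e) → b≢a′ (cong proj₁ e)
                   ; (4th refl) (2nd e) → b≢b₁ (cong proj₁ e)
                   ; (4th refl) (3rd e) → b≢a (cong proj₁ e)
                   ; (4th refl) (4th e) → b₁≢u (cong proj₂ e) } }
      module H = Hub G core

both-V₁ : ∀ {n} (G : Graph n) {u v : Fin n} → Graph.c G ∌ u → Graph.c G ∌ v → u ≢ v →
  (∀ a → Graph.c G ∋ a → Graph.E G u a ≡ true → Graph.E G a v ≡ false) → GP G u v
both-V₁ {n} G {u} {v} ¬cu ¬cv u≢v noMiddle = fromPair pair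
  where
  open Graph G
  open GraphLemmas G
  open BothV₁ G ¬cu ¬cv u≢v noMiddle

  Pair : Set
  Pair = ∃₂ λ a a′ → E u a ≡ true × E u a′ ≡ true × E a a′ ≡ true

  pair : Pair
  pair with cut (single u) {y = v} (single-∋ u) (single-∌ (u≢v ∘ sym))
  ... | two {s₁} {t₁} {s₂} {t₂} (p₁ , _ , e₁) (p₂ , _ , e₂) d with single-∋⁻ p₁ | single-∋⁻ p₂
  ...   | refl | refl with adj {t₁} {t₂} (λ { refl → d refl }) (inj₁ (headV₂ ¬cu e₁))
  ...     | inj₁ e = t₁ , t₂ , e₁ , e₂ , e
  ...     | inj₂ e = t₂ , t₁ , e₂ , e₁ , e

  -- In the reversed graph `b₁` and `b` play the parts of `a` and `a′`, and b₁ → a′ is the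
  -- hypothesis that `near-v` needs there; otherwise a′ → b₁ completes the crossed trees.
  dominated : ∀ {a a′ b b₁} → E u a ≡ true → E u a′ ≡ true → E a a′ ≡ true →
    E a b ≡ true → E a b₁ ≡ true → E b v ≡ true → E b₁ v ≡ true → E b b₁ ≡ true → GP G u v
  dominated {a} {a′} {b} {b₁} ua ua′ aa′ ab ab₁ bv b₁v bb₁ with bool-cases (E b₁ a′)
  ... | inj₁ b₁a′ = GP-op G (BothV₁.At.near-v (op G) ¬cv ¬cu (u≢v ∘ sym)
          (λ x cx xv → ¬true⇒false λ ux → true≢false xv (noMiddle x cx ux))
          b₁v bv bb₁ ab₁ ua (arc⇒≢ aa′ ∘ sym) ua′ b₁a′)
  ... | inj₂ ¬b₁a′ = At.crossed ua ua′ aa′ ab bv bb₁ (adjʳ (headV₂ ¬cu ua′) (λ { refl → true≢false b₁v (noMiddle _ (headV₂ ¬cu ua′) ua′) }) ¬b₁a′) b₁v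

  fromPair : Pair → GP G u v
  fromPair (a , a′ , ua , ua′ , aa′) with any? (λ b → true? (E a b) ×-dec true? (E b v))
  ... | no none = At.far-from-v ua ua′ aa′ (λ x xv → ¬true⇒false λ ax → none (x , ax , xv))
  ... | yes (b , ab , bv) with another-in G bv
  ...   | b₁ , b₁≢b , b₁v with bool-cases (E b₁ a)
  ...     | inj₁ b₁a = At.near-v ua ua′ aa′ ab bv b₁≢b b₁v b₁a
  ...     | inj₂ ¬b₁a with adj b₁≢b (inj₁ (tailV₂ ¬cv b₁v))
  ...       | inj₁ b₁b = dominated ua ua′ aa′ ab₁ ab b₁v bv b₁b
    where
    ab₁ : E a b₁ ≡ true
    ab₁ = adjˡ (tailV₂ ¬cv b₁v) (λ { refl → true≢false b₁v (noMiddle _ (headV₂ ¬cu ua) ua) }) ¬b₁a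
  ...       | inj₂ bb₁ = dominated ua ua′ aa′ ab ab₁ bv b₁v bb₁
    where
    ab₁ : E a b₁ ≡ true
    ab₁ = adjˡ (tailV₂ ¬cv b₁v) (λ { refl → true≢false b₁v (noMiddle _ (headV₂ ¬cu ua) ua) }) ¬b₁a

-- All pairs of roots

distinct-roots : ∀ {n} (G : Graph n) {u v : Fin n} → u ≢ v → GP G u v
distinct-roots G {u} {v} u≢v with bool-cases (Graph.E G u v)
... | inj₁ uv = arc-between-roots G uv
... | inj₂ ¬uv with any? (λ a → true? (Graph.c G a) ×-dec (true? (Graph.E G u a) ×-dec true? (Graph.E G a v)))
...   | yes (a , ca , ua , av) = middle G ca u≢v ua av ¬uv
...   | no none with bool-cases (Graph.c G u) | bool-cases (Graph.c G v)
...     | inj₁ cu  | inj₁ cv  = roots-V₂ G cu cv u≢v ¬uv λ a ca ua → ¬true⇒false λ av → none (a , ca , ua , av)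
...     | inj₁ cu  | inj₂ ¬cv = root-V₂-V₁ G cu ¬cv ¬uv λ a ca ua → ¬true⇒false λ av → none (a , ca , ua , av)
...     | inj₂ ¬cu | inj₁ cv  = GP-op G (root-V₂-V₁ (op G) cv ¬cu ¬uv λ a ca av → ¬true⇒false λ ua → none (a , ca , ua , av))
...     | inj₂ ¬cu | inj₂ ¬cv = both-V₁ G ¬cu ¬cv u≢v λ a ca ua → ¬true⇒false λ av → none (a , ca , ua , av)

stop-at : ∀ {n} {R : Fin n → Fin n → Set} {x u : Fin n} → Star R x u → Star (λ a b → R a b × a ≢ u) x u
stop-at ε = ε
stop-at {x = x} {u = u} (r ◅ w) with x ≟ u
... | yes refl = ε
... | no x≢u   = (r , x≢u) ◅ stop-at w

-- An in-branching rooted at u uses no arc leaving u, so u → a can be added to an out-branching rooted at a.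
shift-root : ∀ {n} (G : Graph n) {u a : Fin n} → Graph.E G u a ≡ true → GP G a u → GP G u u
shift-root G {u} {a} ua (χ , out , inn) = addArc χ u a
  , (λ x → (ua , addArc-new χ u a) ◅ Star.map (λ { (e , p) → e , addArc-old χ u a p }) (out x))
  , (λ x → Star.map (λ { ((e , p) , ne) → e , addArc-false χ u a (λ { refl → ne refl }) p }) (stop-at (inn x)))

all-roots : ∀ {n} (G : Graph n) (u v : Fin n) → GP G u v
all-roots G u v with u ≟ v
... | no u≢v = distinct-roots G u≢v
... | yes refl with bool-cases (Graph.c G u)
...   | inj₁ cu = root-V₂ G cu
...   | inj₂ _ with any? (λ y → ¬? (y ≟ u))
...     | no alone = (λ _ _ → true) , (λ x → path x) , (λ x → back x)
  where
  same : ∀ x → x ≡ u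
  same x with x ≟ u
  ... | yes e = e
  ... | no ne = ⊥-elim (alone (x , ne))
  path : ∀ {R : Fin _ → Fin _ → Set} x → Star R u x
  path x with same x
  ... | refl = ε
  back : ∀ {R : Fin _ → Fin _ → Set} x → Star R x u
  back x with same x
  ... | refl = ε
...     | yes (y , y≢u) with Graph.cut G (single u) {y = y} (single-∋ u) (single-∌ y≢u)
...       | two {s₁} {t₁} (p₁ , q₁ , e₁) _ _ with single-∋⁻ p₁
...         | refl = shift-root G e₁ (distinct-roots G (single-∌⁻ q₁))

-- The graph of a 2-arc-strong semicomplete split digraph

sum-zero : ∀ {n} (f : Fin n → ℕ) → (∀ x → f x ≡ 0) → sum (tabulate f) ≡ 0
sum-zero {zero}  f h = refl
sum-zero {suc n} f h rewrite h zero = sum-zero (f ∘ suc) (h ∘ suc)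

sum-one : ∀ {n} (f : Fin n → ℕ) s → f s ≡ 1 → (∀ x → x ≢ s → f x ≡ 0) → sum (tabulate f) ≡ 1
sum-one f zero    p h rewrite p = cong suc (sum-zero (f ∘ suc) λ x → h (suc x) λ ())
sum-one f (suc s) p h rewrite h zero (λ ()) = sum-one (f ∘ suc) s p λ x ne → h (suc x) λ { refl → ne refl }

∈─⇒∉ : ∀ {n} {x : Fin n} (p q : Subset n) → x ∈ˢ p ─ q → x ∉ˢ q
∈─⇒∉ (true ∷ p) (false ∷ q) here      ()
∈─⇒∉ (_ ∷ p)    (false ∷ q) (there i) (there j) = ∈─⇒∉ p q i j
∈─⇒∉ (_ ∷ p)    (true ∷ q)  (there i) (there j) = ∈─⇒∉ p q i j

oneArc : ∀ {n} → Fin n → Fin n → ArcSet n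
oneArc s t x with x ≟ s
... | yes _ = ⁅ t ⁆
... | no _  = ∅

oneArc-∋ : ∀ {n} (s t : Fin n) → t ∈ˢ oneArc s t s
oneArc-∋ s t with s ≟ s
... | yes _  = x∈⁅x⁆ t
... | no ne  = ⊥-elim (ne refl)

oneArc-size : ∀ {n} (s t : Fin n) → size (oneArc s t) ≡ 1
oneArc-size {n} s t = sum-one (λ x → ∣ oneArc s t x ∣) s at-s elsewhere
  where
  at-s : ∣ oneArc s t s ∣ ≡ 1
  at-s with s ≟ s
  ... | yes _ = ∣⁅x⁆∣≡1 t
  ... | no ne = ⊥-elim (ne refl)
  elsewhere : ∀ x → x ≢ s → ∣ oneArc s t x ∣ ≡ 0
  elsewhere x ne with x ≟ s
  ... | yes e = ⊥-elim (ne e)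
  ... | no _  = ∣⊥∣≡0 n

module FromDigraph {n : ℕ} (D : Digraph n) (strong : ArcStrong 2 D) (isSplit : SemicompleteSplit D) where
  open SemicompleteSplit isSplit

  E : BRel n
  E x y = lookup (arcs D x) y

  E⇒Arc : ∀ {x y} → E x y ≡ true → Arc D x y
  E⇒Arc {x} {y} e = lookup⇒[]= y (arcs D x) e

  Arc⇒E : ∀ {x y} → Arc D x y → E x y ≡ true
  Arc⇒E = []=⇒lookup

  side : ∀ x → (x ∈ˢ V₁) ⊎ (x ∈ˢ V₂)
  side x = x∈p∪q⁻ V₁ V₂ (subst (x ∈ˢ_) (sym cover) ∈⊤)

  inV₂ : Pred n
  inV₂ = lookup V₂

  ∌V₂⇒∈V₁ : ∀ {x} → inV₂ ∌ x → x ∈ˢ V₁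
  ∌V₂⇒∈V₁ {x} h with side x
  ... | inj₁ p = p
  ... | inj₂ q = ⊥-elim (true≢false ([]=⇒lookup q) h)

  adj-from : ∀ {x y} → x ≢ y → inV₂ ∋ x → E x y ≡ true ⊎ E y x ≡ true
  adj-from {x} {y} x≢y cx with side y
  ... | inj₁ q = Sum.map Arc⇒E Arc⇒E (swap (complete y x q (lookup⇒[]= x V₂ cx)))
  ... | inj₂ q = Sum.map Arc⇒E Arc⇒E (semicomplete x y (lookup⇒[]= x V₂ cx) q x≢y)

  -- The digraph stays strong without the first arc found, which yields the second.
  cut-arcs : ∀ (S : Pred n) {x y} → S ∋ x → S ∌ y → Two (λ s t → S ∋ s × S ∌ t × E s t ≡ true)
  cut-arcs S {x} {y} x∈ y∉ with cross S (strong (λ _ → ∅) (λ _ i → ⊥-elim (∉⊥ i)) small x y) x∈ y∉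
    where
    small : size {n} (λ _ → ∅) < 2
    small rewrite sum-zero (λ (_ : Fin n) → ∣ ∅ {n} ∣) (λ _ → ∣⊥∣≡0 n) = s≤s z≤n
  ... | s , t , s∈ , t∉ , a with p─q⊆p (arcs D s) ∅ a
  ...   | st with cross S (strong (oneArc s t) sub (≤-reflexive (cong suc (oneArc-size s t))) x y) x∈ y∉
    where
    sub : ∀ z {w} → w ∈ˢ oneArc s t z → w ∈ˢ arcs D z
    sub z i with z ≟ s
    ... | yes refl = subst (_∈ˢ arcs D z) (sym (x∈⁅y⁆⇒x≡y t i)) st
    ... | no _     = ⊥-elim (∉⊥ i)
  ...     | s′ , t′ , s′∈ , t′∉ , a′ = two (s∈ , t∉ , Arc⇒E st)
              (s′∈ , t′∉ , Arc⇒E (p─q⊆p (arcs D s′) (oneArc s t s′) a′))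
              λ { refl → ∈─⇒∉ (arcs D s′) (oneArc s t s′) a′ (oneArc-∋ s t) }

  graph : Graph n
  graph = record
    { E = E ; c = inV₂
    ; adj = λ { x≢y (inj₁ cx) → adj-from x≢y cx ; x≢y (inj₂ cy) → swap (adj-from (x≢y ∘ sym) cy) }
    ; ind = λ {x} {y} cx cy → ¬true⇒false λ e → independent x y (∌V₂⇒∈V₁ cx) (∌V₂⇒∈V₁ cy) (inj₁ (E⇒Arc e))
    ; irr = λ {x} → ¬true⇒false λ e → loopless D x (E⇒Arc e)
    ; cut = cut-arcs }

-- Rooted trees given by parents and ranks

record Parents {n : ℕ} (R : Fin n → Fin n → Set) (r : Fin n) : Set where
  field
    par  : Fin n → Fin n
    rk   : Fin n → ℕ
    arc  : ∀ x → x ≢ r → R (par x) x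
    down : ∀ x → x ≢ r → rk (par x) < rk x

module GrowTree {n : ℕ} {R : Fin n → Fin n → Set} {r : Fin n} (reach : ∀ x → Star R r x) where
  record Partial (M : Pred n) : Set where
    field
      par  : Fin n → Fin n
      rk   : Fin n → ℕ
      root : M ∋ r
      arc  : ∀ x → M ∋ x → x ≢ r → R (par x) x
      inM  : ∀ x → M ∋ x → x ≢ r → M ∋ par x
      down : ∀ x → M ∋ x → x ≢ r → rk (par x) < rk x
  base : Partial (single r)
  base = record { par = id ; rk = λ _ → 0 ; root = single-∋ r
    ; arc = λ x p ne → ⊥-elim (ne (single-∋⁻ p)) ; inM = λ x p ne → ⊥-elim (ne (single-∋⁻ p))
    ; down = λ x p ne → ⊥-elim (ne (single-∋⁻ p)) }
  module Add {M : Pred n} (pt : Partial M) {y z : Fin n} (y∈ : M ∋ y) (z∉ : M ∌ z) (yz : R y z) where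
    open Partial pt
    par′ : Fin n → Fin n
    par′ x = if ⌊ z ≟ x ⌋ then y else par x
    rk′ : Fin n → ℕ
    rk′ x = if ⌊ z ≟ x ⌋ then suc (rk y) else rk x
    par-old : ∀ {x} → M ∋ x → par′ x ≡ par x
    par-old {x} x∈ with z ≟ x
    ... | yes refl = ⊥-elim (true≢false x∈ z∉)
    ... | no _     = refl
    rk-old : ∀ {x} → M ∋ x → rk′ x ≡ rk x
    rk-old {x} x∈ with z ≟ x
    ... | yes refl = ⊥-elim (true≢false x∈ z∉)
    ... | no _     = refl
    par-new : par′ z ≡ y
    par-new with z ≟ z
    ... | yes _ = refl
    ... | no h  = ⊥-elim (h refl)
    rk-new : rk′ z ≡ suc (rk y)
    rk-new with z ≟ z
    ... | yes _ = refl
    ... | no h  = ⊥-elim (h refl)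
    arc′ : ∀ x → (M ⊕ z) ∋ x → x ≢ r → R (par′ x) x
    arc′ x p ne with ⊕-case M z p
    ... | inj₁ refl = subst (λ q → R q x) (sym par-new) yz
    ... | inj₂ q    = subst (λ q → R q x) (sym (par-old q)) (arc x q ne)
    inM′ : ∀ x → (M ⊕ z) ∋ x → x ≢ r → (M ⊕ z) ∋ par′ x
    inM′ x p ne with ⊕-case M z p
    ... | inj₁ refl = subst ((M ⊕ z) ∋_) (sym par-new) (⊕-old M z y∈)
    ... | inj₂ q    = subst ((M ⊕ z) ∋_) (sym (par-old q)) (⊕-old M z (inM x q ne))
    down′ : ∀ x → (M ⊕ z) ∋ x → x ≢ r → rk′ (par′ x) < rk′ x
    down′ x p ne with ⊕-case M z p
    ... | inj₁ refl rewrite par-new | rk-new | rk-old y∈ = ≤-refl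
    ... | inj₂ q rewrite par-old q | rk-old q | rk-old (inM x q ne) = down x q ne
    extended : Partial (M ⊕ z)
    extended = record { par = par′ ; rk = rk′ ; root = ⊕-old M z root ; arc = arc′ ; inM = inM′ ; down = down′ }
  grow : ∀ M → Partial M → (∀ x → M ∋ x) ⊎ (∃ λ x → M ∌ x × Partial (M ⊕ x))
  grow M pt with any? (λ x → M x Bool.≟ false)
  ... | no none = inj₁ (allOf M none)
  ... | yes (x , x∉) with cross M (reach x) (Partial.root pt) x∉
  ...   | y , z , y∈ , z∉ , yz = inj₂ (z , z∉ , Add.extended pt y∈ z∉ yz)

  parents : Parents R r
  parents with saturate {n} {Partial} {λ M → ∀ x → M ∋ x} grow (single r) base
  ... | M , pt , all = record { par = Partial.par pt ; rk = Partial.rk pt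
    ; arc = λ x → Partial.arc pt x (all x) ; down = λ x → Partial.down pt x (all x) }

argmax : ∀ {m} (f : Fin (suc m) → ℕ) → ∃ λ i → ∀ j → f j ≤ f i
argmax {zero}  f = zero , λ { zero → ≤-refl }
argmax {suc m} f with argmax (f ∘ suc)
... | i , h with ≤-total (f zero) (f (suc i))
...   | inj₁ le = suc i , λ { zero → le ; (suc j) → h j }
...   | inj₂ ge = zero , λ { zero → ≤-refl ; (suc j) → ≤-trans (h j) ge }

module RootedTree {n : ℕ} (T : Digraph n) {r : Fin n} (par : Fin n → Fin n) (rk : Fin n → ℕ)
  (down : ∀ x → x ≢ r → rk (par x) < rk x)
  (edge : ∀ {x y} → Adjacent T x y → (y ≢ r × par y ≡ x) ⊎ (x ≢ r × par x ≡ y))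
  (up : ∀ x → x ≢ r → Adjacent T x (par x)) where

  toRoot : ∀ x → Acc _<_ (rk x) → Star (Adjacent T) x r
  toRoot x (acc rs) with x ≟ r
  ... | yes refl = ε
  ... | no x≢r   = up x x≢r ◅ toRoot (par x) (rs (down x x≢r))

  connected : ∀ x y → Star (Adjacent T) x y
  connected x y = toRoot x (<-wellFounded _) ◅◅ Star.reverse swap (toRoot y (<-wellFounded _))

  highest : ∀ {x y} → Adjacent T x y → rk y ≤ rk x → par x ≡ y
  highest a le with edge a
  ... | inj₁ (y≢r , refl) = ⊥-elim (<-irrefl refl (≤-<-trans le (down _ y≢r)))
  ... | inj₂ (_ , e)      = e

  -- A vertex of maximal rank on a cycle has both cycle neighbours as parent.
  acyclic : ¬ UndirectedCycle T
  acyclic cyc = noCycle m≥2 c distinct step close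
    where
    open UndirectedCycle cyc
    noCycle : ∀ {m} → 2 ≤ m → (c : Fin (suc m) → Fin n) → Injective _≡_ _≡_ c →
      (∀ (i : Fin m) → Adjacent T (c (inject₁ i)) (c (suc i))) → Adjacent T (c (fromℕ m)) (c zero) → ⊥
    noCycle {suc (suc k)} (s≤s (s≤s _)) c distinct step close = at (view (proj₁ top)) (proj₂ top)
      where
      top : ∃ λ i → ∀ j → rk (c j) ≤ rk (c i)
      top = argmax (rk ∘ c)
      clash : ∀ i → (∀ j → rk (c j) ≤ rk (c i)) → ∀ {j k} → Adjacent T (c i) (c j) → Adjacent T (c i) (c k) → j ≢ k → ⊥
      clash i max {j} {k} a b j≢k = j≢k (distinct (trans (sym (highest a (max j))) (highest b (max k))))
      apart : ∀ (j : Fin (suc k)) → Fin.suc (suc j) ≢ inject₁ (inject₁ j)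
      apart j e = <⇒≢ (≤-trans (n<1+n (toℕ j)) (m≤n⇒m≤1+n ≤-refl))
        (sym (trans (cong toℕ e) (trans (toℕ-inject₁ (inject₁ j)) (toℕ-inject₁ j))))
      at : ∀ {i} → View i → (∀ j → rk (c j) ≤ rk (c i)) → ⊥
      at ‵fromℕ max = clash (fromℕ (suc (suc k))) max close (swap (step (fromℕ (suc k)))) λ ()
      at (‵inject₁ zero) max = clash zero max (step zero) (swap close) λ ()
      at (‵inject₁ (suc j)) max = clash (suc (inject₁ j)) max (step (suc j)) (swap (step (inject₁ j))) (apart j)

count-none : ∀ {n} (f : Pred n) → (∀ x → f ∌ x) → ∣ tabulate f ∣ ≡ 0
count-none {zero}  f h = refl
count-none {suc n} f h rewrite h zero = count-none (f ∘ suc) (h ∘ suc)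

count-one : ∀ {n} (f : Pred n) p → f ∋ p → (∀ x → x ≢ p → f ∌ x) → ∣ tabulate f ∣ ≡ 1
count-one f zero    i h rewrite i = cong suc (count-none (f ∘ suc) λ x → h (suc x) λ ())
count-one f (suc p) i h rewrite h zero (λ ()) = count-one (f ∘ suc) p i λ x ne → h (suc x) λ { refl → ne refl }

module ParentTree {n : ℕ} {R : Fin n → Fin n → Set} {r : Fin n} (P : Parents R r) where
  open Parents P

  isPar : BRel n
  isPar y x = not ⌊ x ≟ r ⌋ ∧ ⌊ par x ≟ y ⌋

  isPar⁻ : ∀ {y x} → isPar y x ≡ true → x ≢ r × par x ≡ y
  isPar⁻ {y} {x} p with ∧-true⁻ {not ⌊ x ≟ r ⌋} p
  ... | a , b = ⌊⌋-false⁻ (x ≟ r) (not-true⁻ a) , ⌊⌋-true⁻ (par x ≟ y) b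

  isPar⁺ : ∀ {x} → x ≢ r → isPar (par x) x ≡ true
  isPar⁺ {x} ne = ∧-true (not-true (⌊⌋-false (x ≟ r) ne)) (⌊⌋-true (par x ≟ par x) refl)

  isPar-loop : ∀ x → isPar x x ≡ true → ⊥
  isPar-loop _ p with isPar⁻ p
  ... | x≢r , e = <⇒≢ (down _ x≢r) (cong rk e)

  isPar-anti : ∀ {x y} → isPar x y ≡ true → isPar y x ≡ true → ⊥
  isPar-anti {x} p q with isPar⁻ p | isPar⁻ q
  ... | y≢r , refl | x≢r , e = <-irrefl refl (<-trans (down _ y≢r) (subst (λ z → rk z < rk x) e (down _ x≢r)))

  isPar-root : ∣ tabulate (λ y → isPar y r) ∣ ≡ 0
  isPar-root = count-none (λ y → isPar y r) λ y → ¬true⇒false λ p → proj₁ (isPar⁻ {y} p) refl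

  isPar-nonroot : ∀ x → x ≢ r → ∣ tabulate (λ y → isPar y x) ∣ ≡ 1
  isPar-nonroot x ne = count-one (λ y → isPar y x) (par x) (isPar⁺ ne) λ y h → ¬true⇒false λ p → h (sym (proj₂ (isPar⁻ p)))

  fromRel : (B : BRel n) → (∀ x → B x x ≡ true → ⊥) → Digraph n
  fromRel B irr = record { arcs = λ x → tabulate (B x) ; loopless = λ x i → irr x (trans (sym (lookup∘tabulate (B x) x)) ([]=⇒lookup i)) }

  arc⁻ : ∀ {B : BRel n} {irr} {x y} → Arc (fromRel B irr) x y → B x y ≡ true
  arc⁻ {B} {_} {x} {y} i = trans (sym (lookup∘tabulate (B x) y)) ([]=⇒lookup i)

  arc⁺ : ∀ {B : BRel n} {irr} {x y} → B x y ≡ true → Arc (fromRel B irr) x y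
  arc⁺ {B} {_} {x} {y} p = lookup⇒[]= y (tabulate (B x)) (trans (lookup∘tabulate (B x) y) p)

  outTree inTree : Digraph n
  outTree = fromRel isPar isPar-loop
  inTree  = fromRel (flip isPar) isPar-loop

  outTree-tree : OrientedTree outTree
  outTree-tree = record
    { oriented = λ x y p → isPar-anti (arc⁻ {isPar} {isPar-loop} (proj₁ p)) (arc⁻ {isPar} {isPar-loop} (proj₂ p))
    ; connected = connected ; acyclic = acyclic }
    where
    open RootedTree outTree par rk down
      (Sum.map (isPar⁻ ∘ arc⁻ {isPar} {isPar-loop}) (isPar⁻ ∘ arc⁻ {isPar} {isPar-loop}))
      (λ x ne → inj₂ (arc⁺ {isPar} {isPar-loop} (isPar⁺ ne)))

  inTree-tree : OrientedTree inTree
  inTree-tree = record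
    { oriented = λ x y p → isPar-anti (arc⁻ {flip isPar} {isPar-loop} (proj₁ p)) (arc⁻ {flip isPar} {isPar-loop} (proj₂ p))
    ; connected = connected ; acyclic = acyclic }
    where
    open RootedTree inTree par rk down
      (swap ∘ Sum.map (isPar⁻ ∘ arc⁻ {flip isPar} {isPar-loop}) (isPar⁻ ∘ arc⁻ {flip isPar} {isPar-loop}))
      (λ x ne → inj₁ (arc⁺ {flip isPar} {isPar-loop} (isPar⁺ ne)))

  outTree-in : ∀ x → inDegree outTree x ≡ ∣ tabulate (λ y → isPar y x) ∣
  outTree-in x = cong ∣_∣ (tabulate-cong λ y → lookup∘tabulate (isPar y) x)

  arc-in-R : ∀ {x y} → isPar x y ≡ true → R x y
  arc-in-R p with isPar⁻ p
  ... | y≢r , refl = arc _ y≢r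

theorem1p7 : ∀ (n : ℕ) (D : Digraph n) → ArcStrong 2 D → SemicompleteSplit D →
    ∀ (u v : Fin n) → GoodPair D u v
theorem1p7 n D strong isSplit u v with all-roots (FromDigraph.graph D strong isSplit) u v
... | χ , out , inn = O.outTree , I.inTree , outB , inB , disjoint
  where
  open FromDigraph D strong isSplit using (E; E⇒Arc)
  module O = ParentTree (GrowTree.parents out)
  -- The in-branching is grown as an out-tree from `v` along reversed arcs; `inTree` turns them
  -- back.
  module I = ParentTree (GrowTree.parents {R = λ a b → E b a ≡ true × χ b a ≡ false} (λ x → Star.reverse id (inn x)))
  outB : OutBranching D u O.outTree
  outB = record
    { spanning = λ x i → E⇒Arc (proj₁ (O.arc-in-R (O.arc⁻ {O.isPar} {O.isPar-loop} i)))
    ; tree = O.outTree-tree ; root = trans (O.outTree-in u) O.isPar-root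
    ; nonroot = λ x ne → trans (O.outTree-in x) (O.isPar-nonroot x ne) }
  inB : InBranching D v I.inTree
  inB = record
    { spanning = λ x i → E⇒Arc (proj₁ (I.arc-in-R (I.arc⁻ {flip I.isPar} {I.isPar-loop} i)))
    ; tree = I.inTree-tree ; root = I.isPar-root ; nonroot = I.isPar-nonroot }
  disjoint : ArcDisjoint O.outTree I.inTree
  disjoint x y (p , q) = true≢false
    (proj₂ (O.arc-in-R (O.arc⁻ {O.isPar} {O.isPar-loop} p)))
    (proj₂ (I.arc-in-R (I.arc⁻ {flip I.isPar} {I.isPar-loop} q)))
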